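{- For Lebesgue almost all $x\in(0,1)$, $$\liminf_{n\to\infty}\frac{\log R_n(x)-\log n}{\log\log n}=-\infty\quad\text{and}\quad\liminf_{n\to\infty}\frac{\log M_n(x)-\log n}{\log\log n}=0.$$
   Context: Signed Engel expansion: define $T\colon[0,1)\to[0,1)$ by: for $k\in\mathbb{N}$, $Tx=\lceil 1/x\rceil x-1$ if $x\in(\frac{1}{2k},\frac{1}{2k-1})$; $Tx=1-\lfloor 1/x\rfloor x$ if $x\in(\frac{1}{2k+1},\frac{1}{2k})$; $Tx=0$ if $x\in\{0\}\cup\{1/n\colon n\ge 2\}$. For $x\in(0,1)$, $d_1(x)=\lceil 1/x\rceil$ if $x\in[\frac{1}{2k},\frac{1}{2k-1})$ for some $k\in\mathbb{N}$, and $d_1(x)=\lfloor 1/x\rfloor$ if $x\in[\frac{1}{2k+1},\frac{1}{2k})$ for some $k\in\mathbb{N}$; $d_{n+1}(x)=d_1(T^nx)$. For irrational $x\in(0,1)$, $R_1(x)=d_1(x)$, $R_n(x)=d_n(x)/d_{n-1}(x)$ for $n\ge2$, and $M_n(x)=\max\{R_k(x)\colon 1\le k\le n\}$. -}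

module Defs where

open import Algebra.Bundles using (CommutativeRing; Semiring)
open import Axiom.ExcludedMiddle using (ExcludedMiddle)
open import Data.Bool.Base using (if_then_else_)
open import Data.Fin.Base using (toℕ)
open import Data.Integer.Base as ℤ using (ℤ; +_; -[1+_]; 0ℤ)
open import Data.Nat.Base as ℕ using (ℕ; zero; suc; _!)
open import Data.Nat.GeneralisedArithmetic using (fold)
open import Data.Product.Base using (Σ-syntax; ∃; ∃-syntax; _×_; _,_)
open import Data.Rational.Base as ℚ using (ℚ)
open import Level using (0ℓ) renaming (suc to lsuc)
open import Relation.Binary.Core using (Rel)
open import Relation.Binary.Structures using (IsStrictTotalOrder)
open import Relation.Nullary.Construct.Add.Extrema using (_±; [_])
open import Relation.Nullary.Decidable.Core using (yes; no; does)
open import Relation.Nullary.Negation.Core using (¬_)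
import Algebra.Definitions.RawSemiring as RawSemiringDefinitions
import Relation.Binary.Construct.Add.Extrema.NonStrict as AddExtrema

-- The real numbers are taken axiomatically, as a Dedekind-complete ordered
-- field; this determines them up to a unique isomorphism.
-- The value of 0# ⁻¹ is left unspecified.
record CompleteOrderedField : Set (lsuc 0ℓ) where
  field
    commutativeRing : CommutativeRing 0ℓ 0ℓ

  open CommutativeRing commutativeRing public

  infix 4 _<_ _≤_
  infix 9 _⁻¹

  field
    _⁻¹                : Carrier → Carrier
    ⁻¹-cong            : ∀ {x y} → x ≈ y → x ⁻¹ ≈ y ⁻¹
    ⁻¹-inverseʳ        : ∀ x → ¬ (x ≈ 0#) → x * x ⁻¹ ≈ 1#
    _<_                : Rel Carrier 0ℓ
    isStrictTotalOrder : IsStrictTotalOrder _≈_ _<_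
    0<1                : 0# < 1#
    +-monoʳ-<          : ∀ x {y z} → y < z → x + y < x + z
    *-pos              : ∀ {x y} → 0# < x → 0# < y → 0# < x * y

  _≤_ : Rel Carrier 0ℓ
  x ≤ y = ¬ (y < x)

  UpperBound : (Carrier → Set) → Carrier → Set
  UpperBound S u = ∀ x → S x → x ≤ u

  field
    supremum : (S : Carrier → Set) → ∃ S → ∃ (UpperBound S) →
               Σ[ s ∈ Carrier ] UpperBound S s × (∀ u → UpperBound S u → s ≤ u)

-- Excluded middle is the classical metatheory of the source; it is also what
-- allows total functions to be defined by cases on undecidable conditions.
module Analysis (lem : ExcludedMiddle 0ℓ) (reals : CompleteOrderedField) where

  open CompleteOrderedField reals public renaming (Carrier to ℝ)
  open IsStrictTotalOrder isStrictTotalOrder public using (_<?_)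
  open RawSemiringDefinitions (Semiring.rawSemiring semiring) public using (_^_; sum) renaming (_×_ to _·_)
  open AddExtrema _≤_ public using (_≤±_)

  infixl 7 _/_

  _/_ : ℝ → ℝ → ℝ
  x / y = x * y ⁻¹

  fromℕ : ℕ → ℝ
  fromℕ n = n · 1#

  fromℤ : ℤ → ℝ
  fromℤ (+ n)    = fromℕ n
  fromℤ -[1+ n ] = - fromℕ (suc n)

  fromℚ : ℚ → ℝ
  fromℚ q = fromℤ (ℚ.↥ q) / fromℤ (ℚ.↧ q)

  Irrational : ℝ → Set
  Irrational x = ¬ (∃[ q ] x ≈ fromℚ q)

  max : ℝ → ℝ → ℝ
  max x y = if does (x <? y) then y else x

  ∑< : ℕ → (ℕ → ℝ) → ℝ
  ∑< n f = sum {n} (λ i → f (toℕ i))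

  -- A witness of P if there is one, and the default value otherwise. Below, P
  -- always has at most one witness up to the equality of A.
  choose : {A : Set} → A → (A → Set) → A
  choose default P with lem {∃ P}
  ... | yes (a , _) = a
  ... | no _        = default

  ⌊_⌋ : ℝ → ℤ
  ⌊ y ⌋ = choose 0ℤ (λ m → fromℤ m ≤ y × y < fromℤ m + 1#)

  ⌈_⌉ : ℝ → ℤ
  ⌈ y ⌉ = choose 0ℤ (λ m → fromℤ m - 1# < y × y ≤ fromℤ m)

  _⟶_ : (ℕ → ℝ) → ℝ → Set
  a ⟶ l = ∀ ε → 0# < ε → ∃[ N ] (∀ n → N ℕ.≤ n → l - ε < a n × a n < l + ε)

  exp : ℝ → ℝ
  exp x = choose 0# ((λ n → ∑< n (λ k → (x ^ k) / fromℕ (k !))) ⟶_)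

  -- log y is 0# for y ≤ 0#.
  log : ℝ → ℝ
  log y = choose 0# (λ l → exp l ≈ y)

  IsInf : {I : Set} → (I → ℝ ±) → ℝ ± → Set
  IsInf f l = (∀ i → l ≤± f i) × (∀ u → (∀ i → u ≤± f i) → u ≤± l)

  IsSup : {I : Set} → (I → ℝ ±) → ℝ ± → Set
  IsSup f l = (∀ i → f i ≤± l) × (∀ u → (∀ i → f i ≤± u) → l ≤± u)

  -- liminf a = sup over n of inf over m ≥ n of a m, in [-∞, +∞].
  IsLiminf : (ℕ → ℝ) → ℝ ± → Set
  IsLiminf a l =
    Σ[ g ∈ (ℕ → ℝ ±) ] (∀ n → IsInf (λ j → [ a (n ℕ.+ j) ]) (g n)) × IsSup g l

  -- Lebesgue measure zero: for every ε > 0 there is a countable cover by open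
  -- intervals of total length at most ε.
  Null : (ℝ → Set) → Set
  Null S = ∀ ε → 0# < ε →
    Σ[ lo ∈ (ℕ → ℝ) ] Σ[ hi ∈ (ℕ → ℝ) ]
      (∀ i → lo i ≤ hi i) ×
      (∀ x → S x → ∃[ i ] lo i < x × x < hi i) ×
      (∀ n → ∑< n (λ i → hi i - lo i) ≤ ε)

  -- Lebesgue almost all x in (0,1).
  AlmostAll : (ℝ → Set) → Set
  AlmostAll P = Null (λ x → 0# < x × x < 1# × ¬ P x)

module SignedEngel (lem : ExcludedMiddle 0ℓ) (reals : CompleteOrderedField) where

  open Analysis lem reals public

  recip : ℕ → ℝ
  recip n = fromℕ n ⁻¹

  -- The three cases partition [0,1): the last one is x = 0 or x = 1/n with
  -- n ≥ 2. Values outside [0,1) are irrelevant.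
  T : ℝ → ℝ
  T x =
    if does (lem {∃[ k ] 1 ℕ.≤ k × recip (2 ℕ.* k) < x × x < recip (2 ℕ.* k ℕ.∸ 1)})
    then fromℤ ⌈ 1# / x ⌉ * x - 1#
    else if does (lem {∃[ k ] 1 ℕ.≤ k × recip (2 ℕ.* k ℕ.+ 1) < x × x < recip (2 ℕ.* k)})
    then 1# - fromℤ ⌊ 1# / x ⌋ * x
    else 0#

  -- The value is 0 outside (0,1), where d₁ is not defined in the source.
  d₁ : ℝ → ℤ
  d₁ x =
    if does (lem {∃[ k ] 1 ℕ.≤ k × recip (2 ℕ.* k) ≤ x × x < recip (2 ℕ.* k ℕ.∸ 1)})
    then ⌈ 1# / x ⌉
    else if does (lem {∃[ k ] 1 ℕ.≤ k × recip (2 ℕ.* k ℕ.+ 1) ≤ x × x < recip (2 ℕ.* k)})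
    then ⌊ 1# / x ⌋
    else 0ℤ

  -- d, R and M are indexed from 1; their values at index 0 are placeholders,
  -- which a liminf does not see.
  d : ℕ → ℝ → ℤ
  d zero    x = 0ℤ
  d (suc n) x = d₁ (fold x T n)

  R : ℕ → ℝ → ℝ
  R zero          x = 0#
  R (suc zero)    x = fromℤ (d 1 x)
  R (suc (suc n)) x = fromℤ (d (suc (suc n)) x) / fromℤ (d (suc n) x)

  M : ℕ → ℝ → ℝ
  M zero          x = 0#
  M (suc zero)    x = R 1 x
  M (suc (suc n)) x = max (M (suc n) x) (R (suc (suc n)) x)

{-# OPTIONS --safe #-}

-- Write y ∈ (1/(q+1), 1/q), and let e and o be the even and the odd one of q and
-- q + 1. Then d₁ y = e and T y = |e y - 1|, and T maps (1/(q+1), 1/q) affinely onto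
-- (0, 1/o). Hence, if y is uniform on (0, 1/m), then P(q ≥ t m) = 1/t for every
-- integer t ≥ 1, and given q the point T y is uniform on (0, 1/o): the pairs (m, q)
-- along an orbit form a Markov chain for which the integer parts of the ratios q/m
-- are independent, and these ratios agree with the R_n up to constant factors.
-- This gives, for almost all x:
-- * q < 2m infinitely often, so R_n ≤ 4 infinitely often (first liminf);
-- * for n = 2^(2^(i²+1)), P(some ratio among the first n is ≥ n 2^i) ≤ 2^(-i), so that
--   by Borel-Cantelli M_n ≤ 2^(i+1) n for all large i, while log log n ≥ i² log 2;
-- * P(the first 2^(l+3) t ratios are all < t) = (1 - 1/t)^(2^(l+3) t) ≤ 2^(-2^(l+3)).
--   Summing over t = 2^j with j < 2^((l+1)²) and applying Borel-Cantelli gives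
--   M_n ≥ 2^(-(l+5)) n for all large n, where l² ≤ log₂ log₂ n < (l+1)².
module Submission where

open import Algebra.Bundles using (CommutativeRing)
open import Algebra.Solver.Ring.AlmostCommutativeRing using (AlmostCommutativeRing; fromCommutativeRing; _-Raw-AlmostCommutative⟶_)
open import Axiom.ExcludedMiddle using (ExcludedMiddle)
open import Data.Bool.Base using (if_then_else_)
open import Data.Empty using (⊥; ⊥-elim)
open import Data.Integer.Base as ℤ using (ℤ; +_; -[1+_])
import Data.Integer.Properties as ℤ
open import Data.Maybe.Base using (Maybe; just; nothing)
open import Data.Nat.Base as ℕ using (ℕ; zero; suc; z≤n; s≤s; _!)
open import Data.Nat.GeneralisedArithmetic using (fold)
import Data.Nat.Properties as ℕ
open import Data.Nat.Solver using (module +-*-Solver)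
open import Data.Product.Base using (Σ-syntax; ∃; ∃-syntax; _×_; _,_; proj₁; proj₂)
open import Data.Rational.Base using (mkℚ)
open import Data.Sum.Base using (_⊎_; inj₁; inj₂)
open import Function.Base using (_∘_)
open import Level using (0ℓ)
open import Relation.Binary.Definitions using (tri<; tri≈; tri>)
open import Relation.Binary.PropositionalEquality.Core as ≡ using (_≡_)
open import Relation.Binary.Structures using (IsPreorder; IsStrictTotalOrder)
open import Relation.Nullary.Construct.Add.Extrema using (_±; [_]; ⊥±; ⊤±)
open import Relation.Nullary.Decidable.Core using (yes; no; does)
open import Relation.Nullary.Negation.Core using (¬_; contradiction)
import Algebra.Properties.Ring as RingProperties
import Algebra.Properties.Semiring.Mult as SemiringMult
import Algebra.Properties.Semiring.Mult.TCOptimised as SemiringMult′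
import Algebra.Solver.Ring as RingSolver
import Relation.Binary.Construct.Add.Extrema.NonStrict as AddExtrema
import Relation.Binary.Construct.Add.Supremum.NonStrict as AddSupremum
import Relation.Binary.Reasoning.Base.Triple as TripleReasoning
open import Defs

-- Nothing is ever measured: null sets are defined by interval covers, so every estimate is an upper
-- bound on a cover. Independence enters only as the fact that these bounds multiply along the
-- orbit, and no random process is constructed.
--
-- The two bounds for M_n differ in kind. That the liminf is at most 0 asks for good n only
-- infinitely often, so a very sparse sequence is allowed, on which an error of order i is lost
-- against i². That it is at least 0 concerns every n; it works because a failure probability doubly
-- exponential in l can pay for all dyadic levels of a block, and leaves an error of order l against
-- log log n of order l². For R_n a bounded value suffices, since log n = exp (log log n) outgrows
-- every multiple of log log n.
--
-- The points 1/n, where the affine branches of T meet, would stop an orbit; they are avoided by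
-- following only points that satisfy `Generic`. As the reals are axiomatic, `exp` and `log` are
-- built from the series, mainly for nonnegative arguments of `exp` and arguments at least 1 of
-- `log`.

-- A ring solver with integer coefficients.

module IntegerCoefficientSolver (commutativeRing : CommutativeRing 0ℓ 0ℓ) where

  open CommutativeRing commutativeRing
  open RingProperties ring
  open SemiringMult′ semiring using (1+×; ×-homo-+; ×1-homo-*) renaming (_×_ to _×′_)
  open import Relation.Binary.Reasoning.Setoid setoid

  -- With the optimised multiple `_×′_` the coefficients 0 and 1 evaluate to `0#` and `1#` by
  -- computation, whereas `fromℕ 1` is `1# + 0#`. In later solver calls `con (+ 1) :+ n` thus stands
  -- for the unfolding of `fromℕ (suc n)`.
  ⟦_⟧ᶻ : ℤ → Carrier
  ⟦ + n ⟧ᶻ      = n ×′ 1#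
  ⟦ -[1+ n ] ⟧ᶻ = - (suc n ×′ 1#)

  private
    cancel-common : ∀ c x y → (c + x) - (c + y) ≈ x - y
    cancel-common c x y = begin
      (c + x) - (c + y)       ≈⟨ +-congˡ (sym (-‿+-comm c y)) ⟩
      (c + x) + (- c + - y)   ≈⟨ +-congʳ (+-comm c x) ⟩
      (x + c) + (- c + - y)   ≈⟨ +-assoc x c _ ⟩
      x + (c + (- c + - y))   ≈⟨ +-congˡ (sym (+-assoc c (- c) (- y))) ⟩
      x + ((c - c) + - y)     ≈⟨ +-congˡ (+-congʳ (-‿inverseʳ c)) ⟩
      x + (0# + - y)          ≈⟨ +-congˡ (+-identityˡ _) ⟩
      x - y                   ∎

  ⊖-homo : ∀ m n → ⟦ m ℤ.⊖ n ⟧ᶻ ≈ m ×′ 1# - n ×′ 1#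
  ⊖-homo zero zero = sym (-‿inverseʳ 0#)
  ⊖-homo zero (suc n) = sym (+-identityˡ _)
  ⊖-homo (suc m) zero = begin
    suc m ×′ 1#         ≈⟨ +-identityʳ _ ⟨
    suc m ×′ 1# + 0#    ≈⟨ +-congˡ -0#≈0# ⟨
    suc m ×′ 1# - 0#    ∎
  ⊖-homo (suc m) (suc n) = begin
    ⟦ suc m ℤ.⊖ suc n ⟧ᶻ                    ≡⟨ ≡.cong ⟦_⟧ᶻ (ℤ.[1+m]⊖[1+n]≡m⊖n m n) ⟩
    ⟦ m ℤ.⊖ n ⟧ᶻ                            ≈⟨ ⊖-homo m n ⟩
    m ×′ 1# - n ×′ 1#                       ≈⟨ cancel-common 1# _ _ ⟨
    (1# + m ×′ 1#) - (1# + n ×′ 1#)         ≈⟨ +-cong (1+× m 1#) (-‿cong (1+× n 1#)) ⟨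
    suc m ×′ 1# - suc n ×′ 1#               ∎

  +-homo : ∀ i j → ⟦ i ℤ.+ j ⟧ᶻ ≈ ⟦ i ⟧ᶻ + ⟦ j ⟧ᶻ
  +-homo (+ m)    (+ n)    = ×-homo-+ 1# m n
  +-homo (+ m)    -[1+ n ] = ⊖-homo m (suc n)
  +-homo -[1+ m ] (+ n)    = trans (⊖-homo n (suc m)) (+-comm _ _)
  +-homo -[1+ m ] -[1+ n ] = begin
    - (suc (suc (m ℕ.+ n)) ×′ 1#)           ≡⟨ ≡.cong (λ k → - (k ×′ 1#)) (≡.sym (ℕ.+-suc (suc m) n)) ⟩
    - ((suc m ℕ.+ suc n) ×′ 1#)             ≈⟨ -‿cong (×-homo-+ 1# (suc m) (suc n)) ⟩
    - (suc m ×′ 1# + suc n ×′ 1#)           ≈⟨ -‿+-comm _ _ ⟨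
    - (suc m ×′ 1#) + - (suc n ×′ 1#)       ∎

  -‿homo : ∀ i → ⟦ ℤ.- i ⟧ᶻ ≈ - ⟦ i ⟧ᶻ
  -‿homo (+ zero)  = sym -0#≈0#
  -‿homo (+ suc n) = refl
  -‿homo -[1+ n ]  = sym (-‿involutive _)

  private
    *-homo-+⁺ : ∀ m j → ⟦ + m ℤ.* j ⟧ᶻ ≈ ⟦ + m ⟧ᶻ * ⟦ j ⟧ᶻ
    *-homo-+⁺ m (+ n) = begin
      ⟦ + m ℤ.* + n ⟧ᶻ    ≡⟨ ≡.cong ⟦_⟧ᶻ (≡.sym (ℤ.pos-* m n)) ⟩
      (m ℕ.* n) ×′ 1#     ≈⟨ ×1-homo-* m n ⟩
      m ×′ 1# * n ×′ 1#   ∎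
    *-homo-+⁺ m -[1+ n ] = begin
      ⟦ + m ℤ.* -[1+ n ] ⟧ᶻ         ≡⟨ ≡.cong ⟦_⟧ᶻ (≡.sym (ℤ.neg-distribʳ-* (+ m) (+ suc n))) ⟩
      ⟦ ℤ.- (+ m ℤ.* + suc n) ⟧ᶻ    ≈⟨ -‿homo (+ m ℤ.* + suc n) ⟩
      - ⟦ + m ℤ.* + suc n ⟧ᶻ        ≈⟨ -‿cong (*-homo-+⁺ m (+ suc n)) ⟩
      - (m ×′ 1# * suc n ×′ 1#)     ≈⟨ -‿distribʳ-* _ _ ⟩
      m ×′ 1# * - (suc n ×′ 1#)     ∎

  *-homo : ∀ i j → ⟦ i ℤ.* j ⟧ᶻ ≈ ⟦ i ⟧ᶻ * ⟦ j ⟧ᶻ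
  *-homo (+ m)    j = *-homo-+⁺ m j
  *-homo -[1+ m ] j = begin
    ⟦ -[1+ m ] ℤ.* j ⟧ᶻ         ≡⟨ ≡.cong ⟦_⟧ᶻ (≡.sym (ℤ.neg-distribˡ-* (+ suc m) j)) ⟩
    ⟦ ℤ.- (+ suc m ℤ.* j) ⟧ᶻ    ≈⟨ -‿homo (+ suc m ℤ.* j) ⟩
    - ⟦ + suc m ℤ.* j ⟧ᶻ        ≈⟨ -‿cong (*-homo-+⁺ (suc m) j) ⟩
    - (suc m ×′ 1# * ⟦ j ⟧ᶻ)    ≈⟨ -‿distribˡ-* _ _ ⟩
    - (suc m ×′ 1#) * ⟦ j ⟧ᶻ    ∎

  target : AlmostCommutativeRing 0ℓ 0ℓ
  target = fromCommutativeRing commutativeRing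

  morphism : ℤ.+-*-rawRing -Raw-AlmostCommutative⟶ target
  morphism = record
    { ⟦_⟧    = ⟦_⟧ᶻ
    ; +-homo = +-homo
    ; *-homo = *-homo
    ; -‿homo = -‿homo
    ; 0-homo = refl
    ; 1-homo = refl
    }

  coefficient-≟ : (i j : ℤ) → Maybe (⟦ i ⟧ᶻ ≈ ⟦ j ⟧ᶻ)
  coefficient-≟ i j with i ℤ.≟ j
  ... | yes i≡j = just (reflexive (≡.cong ⟦_⟧ᶻ i≡j))
  ... | no _    = nothing

  open RingSolver ℤ.+-*-rawRing target morphism coefficient-≟ public
    using (solve; _:=_; _:+_; _:*_; _:-_; :-_; con)

-- Ordered field arithmetic and the Archimedean property.

module OrderedField (lem : ExcludedMiddle 0ℓ) (reals : CompleteOrderedField) where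

  open SignedEngel lem reals public
  open IsStrictTotalOrder isStrictTotalOrder public
    using (compare; <-resp-≈; <-respʳ-≈; <-respˡ-≈)
    renaming (irrefl to <-irrefl; asym to <-asym; trans to <-trans)
  open IntegerCoefficientSolver commutativeRing public
    using (solve; _:=_; _:+_; _:*_; _:-_; :-_; con)

  private
    variable
      a b e x y z w : ℝ
      m n : ℕ

  <⇒≤ : x < y → x ≤ y
  <⇒≤ = <-asym

  ≤-reflexive : x ≈ y → x ≤ y
  ≤-reflexive x≈y = <-irrefl (sym x≈y)

  ≤-refl : x ≤ x
  ≤-refl = ≤-reflexive refl

  -- Since `≤` is just the negation of the reverse `<`, the disjunction has to come from trichotomy.
  ≤⇒<⊎≈ : x ≤ y → x < y ⊎ x ≈ y
  ≤⇒<⊎≈ {x} {y} x≤y with compare x y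
  ... | tri< x<y _ _ = inj₁ x<y
  ... | tri≈ _ x≈y _ = inj₂ x≈y
  ... | tri> _ _ y<x = contradiction y<x x≤y

  ≤-<-trans : x ≤ y → y < z → x < z
  ≤-<-trans x≤y y<z with ≤⇒<⊎≈ x≤y
  ... | inj₁ x<y = <-trans x<y y<z
  ... | inj₂ x≈y = <-respˡ-≈ (sym x≈y) y<z

  <-≤-trans : x < y → y ≤ z → x < z
  <-≤-trans x<y y≤z with ≤⇒<⊎≈ y≤z
  ... | inj₁ y<z = <-trans x<y y<z
  ... | inj₂ y≈z = <-respʳ-≈ y≈z x<y

  ≤-trans : x ≤ y → y ≤ z → x ≤ z
  ≤-trans x≤y y≤z z<x = y≤z (<-≤-trans z<x x≤y)

  ≤-antisym : x ≤ y → y ≤ x → x ≈ y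
  ≤-antisym x≤y y≤x with ≤⇒<⊎≈ x≤y
  ... | inj₁ x<y = contradiction x<y y≤x
  ... | inj₂ x≈y = x≈y

  ≤-total : ∀ x y → x ≤ y ⊎ y ≤ x
  ≤-total x y with compare x y
  ... | tri< x<y _ _ = inj₁ (<⇒≤ x<y)
  ... | tri≈ _ x≈y _ = inj₁ (≤-reflexive x≈y)
  ... | tri> _ _ y<x = inj₂ (<⇒≤ y<x)

  ≰⇒> : ¬ (x ≤ y) → y < x
  ≰⇒> {x} {y} x≰y with compare x y
  ... | tri< x<y _ _ = contradiction (<⇒≤ x<y) x≰y
  ... | tri≈ _ x≈y _ = contradiction (≤-reflexive x≈y) x≰y
  ... | tri> _ _ y<x = y<x

  ≤-isPreorder : IsPreorder _≈_ _≤_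
  ≤-isPreorder = record { isEquivalence = isEquivalence ; reflexive = ≤-reflexive ; trans = ≤-trans }

  module ≤-Reasoning =
    TripleReasoning ≤-isPreorder <-asym <-trans <-resp-≈ <⇒≤ <-≤-trans ≤-<-trans

  x<y⇒0<y-x : x < y → 0# < y - x
  x<y⇒0<y-x {x} {y} x<y = <-respˡ-≈ (-‿inverseˡ x) (<-respʳ-≈ (+-comm (- x) y) (+-monoʳ-< (- x) x<y))

  -- Linear arithmetic: a (strict) inequality a < b is proved by exhibiting
  -- b - a as an expression that is manifestly positive.
  <-from : 0# < e → e ≈ b - a → a < b
  <-from {e} {b} {a} 0<e e≈b-a = <-respˡ-≈ (+-identityʳ a) (<-respʳ-≈ a+e≈b (+-monoʳ-< a 0<e))
    where
    a+e≈b : a + e ≈ b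
    a+e≈b = trans (+-congˡ e≈b-a) (solve 2 (λ a b → a :+ (b :- a) := b) refl a b)

  x≤y⇒0≤y-x : x ≤ y → 0# ≤ y - x
  x≤y⇒0≤y-x {x} {y} x≤y y-x<0 = x≤y (<-from (x<y⇒0<y-x y-x<0)
    (solve 2 (λ x y → con (+ 0) :- (y :- x) := x :- y) refl x y))

  ≤-from : 0# ≤ e → e ≈ b - a → a ≤ b
  ≤-from {e} {b} {a} 0≤e e≈b-a b<a = 0≤e (<-from (x<y⇒0<y-x b<a)
    (trans (solve 2 (λ a b → a :- b := con (+ 0) :- (b :- a)) refl a b) (+-congˡ (-‿cong (sym e≈b-a)))))

  +-mono-< : x < y → z < w → x + z < y + w
  +-mono-< {x} {y} {z} {w} x<y z<w =
    <-trans (+-monoʳ-< x z<w) (<-respˡ-≈ (+-comm w x) (<-respʳ-≈ (+-comm w y) (+-monoʳ-< w x<y)))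

  +-monoʳ-≤ : ∀ x → y ≤ z → x + y ≤ x + z
  +-monoʳ-≤ {y} {z} x y≤z = ≤-from (x≤y⇒0≤y-x y≤z)
    (solve 3 (λ x y z → z :- y := (x :+ z) :- (x :+ y)) refl x y z)

  +-mono-≤ : x ≤ y → z ≤ w → x + z ≤ y + w
  +-mono-≤ {x} {y} {z} {w} x≤y z≤w = ≤-trans (+-monoʳ-≤ x z≤w)
    (≤-from (x≤y⇒0≤y-x x≤y) (solve 3 (λ x y w → y :- x := (y :+ w) :- (x :+ w)) refl x y w))

  +-pos : 0# < x → 0# < y → 0# < x + y
  +-pos 0<x 0<y = <-respˡ-≈ (+-identityˡ 0#) (+-mono-< 0<x 0<y)

  +-nonneg : 0# ≤ x → 0# ≤ y → 0# ≤ x + y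
  +-nonneg 0≤x 0≤y = ≤-trans (≤-reflexive (sym (+-identityˡ 0#))) (+-mono-≤ 0≤x 0≤y)

  +-pos-nonneg : 0# < x → 0# ≤ y → 0# < x + y
  +-pos-nonneg {x} {y} 0<x 0≤y = <-≤-trans 0<x (≤-from 0≤y (solve 2 (λ x y → y := (x :+ y) :- x) refl x y))

  *-nonneg : 0# ≤ x → 0# ≤ y → 0# ≤ x * y
  *-nonneg {x} {y} 0≤x 0≤y with ≤⇒<⊎≈ 0≤x | ≤⇒<⊎≈ 0≤y
  ... | inj₁ 0<x | inj₁ 0<y = <⇒≤ (*-pos 0<x 0<y)
  ... | inj₂ 0≈x | _        = ≤-reflexive (trans (sym (zeroˡ y)) (*-congʳ 0≈x))
  ... | inj₁ _   | inj₂ 0≈y = ≤-reflexive (trans (sym (zeroʳ x)) (*-congˡ 0≈y))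

  *-monoˡ-≤ : 0# ≤ z → x ≤ y → z * x ≤ z * y
  *-monoˡ-≤ {z} {x} {y} 0≤z x≤y = ≤-from (*-nonneg 0≤z (x≤y⇒0≤y-x x≤y))
    (solve 3 (λ x y z → z :* (y :- x) := z :* y :- z :* x) refl x y z)

  *-monoʳ-≤ : 0# ≤ z → x ≤ y → x * z ≤ y * z
  *-monoʳ-≤ {z} {x} {y} 0≤z x≤y = ≤-from (*-nonneg 0≤z (x≤y⇒0≤y-x x≤y))
    (solve 3 (λ x y z → z :* (y :- x) := y :* z :- x :* z) refl x y z)

  *-mono-≤ : 0# ≤ x → 0# ≤ z → x ≤ y → z ≤ w → x * z ≤ y * w
  *-mono-≤ 0≤x 0≤z x≤y z≤w = ≤-trans (*-monoˡ-≤ 0≤x z≤w) (*-monoʳ-≤ (≤-trans 0≤z z≤w) x≤y)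

  *-monoˡ-< : 0# < z → x < y → z * x < z * y
  *-monoˡ-< {z} {x} {y} 0<z x<y = <-from (*-pos 0<z (x<y⇒0<y-x x<y))
    (solve 3 (λ x y z → z :* (y :- x) := z :* y :- z :* x) refl x y z)

  *-cancelˡ-≤ : 0# < z → z * x ≤ z * y → x ≤ y
  *-cancelˡ-≤ 0<z zx≤zy y<x = zx≤zy (*-monoˡ-< 0<z y<x)

  *-cancelˡ-< : 0# < z → z * x < z * y → x < y
  *-cancelˡ-< 0<z zx<zy = ≰⇒> (λ y≤x → *-monoˡ-≤ (<⇒≤ 0<z) y≤x zx<zy)

  0≤1 : 0# ≤ 1#
  0≤1 = <⇒≤ 0<1

  pos⇒≉0 : 0# < x → ¬ (x ≈ 0#)
  pos⇒≉0 0<x x≈0 = <-irrefl (sym x≈0) 0<x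

  inverseʳ : 0# < x → x * x ⁻¹ ≈ 1#
  inverseʳ {x} 0<x = ⁻¹-inverseʳ x (pos⇒≉0 0<x)

  inverseˡ : 0# < x → x ⁻¹ * x ≈ 1#
  inverseˡ {x} 0<x = trans (*-comm _ _) (inverseʳ 0<x)

  *-cancelˡ-≈ : 0# < z → z * x ≈ z * y → x ≈ y
  *-cancelˡ-≈ 0<z zx≈zy = ≤-antisym (*-cancelˡ-≤ 0<z (≤-reflexive zx≈zy)) (*-cancelˡ-≤ 0<z (≤-reflexive (sym zx≈zy)))

  ⁻¹-pos : 0# < x → 0# < x ⁻¹
  ⁻¹-pos {x} 0<x = *-cancelˡ-< 0<x (<-respˡ-≈ (sym (zeroʳ x)) (<-respʳ-≈ (sym (inverseʳ 0<x)) 0<1))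

  /-pos : 0# < x → 0# < y → 0# < x / y
  /-pos 0<x 0<y = *-pos 0<x (⁻¹-pos 0<y)

  *-/-cancel : 0# < y → y * (x / y) ≈ x
  *-/-cancel {y} {x} 0<y = begin
    y * (x * y ⁻¹)   ≈⟨ solve 3 (λ x y i → y :* (x :* i) := x :* (y :* i)) refl x y (y ⁻¹) ⟩
    x * (y * y ⁻¹)   ≈⟨ *-congˡ (inverseʳ 0<y) ⟩
    x * 1#           ≈⟨ *-identityʳ x ⟩
    x                ∎
    where open import Relation.Binary.Reasoning.Setoid setoid

  /-≤ : 0# < y → x ≤ y * z → x / y ≤ z
  /-≤ 0<y x≤yz = *-cancelˡ-≤ 0<y (≤-trans (≤-reflexive (*-/-cancel 0<y)) x≤yz)

  ≤-/ : 0# < y → y * z ≤ x → z ≤ x / y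
  ≤-/ 0<y yz≤x = *-cancelˡ-≤ 0<y (≤-trans yz≤x (≤-reflexive (sym (*-/-cancel 0<y))))

  <-/ : 0# < y → y * z < x → z < x / y
  <-/ 0<y yz<x = *-cancelˡ-< 0<y (<-respʳ-≈ (sym (*-/-cancel 0<y)) yz<x)

  /-< : 0# < y → x < y * z → x / y < z
  /-< 0<y x<yz = *-cancelˡ-< 0<y (<-respˡ-≈ (sym (*-/-cancel 0<y)) x<yz)

  open SemiringMult semiring using (×-homo-+; ×1-homo-*; ×-homo-1)

  fromℕ-+ : ∀ m n → fromℕ (m ℕ.+ n) ≈ fromℕ m + fromℕ n
  fromℕ-+ = ×-homo-+ 1#

  fromℕ-* : ∀ m n → fromℕ (m ℕ.* n) ≈ fromℕ m * fromℕ n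
  fromℕ-* = ×1-homo-*

  fromℕ-1 : fromℕ 1 ≈ 1#
  fromℕ-1 = ×-homo-1 1#

  fromℕ-nonneg : ∀ n → 0# ≤ fromℕ n
  fromℕ-nonneg zero    = ≤-refl
  fromℕ-nonneg (suc n) = +-nonneg 0≤1 (fromℕ-nonneg n)

  fromℕ-pos : ∀ n → 0# < fromℕ (suc n)
  fromℕ-pos n = +-pos-nonneg 0<1 (fromℕ-nonneg n)

  fromℕ-pos′ : 1 ℕ.≤ n → 0# < fromℕ n
  fromℕ-pos′ {suc n} _ = fromℕ-pos n

  fromℕ-mono-≤ : m ℕ.≤ n → fromℕ m ≤ fromℕ n
  fromℕ-mono-≤ {n = n} z≤n = fromℕ-nonneg n
  fromℕ-mono-≤ (s≤s m≤n)   = +-monoʳ-≤ 1# (fromℕ-mono-≤ m≤n)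

  fromℕ-cancel-< : fromℕ m < fromℕ n → m ℕ.< n
  fromℕ-cancel-< m<n = ℕ.≰⇒> (λ n≤m → fromℕ-mono-≤ n≤m m<n)

  recip-pos : 1 ℕ.≤ n → 0# < recip n
  recip-pos 1≤n = ⁻¹-pos (fromℕ-pos′ 1≤n)

  recip-inverseʳ : 1 ℕ.≤ n → fromℕ n * recip n ≈ 1#
  recip-inverseʳ 1≤n = inverseʳ (fromℕ-pos′ 1≤n)

  recip-1 : recip 1 ≈ 1#
  recip-1 = trans (sym (*-identityˡ _)) (trans (*-congʳ (sym fromℕ-1)) (recip-inverseʳ {1} (s≤s z≤n)))

  recip-* : 1 ℕ.≤ m → 1 ℕ.≤ n → recip (m ℕ.* n) ≈ recip m * recip n
  recip-* {m} {n} 1≤m 1≤n = *-cancelˡ-≈ (fromℕ-pos′ 1≤mn) (begin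
    fromℕ (m ℕ.* n) * recip (m ℕ.* n)          ≈⟨ recip-inverseʳ 1≤mn ⟩
    1#                                         ≈⟨ *-identityˡ 1# ⟨
    1# * 1#                                    ≈⟨ *-cong (recip-inverseʳ 1≤m) (recip-inverseʳ 1≤n) ⟨
    (fromℕ m * recip m) * (fromℕ n * recip n)  ≈⟨ solve 4 (λ a b c d → (a :* b) :* (c :* d) := (a :* c) :* (b :* d)) refl _ _ _ _ ⟩
    (fromℕ m * fromℕ n) * (recip m * recip n)  ≈⟨ *-congʳ (fromℕ-* m n) ⟨
    fromℕ (m ℕ.* n) * (recip m * recip n)      ∎)
    where
    open import Relation.Binary.Reasoning.Setoid setoid
    1≤mn : 1 ℕ.≤ m ℕ.* n
    1≤mn = ℕ.*-mono-≤ 1≤m 1≤n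

  recip-anti-≤ : 1 ℕ.≤ m → m ℕ.≤ n → recip n ≤ recip m
  recip-anti-≤ {m} {n} 1≤m m≤n = *-cancelˡ-≤ (fromℕ-pos′ 1≤n) (begin
    fromℕ n * recip n   ≈⟨ recip-inverseʳ 1≤n ⟩
    1#                  ≈⟨ recip-inverseʳ 1≤m ⟨
    fromℕ m * recip m   ≤⟨ *-monoʳ-≤ (<⇒≤ (recip-pos 1≤m)) (fromℕ-mono-≤ m≤n) ⟩
    fromℕ n * recip m   ∎)
    where
    open ≤-Reasoning
    1≤n : 1 ℕ.≤ n
    1≤n = ℕ.≤-trans 1≤m m≤n

  -- If the naturals were bounded, they would have a supremum s; from n + 1 ≤ s for all n it follows
  -- that s - 1 is a smaller upper bound.
  archimedean : ∀ x → ∃[ n ] x < fromℕ n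
  archimedean x with lem {∃[ n ] x < fromℕ n}
  ... | yes found = found
  ... | no ¬found = contradiction s-1<s s≤s-1
    where
    bounded : ∀ n → fromℕ n ≤ x
    bounded n x<n = ¬found (n , x<n)

    S : ℝ → Set
    S y = ∃[ n ] y ≈ fromℕ n

    sup : Σ[ s ∈ ℝ ] UpperBound S s × (∀ u → UpperBound S u → s ≤ u)
    sup = supremum S (0# , 0 , refl) (x , λ { y (n , y≈n) → ≤-trans (≤-reflexive y≈n) (bounded n) })

    s : ℝ
    s = proj₁ sup

    s≤s-1 : s ≤ s - 1#
    s≤s-1 = proj₂ (proj₂ sup) (s - 1#) λ { y (n , y≈n) → ≤-trans (≤-reflexive y≈n)
      (≤-from (x≤y⇒0≤y-x (proj₁ (proj₂ sup) (fromℕ (suc n)) (suc n , refl)))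
        (solve 2 (λ s n → s :- (con (+ 1) :+ n) := (s :- con (+ 1)) :- n) refl s (fromℕ n))) }

    s-1<s : s - 1# < s
    s-1<s = <-from 0<1 (solve 1 (λ s → con (+ 1) := s :- (s :- con (+ 1))) refl s)

  recip-below : 0# < e → ∃[ n ] (1 ℕ.≤ n × recip n < e)
  recip-below {e} 0<e with archimedean (e ⁻¹)
  ... | zero , e⁻¹<0 = contradiction (<-trans (⁻¹-pos 0<e) e⁻¹<0) (<-irrefl refl)
  ... | n@(suc n-1) , e⁻¹<n = n , s≤s z≤n , *-cancelˡ-< (fromℕ-pos n-1)
    (<-respˡ-≈ (sym (recip-inverseʳ {n} (s≤s z≤n))) (<-respˡ-≈ (inverseʳ 0<e) (<-respʳ-≈ (*-comm _ _) (*-monoˡ-< 0<e e⁻¹<n))))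

-- Finite sums, absolute bounds and limits of sequences.

module Limits (lem : ExcludedMiddle 0ℓ) (reals : CompleteOrderedField) where

  open OrderedField lem reals public

  private
    variable
      a b c x y A : ℝ
      k m n : ℕ

  choose-spec : {A : Set} {default : A} {P : A → Set} → ∃ P → P (choose default P)
  choose-spec {P = P} found with lem {∃ P}
  ... | yes (_ , pa) = pa
  ... | no ¬found    = contradiction found ¬found

  choose-cases : {A : Set} {default : A} {P : A → Set} → P (choose default P) ⊎ choose default P ≡ default
  choose-cases {P = P} with lem {∃ P}
  ... | yes (_ , pa) = inj₁ pa
  ... | no _         = inj₂ ≡.refl

  ∑-cong : ∀ n {f g : ℕ → ℝ} → (∀ i → f i ≈ g i) → ∑< n f ≈ ∑< n g
  ∑-cong zero    f≈g = refl
  ∑-cong (suc n) f≈g = +-cong (f≈g 0) (∑-cong n (f≈g ∘ suc))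

  ∑-nonneg : ∀ n {f : ℕ → ℝ} → (∀ i → 0# ≤ f i) → 0# ≤ ∑< n f
  ∑-nonneg zero    0≤f = ≤-refl
  ∑-nonneg (suc n) 0≤f = +-nonneg (0≤f 0) (∑-nonneg n (0≤f ∘ suc))

  ∑-last : ∀ n (f : ℕ → ℝ) → ∑< (suc n) f ≈ ∑< n f + f n
  ∑-last zero    f = +-comm _ _
  ∑-last (suc n) f = trans (+-congˡ (∑-last n (f ∘ suc))) (sym (+-assoc _ _ _))

  ∑-+ : ∀ n (f g : ℕ → ℝ) → ∑< n (λ i → f i + g i) ≈ ∑< n f + ∑< n g
  ∑-+ zero    f g = sym (+-identityˡ 0#)
  ∑-+ (suc n) f g = trans (+-congˡ (∑-+ n (f ∘ suc) (g ∘ suc)))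
    (solve 4 (λ a b c d → (a :+ b) :+ (c :+ d) := (a :+ c) :+ (b :+ d)) refl _ _ _ _)

  *-distribˡ-∑ : ∀ n c (f : ℕ → ℝ) → c * ∑< n f ≈ ∑< n (λ i → c * f i)
  *-distribˡ-∑ zero    c f = zeroʳ c
  *-distribˡ-∑ (suc n) c f = trans (distribˡ c _ _) (+-congˡ (*-distribˡ-∑ n c (f ∘ suc)))

  ∑-monoˡ-≤ : ∀ {f : ℕ → ℝ} → (∀ i → 0# ≤ f i) → m ℕ.≤ n → ∑< m f ≤ ∑< n f
  ∑-monoˡ-≤ {n = n} 0≤f z≤n = ∑-nonneg n 0≤f
  ∑-monoˡ-≤ 0≤f (s≤s m≤n)   = +-monoʳ-≤ _ (∑-monoˡ-≤ (0≤f ∘ suc) m≤n)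

  two : ℝ
  two = 1# + 1#

  0<two : 0# < two
  0<two = +-pos 0<1 0<1

  half : ℝ → ℝ
  half x = x / two

  half-pos : 0# < x → 0# < half x
  half-pos 0<x = /-pos 0<x 0<two

  half+half : ∀ x → half x + half x ≈ x
  half+half x = trans (solve 1 (λ h → h :+ h := (con (+ 1) :+ con (+ 1)) :* h) refl (half x)) (*-/-cancel 0<two)

  infix 4 _±≤_

  -- This is |x| ≤ e, kept as two linear inequalities so that the solver applies directly.
  _±≤_ : ℝ → ℝ → Set
  x ±≤ e = - e ≤ x × x ≤ e

  ±≤-resp : x ≈ y → a ≈ b → x ±≤ a → y ±≤ b
  ±≤-resp x≈y a≈b (lo , hi) =
    ≤-trans (≤-reflexive (-‿cong (sym a≈b))) (≤-trans lo (≤-reflexive x≈y)) ,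
    ≤-trans (≤-reflexive (sym x≈y)) (≤-trans hi (≤-reflexive a≈b))

  ±≤-weaken : a ≤ b → x ±≤ a → x ±≤ b
  ±≤-weaken {a} {b} a≤b (lo , hi) =
    ≤-trans (≤-from (x≤y⇒0≤y-x a≤b) (solve 2 (λ a b → b :- a := :- a :- (:- b)) refl a b)) lo , ≤-trans hi a≤b

  ±≤-+ : x ±≤ a → y ±≤ b → x + y ±≤ a + b
  ±≤-+ {x} {a} {y} {b} (lo , hi) (lo′ , hi′) =
    ≤-trans (≤-reflexive (solve 2 (λ a b → :- (a :+ b) := :- a :+ :- b) refl a b)) (+-mono-≤ lo lo′) , +-mono-≤ hi hi′

  ±≤-neg : x ±≤ a → - x ±≤ a
  ±≤-neg {x} {a} (lo , hi) =
    ≤-from (x≤y⇒0≤y-x hi) (solve 2 (λ x a → a :- x := :- x :- (:- a)) refl x a) ,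
    ≤-from (x≤y⇒0≤y-x lo) (solve 2 (λ x a → x :- (:- a) := a :- (:- x)) refl x a)

  -- No case split on signs: 2(xy + ab) = (x + a)(y + b) + (a - x)(b - y) and 2(ab - xy) = (x + a)(b
  -- - y) + (a - x)(y + b), where all factors on the right are nonnegative.
  ±≤-* : x ±≤ a → y ±≤ b → x * y ±≤ a * b
  ±≤-* {x} {a} {y} {b} (lo , hi) (lo′ , hi′) =
    *-cancelˡ-≤ 0<two (≤-from (+-nonneg (*-nonneg (x≤y⇒0≤y-x lo) (x≤y⇒0≤y-x lo′)) (*-nonneg (x≤y⇒0≤y-x hi) (x≤y⇒0≤y-x hi′)))
      (solve 4 (λ x a y b → (x :- (:- a)) :* (y :- (:- b)) :+ (a :- x) :* (b :- y)
        := (con (+ 1) :+ con (+ 1)) :* (x :* y) :- (con (+ 1) :+ con (+ 1)) :* (:- (a :* b))) refl x a y b)) ,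
    *-cancelˡ-≤ 0<two (≤-from (+-nonneg (*-nonneg (x≤y⇒0≤y-x lo) (x≤y⇒0≤y-x hi′)) (*-nonneg (x≤y⇒0≤y-x hi) (x≤y⇒0≤y-x lo′)))
      (solve 4 (λ x a y b → (x :- (:- a)) :* (b :- y) :+ (a :- x) :* (y :- (:- b))
        := (con (+ 1) :+ con (+ 1)) :* (a :* b) :- (con (+ 1) :+ con (+ 1)) :* (x :* y)) refl x a y b))

  nonneg⇒±≤ : 0# ≤ x → x ±≤ x
  nonneg⇒±≤ {x} 0≤x = ≤-from (+-nonneg 0≤x 0≤x) (solve 1 (λ x → x :+ x := x :- (:- x)) refl x) , ≤-refl

  ±≤-bound : ∀ x → ∃[ a ] (0# ≤ a × x ±≤ a)
  ±≤-bound x with ≤-total 0# x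
  ... | inj₁ 0≤x = x , 0≤x , nonneg⇒±≤ 0≤x
  ... | inj₂ x≤0 = - x , 0≤-x , ±≤-resp (solve 1 (λ x → :- (:- x) := x) refl x) refl (±≤-neg (nonneg⇒±≤ 0≤-x))
    where
    0≤-x : 0# ≤ - x
    0≤-x = ≤-from (x≤y⇒0≤y-x x≤0) (solve 1 (λ x → con (+ 0) :- x := :- x :- con (+ 0)) refl x)

  -- Halving ε turns the weak bounds of `_±≤_` into the strict ones in the definition of `_⟶_`.
  ⟶-intro : ∀ {s : ℕ → ℝ} {l} → (∀ ε → 0# < ε → ∃[ N ] (∀ n → N ℕ.≤ n → s n - l ±≤ ε)) → s ⟶ l
  ⟶-intro {s} {l} close ε 0<ε = proj₁ (close (half ε) (half-pos 0<ε)) , λ n N≤n → bounds n (proj₂ (close (half ε) (half-pos 0<ε)) n N≤n)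
    where
    bounds : ∀ n → s n - l ±≤ half ε → l - ε < s n × s n < l + ε
    bounds n (lo , hi) =
      <-from (+-pos-nonneg (half-pos 0<ε) (x≤y⇒0≤y-x lo))
        (trans (solve 3 (λ h s l → h :+ ((s :- l) :- (:- h)) := s :- (l :- (h :+ h))) refl (half ε) (s n) l)
          (+-congˡ (-‿cong (+-congˡ (-‿cong (half+half ε)))))) ,
      <-from (+-pos-nonneg (half-pos 0<ε) (x≤y⇒0≤y-x hi))
        (trans (solve 3 (λ h s l → h :+ (h :- (s :- l)) := (l :+ (h :+ h)) :- s) refl (half ε) (s n) l)
          (+-congʳ (+-congˡ (half+half ε))))

  ⟶-elim : ∀ {s : ℕ → ℝ} {l} → s ⟶ l → ∀ ε → 0# < ε → ∃[ N ] (∀ n → N ℕ.≤ n → s n - l ±≤ ε)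
  ⟶-elim {s} {l} lim ε 0<ε = proj₁ (lim ε 0<ε) , λ n N≤n → bounds n (proj₂ (lim ε 0<ε) n N≤n)
    where
    bounds : ∀ n → l - ε < s n × s n < l + ε → s n - l ±≤ ε
    bounds n (lo , hi) =
      ≤-from (<⇒≤ (x<y⇒0<y-x lo)) (solve 3 (λ e s l → s :- (l :- e) := (s :- l) :- (:- e)) refl ε (s n) l) ,
      ≤-from (<⇒≤ (x<y⇒0<y-x hi)) (solve 3 (λ e s l → (l :+ e) :- s := e :- (s :- l)) refl ε (s n) l)

  limit-≤ : ∀ {s : ℕ → ℝ} {l} → s ⟶ l → (∀ n → s n ≤ b) → l ≤ b
  limit-≤ {b} {s} {l} lim s≤b b<l with lim (l - b) (x<y⇒0<y-x b<l)
  ... | N , close = s≤b N (<-respˡ-≈ (solve 2 (λ l b → l :- (l :- b) := b) refl l b) (proj₁ (close N ℕ.≤-refl)))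

  limit-≥ : ∀ {s : ℕ → ℝ} {l} → s ⟶ l → ∀ k → (∀ n → k ℕ.≤ n → b ≤ s n) → b ≤ l
  limit-≥ {b} {s} {l} lim k b≤s l<b with lim (b - l) (x<y⇒0<y-x l<b)
  ... | N , close = b≤s (N ℕ.⊔ k) (ℕ.m≤n⊔m N k)
    (<-respʳ-≈ (solve 2 (λ l b → l :+ (b :- l) := b) refl l b) (proj₂ (close (N ℕ.⊔ k) (ℕ.m≤m⊔n N k))))

  squeeze-zero : (∀ ε → 0# < ε → x ±≤ ε) → x ≈ 0#
  squeeze-zero {x} small with compare x 0#
  ... | tri≈ _ x≈0 _ = x≈0
  ... | tri< x<0 _ _ = contradiction
    (<-from (half-pos 0<-x) (trans (solve 1 (λ h → h := :- h :- (:- (h :+ h))) refl (half (- x)))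
      (+-congˡ (-‿cong (-‿cong (half+half (- x)))))))
    (λ lt → proj₁ (small (half (- x)) (half-pos 0<-x)) (<-respˡ-≈ (solve 1 (λ x → :- (:- x) := x) refl x) lt))
    where
    0<-x : 0# < - x
    0<-x = <-from (x<y⇒0<y-x x<0) (solve 1 (λ x → con (+ 0) :- x := :- x :- con (+ 0)) refl x)
  ... | tri> _ _ 0<x = contradiction
    (<-from (half-pos 0<x) (trans (solve 1 (λ h → h := (h :+ h) :- h) refl (half x)) (+-congʳ (half+half x))))
    (proj₂ (small (half x) (half-pos 0<x)))

  limit-unique : ∀ {s : ℕ → ℝ} {l l′} → s ⟶ l → s ⟶ l′ → l ≈ l′
  limit-unique {s} {l} {l′} lim lim′ = trans (solve 2 (λ l l′ → l := (l :- l′) :+ l′) refl l l′)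
    (trans (+-congʳ (squeeze-zero small)) (+-identityˡ l′))
    where
    combine : ∀ ε → ∃[ N ] (∀ n → N ℕ.≤ n → s n - l ±≤ half ε) → ∃[ N ] (∀ n → N ℕ.≤ n → s n - l′ ±≤ half ε) → l - l′ ±≤ ε
    combine ε (N , close) (N′ , close′) =
      ±≤-resp (solve 3 (λ s l l′ → :- (s :- l) :+ (s :- l′) := l :- l′) refl (s (N ℕ.⊔ N′)) l l′) (half+half ε)
        (±≤-+ (±≤-neg (close (N ℕ.⊔ N′) (ℕ.m≤m⊔n N N′))) (close′ (N ℕ.⊔ N′) (ℕ.m≤n⊔m N N′)))

    small : ∀ ε → 0# < ε → l - l′ ±≤ ε
    small ε 0<ε = combine ε (⟶-elim lim (half ε) (half-pos 0<ε)) (⟶-elim lim′ (half ε) (half-pos 0<ε))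

  limit-perturb : ∀ {s t r : ℕ → ℝ} {l} → s ⟶ l → r ⟶ 0# → (∀ n → t n - s n ±≤ r n) → t ⟶ l
  limit-perturb {s} {t} {r} {l} lim small near = ⟶-intro close
    where
    combine : ∀ ε → ∃[ N ] (∀ n → N ℕ.≤ n → s n - l ±≤ half ε) → ∃[ N ] (∀ n → N ℕ.≤ n → r n - 0# ±≤ half ε) →
      ∃[ N ] (∀ n → N ℕ.≤ n → t n - l ±≤ ε)
    combine ε (N , near-l) (N′ , near-0) = N ℕ.⊔ N′ , λ n N≤n →
      ±≤-resp (solve 3 (λ t s l → (t :- s) :+ (s :- l) := t :- l) refl (t n) (s n) l) (half+half ε)
        (±≤-+ (±≤-weaken (≤-trans (≤-reflexive (solve 1 (λ r → r := r :- con (+ 0)) refl (r n))) (proj₂ (near-0 n (ℕ.≤-trans (ℕ.m≤n⊔m N N′) N≤n)))) (near n))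
          (near-l n (ℕ.≤-trans (ℕ.m≤m⊔n N N′) N≤n)))

    close : ∀ ε → 0# < ε → ∃[ N ] (∀ n → N ℕ.≤ n → t n - l ±≤ ε)
    close ε 0<ε = combine ε (⟶-elim lim (half ε) (half-pos 0<ε)) (⟶-elim small (half ε) (half-pos 0<ε))

  limit-cong : ∀ {s t : ℕ → ℝ} {l} → (∀ n → s n ≈ t n) → s ⟶ l → t ⟶ l
  limit-cong s≈t lim ε 0<ε = proj₁ (lim ε 0<ε) , λ n N≤n →
    <-respʳ-≈ (s≈t n) (proj₁ (proj₂ (lim ε 0<ε) n N≤n)) , <-respˡ-≈ (s≈t n) (proj₂ (proj₂ (lim ε 0<ε) n N≤n))

  limit-* : ∀ {s t : ℕ → ℝ} {l l′} → (∀ n → s n ±≤ A) → s ⟶ l → t ⟶ l′ → (λ n → s n * t n) ⟶ (l * l′)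
  limit-* {A} {s} {t} {l} {l′} s≤A lim lim′ = ⟶-intro close
    where
    L : ℝ
    L = proj₁ (±≤-bound l′)

    -- Index 0 alone forces this: for negative A one would have - A ≤ s 0 ≤ A < - A.
    0≤A : 0# ≤ A
    0≤A A<0 = proj₁ (s≤A 0) (≤-<-trans (proj₂ (s≤A 0)) (<-from (+-pos (x<y⇒0<y-x A<0) (x<y⇒0<y-x A<0))
      (solve 1 (λ a → (con (+ 0) :- a) :+ (con (+ 0) :- a) := :- a :- a) refl A)))

    -- The error is s n * (t n - l′) + l′ * (s n - l), hence at most (A + L) ε / K. The summand 1
    -- keeps K positive when A and L vanish.
    K : ℝ
    K = 1# + (A + L)

    0<K : 0# < K
    0<K = +-pos-nonneg 0<1 (+-nonneg 0≤A (proj₁ (proj₂ (±≤-bound l′))))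

    combine : ∀ ε → 0# < ε → ∃[ N ] (∀ n → N ℕ.≤ n → s n - l ±≤ ε / K) → ∃[ N ] (∀ n → N ℕ.≤ n → t n - l′ ±≤ ε / K) →
      ∃[ N ] (∀ n → N ℕ.≤ n → s n * t n - l * l′ ±≤ ε)
    combine ε 0<ε (N , near) (N′ , near′) = N ℕ.⊔ N′ , λ n N≤n →
      ±≤-weaken (≤-from (<⇒≤ (/-pos 0<ε 0<K))
        (trans (solve 3 (λ d a l → d := (con (+ 1) :+ (a :+ l)) :* d :- (a :* d :+ l :* d)) refl (ε / K) A L)
          (+-congʳ (*-/-cancel 0<K))))
        (±≤-resp (solve 4 (λ s t l l′ → s :* (t :- l′) :+ l′ :* (s :- l) := s :* t :- l :* l′) refl (s n) (t n) l l′) refl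
          (±≤-+ (±≤-* (s≤A n) (near′ n (ℕ.≤-trans (ℕ.m≤n⊔m N N′) N≤n)))
            (±≤-* (proj₂ (proj₂ (±≤-bound l′))) (near n (ℕ.≤-trans (ℕ.m≤m⊔n N N′) N≤n)))))

    close : ∀ ε → 0# < ε → ∃[ N ] (∀ n → N ℕ.≤ n → s n * t n - l * l′ ±≤ ε)
    close ε 0<ε = combine ε 0<ε (⟶-elim lim (ε / K) (/-pos 0<ε 0<K)) (⟶-elim lim′ (ε / K) (/-pos 0<ε 0<K))

  monotone-converges : ∀ {s : ℕ → ℝ} → (∀ {m n} → m ℕ.≤ n → s m ≤ s n) → (∀ n → s n ≤ b) → ∃[ l ] s ⟶ l
  monotone-converges {b} {s} mono s≤b = l , λ ε 0<ε → within ε 0<ε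
    where
    S : ℝ → Set
    S y = ∃[ n ] y ≈ s n

    sup : Σ[ s ∈ ℝ ] UpperBound S s × (∀ u → UpperBound S u → s ≤ u)
    sup = supremum S (s 0 , 0 , refl) (b , λ { y (n , y≈s) → ≤-trans (≤-reflexive y≈s) (s≤b n) })

    l : ℝ
    l = proj₁ sup

    within : ∀ ε → 0# < ε → ∃[ N ] (∀ n → N ℕ.≤ n → l - ε < s n × s n < l + ε)
    within ε 0<ε with lem {∃[ N ] l - ε < s N}
    ... | yes (N , l-ε<sN) = N , λ n N≤n → <-≤-trans l-ε<sN (mono N≤n) ,
      ≤-<-trans (proj₁ (proj₂ sup) (s n) (n , refl)) (<-from 0<ε (solve 2 (λ l e → e := (l :+ e) :- l) refl l ε))
    ... | no ¬found = contradiction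
      (<-from 0<ε (solve 2 (λ l e → e := l :- (l :- e)) refl l ε))
      (proj₂ (proj₂ sup) (l - ε) λ { y (n , y≈s) → ≤-trans (≤-reflexive y≈s) (λ lt → ¬found (n , lt)) })

-- The exponential series and Cauchy products.

module Exponential (lem : ExcludedMiddle 0ℓ) (reals : CompleteOrderedField) where

  open Limits lem reals public

  private
    variable
      a b x y : ℝ
      k m n : ℕ
      f g F G : ℕ → ℝ

  -- The coefficient Σ f i * g (n - i) of a product of power series. Recursing on the shifted `f`
  -- avoids truncated subtraction.
  conv : ℕ → (ℕ → ℝ) → (ℕ → ℝ) → ℝ
  conv zero    f g = f 0 * g 0
  conv (suc n) f g = f 0 * g (suc n) + conv n (f ∘ suc) g

  conv-cong : ∀ n → (∀ i → f i ≈ F i) → (∀ i → g i ≈ G i) → conv n f g ≈ conv n F G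
  conv-cong zero    f≈F g≈G = *-cong (f≈F 0) (g≈G 0)
  conv-cong (suc n) f≈F g≈G = +-cong (*-cong (f≈F 0) (g≈G (suc n))) (conv-cong n (f≈F ∘ suc) g≈G)

  conv-+ˡ : ∀ n (f F g : ℕ → ℝ) → conv n (λ i → f i + F i) g ≈ conv n f g + conv n F g
  conv-+ˡ zero    f F g = distribʳ _ _ _
  conv-+ˡ (suc n) f F g = trans (+-congˡ (conv-+ˡ n (f ∘ suc) (F ∘ suc) g))
    (solve 5 (λ a b c d e → (a :+ b) :* c :+ (d :+ e) := (a :* c :+ d) :+ (b :* c :+ e)) refl _ _ _ _ _)

  conv-*ˡ : ∀ n x (f g : ℕ → ℝ) → conv n (λ i → x * f i) g ≈ x * conv n f g
  conv-*ˡ zero    x f g = *-assoc _ _ _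
  conv-*ˡ (suc n) x f g = trans (+-congˡ (conv-*ˡ n x (f ∘ suc) g))
    (solve 4 (λ x a b c → (x :* a) :* b :+ x :* c := x :* (a :* b :+ c)) refl _ _ _ _)

  conv-*ʳ : ∀ n x (f g : ℕ → ℝ) → conv n f (λ i → x * g i) ≈ x * conv n f g
  conv-*ʳ zero    x f g = solve 3 (λ x a b → a :* (x :* b) := x :* (a :* b)) refl _ _ _
  conv-*ʳ (suc n) x f g = trans (+-congˡ (conv-*ʳ n x (f ∘ suc) g))
    (solve 4 (λ x a b c → a :* (x :* b) :+ x :* c := x :* (a :* b :+ c)) refl _ _ _ _)

  derivative : (ℕ → ℝ) → ℕ → ℝ
  derivative f i = fromℕ (suc i) * f (suc i)

  -- The product rule for the power series with coefficients f and g.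
  conv-derivative : ∀ n (f g : ℕ → ℝ) →
    fromℕ (suc n) * conv (suc n) f g ≈ conv n (derivative f) g + conv n f (derivative g)
  conv-derivative zero f g =
    solve 4 (λ a b c d → (con (+ 1) :+ con (+ 0)) :* (a :* b :+ c :* d)
      := ((con (+ 1) :+ con (+ 0)) :* c) :* d :+ a :* ((con (+ 1) :+ con (+ 0)) :* b)) refl (f 0) (g 1) (f 1) (g 0)
  conv-derivative (suc n) f g = begin
    N * (f 0 * g (suc (suc n)) + Y)
      ≈⟨ solve 4 (λ n a b c → (con (+ 1) :+ n) :* (a :* b :+ c) := a :* ((con (+ 1) :+ n) :* b) :+ (n :* c :+ c)) refl (fromℕ (suc n)) (f 0) (g (suc (suc n))) Y ⟩
    f 0 * derivative g (suc n) + (fromℕ (suc n) * Y + Y)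
      ≈⟨ +-congˡ (+-congʳ (conv-derivative n (f ∘ suc) g)) ⟩
    f 0 * derivative g (suc n) + ((D + V) + (f 1 * g (suc n) + W))
      ≈⟨ solve 6 (λ a d v b c w → a :+ ((d :+ v) :+ (b :* c :+ w)) := ((con (+ 1) :+ con (+ 0)) :* b :* c :+ (d :+ w)) :+ (a :+ v)) refl _ D V (f 1) (g (suc n)) W ⟩
    (derivative f 0 * g (suc n) + (D + W)) + (f 0 * derivative g (suc n) + V)
      ≈⟨ +-congʳ (+-congˡ shift) ⟩
    (derivative f 0 * g (suc n) + conv n (derivative f ∘ suc) g) + (f 0 * derivative g (suc n) + V) ∎
    where
    open import Relation.Binary.Reasoning.Setoid setoid

    N Y D V W : ℝ
    N = fromℕ (suc (suc n))
    Y = conv (suc n) (f ∘ suc) g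
    D = conv n (derivative (f ∘ suc)) g
    V = conv n (f ∘ suc) (derivative g)
    W = conv n (f ∘ suc ∘ suc) g

    shift : D + W ≈ conv n (derivative f ∘ suc) g
    shift = trans (sym (conv-+ˡ n (derivative (f ∘ suc)) (f ∘ suc ∘ suc) g))
      (conv-cong n (λ i → solve 2 (λ n a → n :* a :+ a := (con (+ 1) :+ n) :* a) refl (fromℕ (suc i)) (f (suc (suc i)))) (λ _ → refl))

  -- The sum of f i * g j over the triangle i + j < n.
  cauchy : ℕ → (ℕ → ℝ) → (ℕ → ℝ) → ℝ
  cauchy n f g = ∑< n (λ k → conv k f g)

  conv-nonneg : ∀ n → (∀ i → 0# ≤ f i) → (∀ i → 0# ≤ g i) → 0# ≤ conv n f g
  conv-nonneg zero    0≤f 0≤g = *-nonneg (0≤f 0) (0≤g 0)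
  conv-nonneg (suc n) 0≤f 0≤g = +-nonneg (*-nonneg (0≤f 0) (0≤g _)) (conv-nonneg n (0≤f ∘ suc) 0≤g)

  cauchy-suc : ∀ n (f g : ℕ → ℝ) → cauchy (suc n) f g ≈ f 0 * ∑< (suc n) g + cauchy n (f ∘ suc) g
  cauchy-suc n f g = begin
    f 0 * g 0 + ∑< n (λ k → f 0 * g (suc k) + conv k (f ∘ suc) g)
      ≈⟨ +-congˡ (∑-+ n (λ k → f 0 * g (suc k)) (λ k → conv k (f ∘ suc) g)) ⟩
    f 0 * g 0 + (∑< n (λ k → f 0 * g (suc k)) + C)
      ≈⟨ +-congˡ (+-congʳ (sym (*-distribˡ-∑ n (f 0) (g ∘ suc)))) ⟩
    f 0 * g 0 + (f 0 * ∑< n (g ∘ suc) + C)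
      ≈⟨ solve 4 (λ a b c d → a :* b :+ (a :* c :+ d) := a :* (b :+ c) :+ d) refl (f 0) (g 0) (∑< n (g ∘ suc)) C ⟩
    f 0 * (g 0 + ∑< n (g ∘ suc)) + C ∎
    where
    open import Relation.Binary.Reasoning.Setoid setoid
    C : ℝ
    C = cauchy n (f ∘ suc) g

  -- The rectangle i < m, j < n lies in the triangle i + j < m + n, and all terms are nonnegative.
  ∑*∑≤cauchy : ∀ m n → (∀ i → 0# ≤ f i) → (∀ i → 0# ≤ g i) → ∑< m f * ∑< n g ≤ cauchy (m ℕ.+ n) f g
  ∑*∑≤cauchy {f} {g} zero n 0≤f 0≤g = ≤-trans (≤-reflexive (zeroˡ _)) (∑-nonneg n (λ k → conv-nonneg k 0≤f 0≤g))
  ∑*∑≤cauchy {f} {g} (suc m) n 0≤f 0≤g = begin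
    (f 0 + ∑< m (f ∘ suc)) * ∑< n g          ≈⟨ distribʳ _ _ _ ⟩
    f 0 * ∑< n g + ∑< m (f ∘ suc) * ∑< n g   ≤⟨ +-mono-≤ (*-monoˡ-≤ (0≤f 0) (∑-monoˡ-≤ 0≤g (ℕ.m≤n+m n (suc m)))) (∑*∑≤cauchy m n (0≤f ∘ suc) 0≤g) ⟩
    f 0 * ∑< (suc m ℕ.+ n) g + cauchy (m ℕ.+ n) (f ∘ suc) g  ≈⟨ cauchy-suc (m ℕ.+ n) f g ⟨
    cauchy (suc m ℕ.+ n) f g                 ∎
    where open ≤-Reasoning

  ∑-tail-±≤ : (∀ i → g i ±≤ G i) → (∀ i → 0# ≤ G i) → m ℕ.≤ n → ∑< n g - ∑< m g ±≤ ∑< n G - ∑< m G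
  ∑-tail-±≤ {n = zero} g≤G 0≤G z≤n =
    ±≤-resp (solve 0 (con (+ 0) := con (+ 0) :- con (+ 0)) refl) (solve 0 (con (+ 0) := con (+ 0) :- con (+ 0)) refl) (nonneg⇒±≤ ≤-refl)
  ∑-tail-±≤ {g} {G} {n = suc n} g≤G 0≤G z≤n =
    ±≤-resp (solve 2 (λ a b → a :+ (b :- con (+ 0)) := (a :+ b) :- con (+ 0)) refl (g 0) (∑< n (g ∘ suc)))
            (solve 2 (λ a b → a :+ (b :- con (+ 0)) := (a :+ b) :- con (+ 0)) refl (G 0) (∑< n (G ∘ suc)))
            (±≤-+ (g≤G 0) (∑-tail-±≤ {n = n} (g≤G ∘ suc) (0≤G ∘ suc) z≤n))
  ∑-tail-±≤ {g} {G} {m = suc m} {n = suc n} g≤G 0≤G (s≤s m≤n) =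
    ±≤-resp (solve 3 (λ a b c → b :- c := (a :+ b) :- (a :+ c)) refl (g 0) (∑< n (g ∘ suc)) (∑< m (g ∘ suc)))
            (solve 3 (λ a b c → b :- c := (a :+ b) :- (a :+ c)) refl (G 0) (∑< n (G ∘ suc)) (∑< m (G ∘ suc)))
            (∑-tail-±≤ (g≤G ∘ suc) (0≤G ∘ suc) m≤n)

  -- For m ≤ n the triangle i + j < m lies in the rectangle i < m, j < n. Both differences are sums
  -- over the remaining pairs, and f i * g j is dominated there by F i * G j.
  ∑*∑-cauchy-±≤ : ∀ m n → (∀ i → f i ±≤ F i) → (∀ i → g i ±≤ G i) → (∀ i → 0# ≤ G i) → m ℕ.≤ n →
    ∑< m f * ∑< n g - cauchy m f g ±≤ ∑< m F * ∑< n G - cauchy m F G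
  ∑*∑-cauchy-±≤ {f} {F} {g} {G} zero n f≤F g≤G 0≤G m≤n =
    ±≤-resp (solve 1 (λ a → con (+ 0) := con (+ 0) :* a :- con (+ 0)) refl (∑< n g)) (solve 1 (λ a → con (+ 0) := con (+ 0) :* a :- con (+ 0)) refl (∑< n G)) (nonneg⇒±≤ ≤-refl)
  ∑*∑-cauchy-±≤ {f} {F} {g} {G} (suc m) n f≤F g≤G 0≤G m<n =
    ±≤-resp (split f g) (split F G)
      (±≤-+ (±≤-* (f≤F 0) (∑-tail-±≤ g≤G 0≤G m<n)) (∑*∑-cauchy-±≤ m n (f≤F ∘ suc) g≤G 0≤G (ℕ.<⇒≤ m<n)))
    where
    split : ∀ f g → f 0 * (∑< n g - ∑< (suc m) g) + (∑< m (f ∘ suc) * ∑< n g - cauchy m (f ∘ suc) g)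
                    ≈ ∑< (suc m) f * ∑< n g - cauchy (suc m) f g
    split f g = trans
      (solve 5 (λ a s t u c → a :* (s :- t) :+ (u :* s :- c) := (a :+ u) :* s :- (a :* t :+ c)) refl (f 0) (∑< n g) (∑< (suc m) g) (∑< m (f ∘ suc)) (cauchy m (f ∘ suc) g))
      (+-congˡ (-‿cong (sym (cauchy-suc m f g))))

  expTerm : ℝ → ℕ → ℝ
  expTerm x k = (x ^ k) / fromℕ (k !)

  expSum : ℝ → ℕ → ℝ
  expSum x n = ∑< n (expTerm x)

  ^-cong : ∀ n → x ≈ y → x ^ n ≈ y ^ n
  ^-cong zero    x≈y = refl
  ^-cong (suc n) x≈y = *-cong x≈y (^-cong n x≈y)

  expTerm-cong : ∀ k → x ≈ y → expTerm x k ≈ expTerm y k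
  expTerm-cong k x≈y = *-congʳ (^-cong k x≈y)

  1≤n! : ∀ n → 1 ℕ.≤ n !
  1≤n! zero    = s≤s z≤n
  1≤n! (suc n) = ℕ.*-mono-≤ (s≤s (z≤n {n})) (1≤n! n)

  expTerm-0 : ∀ x → expTerm x 0 ≈ 1#
  expTerm-0 x = trans (*-identityˡ _) recip-1

  expTerm-suc : ∀ x k → fromℕ (suc k) * expTerm x (suc k) ≈ x * expTerm x k
  expTerm-suc x k = begin
    S * ((x * x ^ k) * recip (suc k ℕ.* (k !)))       ≈⟨ *-congˡ (*-congˡ (recip-* {suc k} {k !} (s≤s z≤n) (1≤n! k))) ⟩
    S * ((x * x ^ k) * (recip (suc k) * recip (k !))) ≈⟨ solve 5 (λ s x p r q → s :* ((x :* p) :* (r :* q)) := (s :* r) :* (x :* (p :* q))) refl S x (x ^ k) (recip (suc k)) (recip (k !)) ⟩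
    (S * recip (suc k)) * (x * (x ^ k * recip (k !))) ≈⟨ *-congʳ (recip-inverseʳ {suc k} (s≤s z≤n)) ⟩
    1# * (x * (x ^ k * recip (k !)))                  ≈⟨ *-identityˡ _ ⟩
    x * (x ^ k * recip (k !))                         ∎
    where
    open import Relation.Binary.Reasoning.Setoid setoid
    S : ℝ
    S = fromℕ (suc k)

  expTerm-nonneg : 0# ≤ x → ∀ k → 0# ≤ expTerm x k
  expTerm-nonneg {x} 0≤x k = *-nonneg (^-nonneg k) (<⇒≤ (recip-pos (1≤n! k)))
    where
    ^-nonneg : ∀ k → 0# ≤ x ^ k
    ^-nonneg zero    = 0≤1
    ^-nonneg (suc k) = *-nonneg 0≤x (^-nonneg k)

  expTerm-±≤ : x ±≤ a → ∀ k → expTerm x k ±≤ expTerm a k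
  expTerm-±≤ {x} {a} x≤a k = ±≤-* (^-±≤ k) (nonneg⇒±≤ (<⇒≤ (recip-pos (1≤n! k))))
    where
    ^-±≤ : ∀ k → x ^ k ±≤ a ^ k
    ^-±≤ zero    = nonneg⇒±≤ 0≤1
    ^-±≤ (suc k) = ±≤-* x≤a (^-±≤ k)

  -- Replaces the binomial theorem: by the product rule both sides satisfy (n + 1) u (n + 1) = (x +
  -- y) u n, with u 0 = 1.
  conv-expTerm : ∀ x y n → conv n (expTerm x) (expTerm y) ≈ expTerm (x + y) n
  conv-expTerm x y zero = trans (*-cong (expTerm-0 x) (expTerm-0 y)) (trans (*-identityˡ 1#) (sym (expTerm-0 (x + y))))
  conv-expTerm x y (suc n) = *-cancelˡ-≈ (fromℕ-pos n) (begin
    fromℕ (suc n) * conv (suc n) X Y                      ≈⟨ conv-derivative n X Y ⟩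
    conv n (derivative X) Y + conv n X (derivative Y)     ≈⟨ +-cong (conv-cong n (expTerm-suc x) (λ _ → refl)) (conv-cong n (λ _ → refl) (expTerm-suc y)) ⟩
    conv n (λ i → x * X i) Y + conv n X (λ i → y * Y i)   ≈⟨ +-cong (conv-*ˡ n x X Y) (conv-*ʳ n y X Y) ⟩
    x * conv n X Y + y * conv n X Y                       ≈⟨ distribʳ _ x y ⟨
    (x + y) * conv n X Y                                  ≈⟨ *-congˡ (conv-expTerm x y n) ⟩
    (x + y) * expTerm (x + y) n                           ≈⟨ expTerm-suc (x + y) n ⟨
    fromℕ (suc n) * expTerm (x + y) (suc n)               ∎)
    where
    open import Relation.Binary.Reasoning.Setoid setoid
    X Y : ℕ → ℝ
    X = expTerm x
    Y = expTerm y

  cauchy-expTerm : ∀ x y n → cauchy n (expTerm x) (expTerm y) ≈ expSum (x + y) n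
  cauchy-expTerm x y n = ∑-cong n (conv-expTerm x y)

  expSum-mono : 0# ≤ x → m ℕ.≤ n → expSum x m ≤ expSum x n
  expSum-mono 0≤x = ∑-monoˡ-≤ (expTerm-nonneg 0≤x)

  -- From an index N > 2x on, each term is at most half of its predecessor.
  expSum-bounded : 0# ≤ x → ∃[ b ] (∀ n → expSum x n ≤ b)
  expSum-bounded {x} 0≤x = bound (archimedean (two * x))
    where
    bound : ∃[ N ] two * x < fromℕ N → ∃[ b ] (∀ n → expSum x n ≤ b)
    bound (N , 2x<N) = expSum x (N ℕ.+ 0) + two * expTerm x (N ℕ.+ 0) , λ n →
      ≤-trans (expSum-mono 0≤x (ℕ.m≤n+m n N))
        (≤-trans (≤-from (*-nonneg (<⇒≤ 0<two) (expTerm-nonneg 0≤x (N ℕ.+ n))) (solve 2 (λ s t → t := (s :+ t) :- s) refl _ _)) (potential n))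
      where
      open ≤-Reasoning
      halving : ∀ k → N ℕ.≤ k → two * expTerm x (suc k) ≤ expTerm x k
      halving k N≤k = *-cancelˡ-≤ (fromℕ-pos k) (begin
        fromℕ (suc k) * (two * expTerm x (suc k))  ≈⟨ solve 3 (λ a b c → a :* (b :* c) := b :* (a :* c)) refl (fromℕ (suc k)) two (expTerm x (suc k)) ⟩
        two * (fromℕ (suc k) * expTerm x (suc k))  ≈⟨ *-congˡ (expTerm-suc x k) ⟩
        two * (x * expTerm x k)                    ≈⟨ *-assoc _ _ _ ⟨
        two * x * expTerm x k                      ≤⟨ *-monoʳ-≤ (expTerm-nonneg 0≤x k) (≤-trans (<⇒≤ 2x<N) (fromℕ-mono-≤ (ℕ.m≤n⇒m≤1+n N≤k))) ⟩
        fromℕ (suc k) * expTerm x k                ∎)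

      -- Adding twice the next term gives a quantity that no longer increases: the term that enters
      -- the sum is paid for by the halving.
      potential : ∀ n → expSum x (N ℕ.+ n) + two * expTerm x (N ℕ.+ n) ≤ expSum x (N ℕ.+ 0) + two * expTerm x (N ℕ.+ 0)
      potential zero    = ≤-refl
      potential (suc n) = begin
        expSum x (N ℕ.+ suc n) + two * expTerm x (N ℕ.+ suc n)     ≡⟨ ≡.cong (λ k → expSum x k + two * expTerm x k) (ℕ.+-suc N n) ⟩
        expSum x (suc (N ℕ.+ n)) + two * expTerm x (suc (N ℕ.+ n)) ≤⟨ +-mono-≤ (≤-reflexive (∑-last (N ℕ.+ n) (expTerm x))) (halving (N ℕ.+ n) (ℕ.m≤m+n N n)) ⟩
        (expSum x (N ℕ.+ n) + t) + t                               ≈⟨ solve 2 (λ s t → (s :+ t) :+ t := s :+ (con (+ 1) :+ con (+ 1)) :* t) refl (expSum x (N ℕ.+ n)) t ⟩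
        expSum x (N ℕ.+ n) + two * t                               ≤⟨ potential n ⟩
        expSum x (N ℕ.+ 0) + two * expTerm x (N ℕ.+ 0)             ∎
        where
        t : ℝ
        t = expTerm x (N ℕ.+ n)

  expSum⟶exp : 0# ≤ x → expSum x ⟶ exp x
  expSum⟶exp {x} 0≤x = choose-spec (monotone-converges (expSum-mono 0≤x) (proj₂ (expSum-bounded 0≤x)))

  expSum≤exp : 0# ≤ x → ∀ n → expSum x n ≤ exp x
  expSum≤exp 0≤x n = limit-≥ (expSum⟶exp 0≤x) n (λ k → expSum-mono 0≤x)

  doubling-tail⟶0 : ∀ {s : ℕ → ℝ} {l} → s ⟶ l → (λ n → s (n ℕ.+ n) - s n) ⟶ 0#
  doubling-tail⟶0 {s} {l} lim = ⟶-intro (λ ε 0<ε → combine ε (⟶-elim lim (half ε) (half-pos 0<ε)))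
    where
    combine : ∀ ε → ∃[ N ] (∀ n → N ℕ.≤ n → s n - l ±≤ half ε) → ∃[ N ] (∀ n → N ℕ.≤ n → (s (n ℕ.+ n) - s n) - 0# ±≤ ε)
    combine ε (N , near) = N , λ n N≤n →
      ±≤-resp (solve 3 (λ s t l → (s :- l) :+ :- (t :- l) := (s :- t) :- con (+ 0)) refl (s (n ℕ.+ n)) (s n) l) (half+half ε)
        (±≤-+ (near (n ℕ.+ n) (ℕ.≤-trans N≤n (ℕ.m≤m+n n n))) (±≤-neg (near n N≤n)))

  -- Let a and b bound |x| and |y|. The product of the partial sums differs from `expSum (x + y) n`
  -- by at most the part of the series of a + b between n and 2n, which tends to 0. Convergence at x
  -- and y is assumed rather than x, y ≥ 0, so that a negative x can be treated in `exp-neg<1`.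
  expSum-limit-* : ∀ {x y l l′} → expSum x ⟶ l → expSum y ⟶ l′ → expSum (x + y) ⟶ (l * l′)
  expSum-limit-* {x} {y} {l} {l′} lim lim′ = conclude (±≤-bound x) (±≤-bound y)
    where
    conclude : ∃[ a ] (0# ≤ a × x ±≤ a) → ∃[ b ] (0# ≤ b × y ±≤ b) → expSum (x + y) ⟶ (l * l′)
    conclude (a , 0≤a , x≤a) (b , 0≤b , y≤b) =
      limit-perturb (limit-* bounded lim lim′) (doubling-tail⟶0 (expSum⟶exp (+-nonneg 0≤a 0≤b))) near
      where
      bounded : ∀ n → expSum x n ±≤ exp a
      bounded n = ±≤-weaken (expSum≤exp 0≤a n)
        (±≤-resp (solve 1 (λ s → s :- con (+ 0) := s) refl (expSum x n)) (solve 1 (λ s → s :- con (+ 0) := s) refl (expSum a n))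
          (∑-tail-±≤ {n = n} (expTerm-±≤ x≤a) (expTerm-nonneg 0≤a) z≤n))

      near : ∀ n → expSum (x + y) n - expSum x n * expSum y n ±≤ expSum (a + b) (n ℕ.+ n) - expSum (a + b) n
      near n = ±≤-weaken
        (+-mono-≤ (≤-trans (∑*∑≤cauchy n n (expTerm-nonneg 0≤a) (expTerm-nonneg 0≤b)) (≤-reflexive (cauchy-expTerm a b (n ℕ.+ n))))
          (≤-reflexive (-‿cong (cauchy-expTerm a b n))))
        (±≤-resp (trans (solve 2 (λ p c → :- (p :- c) := c :- p) refl (expSum x n * expSum y n) (cauchy n (expTerm x) (expTerm y))) (+-congʳ (cauchy-expTerm x y n))) refl
          (±≤-neg (∑*∑-cauchy-±≤ n n (expTerm-±≤ x≤a) (expTerm-±≤ y≤b) (expTerm-nonneg 0≤b) ℕ.≤-refl)))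

-- Inequalities for the exponential, and the logarithm on [1, ∞).

module Logarithm (lem : ExcludedMiddle 0ℓ) (reals : CompleteOrderedField) where

  open Exponential lem reals public

  private
    variable
      x y : ℝ
      m n : ℕ

  -- `exp` is chosen separately for each representative, so congruence rests on the uniqueness of
  -- limits and on convergence for x ≥ 0.
  exp-cong : 0# ≤ x → x ≈ y → exp x ≈ exp y
  exp-cong 0≤x x≈y = limit-unique (limit-cong (λ n → ∑-cong n (λ k → expTerm-cong k x≈y)) (expSum⟶exp 0≤x))
    (expSum⟶exp (≤-trans 0≤x (≤-reflexive x≈y)))

  exp-+ : 0# ≤ x → 0# ≤ y → exp (x + y) ≈ exp x * exp y
  exp-+ 0≤x 0≤y = limit-unique (expSum⟶exp (+-nonneg 0≤x 0≤y)) (expSum-limit-* (expSum⟶exp 0≤x) (expSum⟶exp 0≤y))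

  1+x≤exp : 0# ≤ x → 1# + x ≤ exp x
  1+x≤exp {x} 0≤x = ≤-trans (≤-reflexive (sym first-two)) (expSum≤exp 0≤x 2)
    where
    open import Relation.Binary.Reasoning.Setoid setoid
    first-two : expSum x 2 ≈ 1# + x
    first-two = begin
      expTerm x 0 + (expTerm x 1 + 0#)     ≈⟨ +-congˡ (solve 1 (λ t → t :+ con (+ 0) := (con (+ 1) :+ con (+ 0)) :* t) refl (expTerm x 1)) ⟩
      expTerm x 0 + fromℕ 1 * expTerm x 1  ≈⟨ +-congˡ (expTerm-suc x 0) ⟩
      expTerm x 0 + x * expTerm x 0        ≈⟨ +-cong (expTerm-0 x) (*-congˡ (expTerm-0 x)) ⟩
      1# + x * 1#                          ≈⟨ +-congˡ (*-identityʳ x) ⟩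
      1# + x                               ∎

  -- Three terms of the series, cleared of the denominator 2. With x = log log n this is the
  -- quadratic growth of log n that sends the first liminf to -∞.
  half-square≤exp : 0# ≤ x → two * (1# + x) + x * x ≤ two * exp x
  half-square≤exp {x} 0≤x = ≤-trans (≤-reflexive (sym first-three)) (*-monoˡ-≤ (<⇒≤ 0<two) (expSum≤exp 0≤x 3))
    where
    open import Relation.Binary.Reasoning.Setoid setoid
    t₀ t₁ t₂ : ℝ
    t₀ = expTerm x 0
    t₁ = expTerm x 1
    t₂ = expTerm x 2

    t₁≈x : t₁ ≈ x
    t₁≈x = begin
      t₁                  ≈⟨ solve 1 (λ t → t := (con (+ 1) :+ con (+ 0)) :* t) refl t₁ ⟩
      fromℕ 1 * t₁        ≈⟨ expTerm-suc x 0 ⟩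
      x * t₀              ≈⟨ *-congˡ (expTerm-0 x) ⟩
      x * 1#              ≈⟨ *-identityʳ x ⟩
      x                   ∎

    first-three : two * expSum x 3 ≈ two * (1# + x) + x * x
    first-three = begin
      two * (t₀ + (t₁ + (t₂ + 0#)))
        ≈⟨ solve 3 (λ a b c → (con (+ 1) :+ con (+ 1)) :* (a :+ (b :+ (c :+ con (+ 0)))) := (con (+ 1) :+ con (+ 1)) :* (a :+ b) :+ (con (+ 1) :+ (con (+ 1) :+ con (+ 0))) :* c) refl t₀ t₁ t₂ ⟩
      two * (t₀ + t₁) + fromℕ 2 * t₂   ≈⟨ +-cong (*-congˡ (+-cong (expTerm-0 x) t₁≈x)) (trans (expTerm-suc x 1) (*-congˡ t₁≈x)) ⟩
      two * (1# + x) + x * x           ∎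

  1≤exp : 0# ≤ x → 1# ≤ exp x
  1≤exp {x} 0≤x = ≤-trans (≤-from 0≤x (solve 1 (λ x → x := (con (+ 1) :+ x) :- con (+ 1)) refl x)) (1+x≤exp 0≤x)

  exp-pos : 0# ≤ x → 0# < exp x
  exp-pos 0≤x = <-≤-trans 0<1 (1≤exp 0≤x)

  1<exp : 0# < x → 1# < exp x
  1<exp {x} 0<x = <-≤-trans (<-from 0<x (solve 1 (λ x → x := (con (+ 1) :+ x) :- con (+ 1)) refl x)) (1+x≤exp (<⇒≤ 0<x))

  expSum-0 : expSum 0# ⟶ 1#
  expSum-0 = ⟶-intro (λ ε 0<ε → 1 , λ { (suc n) _ →
      ±≤-resp (sym (is-zero n)) refl (±≤-weaken (<⇒≤ 0<ε) (nonneg⇒±≤ ≤-refl)) })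
    where
    tail-zero : ∀ n (f : ℕ → ℝ) → (∀ i → f i ≈ 0#) → ∑< n f ≈ 0#
    tail-zero zero    f f≈0 = refl
    tail-zero (suc n) f f≈0 = trans (+-cong (f≈0 0) (tail-zero n (f ∘ suc) (f≈0 ∘ suc))) (+-identityˡ 0#)

    is-zero : ∀ n → expSum 0# (suc n) - 1# ≈ 0#
    is-zero n = trans (+-congʳ (+-cong (expTerm-0 0#) (tail-zero n (expTerm 0# ∘ suc) (λ i → trans (*-congʳ (zeroˡ _)) (zeroˡ _)))))
      (solve 0 ((con (+ 1) :+ con (+ 0)) :- con (+ 1) := con (+ 0)) refl)

  exp-0 : exp 0# ≈ 1#
  exp-0 = limit-unique (expSum⟶exp ≤-refl) expSum-0

  -- Convergence at negative x is not established separately: either `exp x` is the default 0, or it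
  -- is a limit, and then exp x * exp (- x) = 1 with exp (- x) > 1.
  exp-neg<1 : x < 0# → exp x < 1#
  exp-neg<1 {x} x<0 = decide choose-cases
    where
    0<-x : 0# < - x
    0<-x = <-from (x<y⇒0<y-x x<0) (solve 1 (λ x → con (+ 0) :- x := :- x :- con (+ 0)) refl x)

    decide : expSum x ⟶ exp x ⊎ exp x ≡ 0# → exp x < 1#
    decide (inj₂ exp≡0) = <-respˡ-≈ (sym (reflexive exp≡0)) 0<1
    decide (inj₁ lim)   = ≰⇒> λ 1≤expx → <-irrefl refl (begin-strict
      1#                   <⟨ 1<exp 0<-x ⟩
      exp (- x)            ≈⟨ *-identityˡ _ ⟨
      1# * exp (- x)       ≤⟨ *-monoʳ-≤ (<⇒≤ (exp-pos (<⇒≤ 0<-x))) 1≤expx ⟩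
      exp x * exp (- x)    ≈⟨ product≈1 ⟩
      1#                   ∎)
      where
      open ≤-Reasoning
      product≈1 : exp x * exp (- x) ≈ 1#
      product≈1 = limit-unique (expSum-limit-* lim (expSum⟶exp (<⇒≤ 0<-x)))
        (limit-cong (λ n → ∑-cong n (λ k → expTerm-cong k (sym (-‿inverseʳ x)))) expSum-0)

  exp-mono-< : 0# ≤ x → x < y → exp x < exp y
  exp-mono-< {x} {y} 0≤x x<y = begin-strict
    exp x                  ≈⟨ *-identityʳ _ ⟨
    exp x * 1#             <⟨ *-monoˡ-< (exp-pos 0≤x) (1<exp (x<y⇒0<y-x x<y)) ⟩
    exp x * exp (y - x)    ≈⟨ exp-+ 0≤x (<⇒≤ (x<y⇒0<y-x x<y)) ⟨
    exp (x + (y - x))      ≈⟨ exp-cong (+-nonneg 0≤x (<⇒≤ (x<y⇒0<y-x x<y))) (solve 2 (λ x y → x :+ (y :- x) := y) refl x y) ⟩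
    exp y                  ∎
    where open ≤-Reasoning

  exp-cancel-≤ : 0# ≤ y → exp x ≤ exp y → x ≤ y
  exp-cancel-≤ 0≤y ex≤ey y<x = ex≤ey (exp-mono-< 0≤y y<x)

  -- Comparison with the geometric series. Together with `exp-+` it bounds how fast `exp` grows and
  -- so stands in for continuity.
  exp*[1-x]≤1 : 0# ≤ x → x < 1# → exp x * (1# - x) ≤ 1#
  exp*[1-x]≤1 {x} 0≤x x<1 = ≤-trans (≤-reflexive (*-comm _ _))
    (≤-trans (*-monoˡ-≤ (<⇒≤ 0<1-x) (limit-≤ (expSum⟶exp 0≤x) (λ n → ≤-/ 0<1-x (≤-trans (≤-reflexive (*-comm _ _)) (partial n)))))
      (≤-reflexive (*-/-cancel 0<1-x)))
    where
    open ≤-Reasoning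
    0<1-x : 0# < 1# - x
    0<1-x = x<y⇒0<y-x x<1

    term-≤ : ∀ n → expTerm x (suc n) ≤ x * expTerm x n
    term-≤ n = ≤-trans (≤-from (*-nonneg (fromℕ-nonneg n) (expTerm-nonneg 0≤x (suc n)))
      (solve 2 (λ n t → n :* t := (con (+ 1) :+ n) :* t :- t) refl (fromℕ n) (expTerm x (suc n)))) (≤-reflexive (expTerm-suc x n))

    -- Keeping the term `expTerm x n` closes the induction, because the next term is at most x times
    -- this one.
    refined : ∀ n → expSum x n * (1# - x) ≤ 1# - expTerm x n
    refined zero = ≤-reflexive (trans (solve 1 (λ x → con (+ 0) :* (con (+ 1) :- x) := con (+ 1) :- con (+ 1)) refl x) (+-congˡ (-‿cong (sym (expTerm-0 x)))))
    refined (suc n) = begin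
      expSum x (suc n) * (1# - x)        ≈⟨ *-congʳ (∑-last n (expTerm x)) ⟩
      (expSum x n + t) * (1# - x)        ≈⟨ solve 3 (λ s t x → (s :+ t) :* (con (+ 1) :- x) := s :* (con (+ 1) :- x) :+ (t :- x :* t)) refl (expSum x n) t x ⟩
      expSum x n * (1# - x) + (t - x * t)  ≤⟨ +-mono-≤ (refined n) (+-monoʳ-≤ t (≤-from (x≤y⇒0≤y-x (term-≤ n)) (solve 2 (λ a b → a :- b := :- b :- (:- a)) refl (x * t) (expTerm x (suc n))))) ⟩
      (1# - t) + (t - expTerm x (suc n)) ≈⟨ solve 2 (λ t u → (con (+ 1) :- t) :+ (t :- u) := con (+ 1) :- u) refl t (expTerm x (suc n)) ⟩
      1# - expTerm x (suc n)             ∎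
      where
      t : ℝ
      t = expTerm x n

    partial : ∀ n → expSum x n * (1# - x) ≤ 1#
    partial n = ≤-trans (refined n) (≤-from (expTerm-nonneg 0≤x n) (solve 1 (λ t → t := con (+ 1) :- (con (+ 1) :- t)) refl (expTerm x n)))

  -- The preimage is the supremum s of all l ≥ 0 with exp l ≤ y; a strict inequality either way is
  -- refuted by moving s by an explicit h.
  exp-surjective : 1# ≤ y → ∃[ l ] exp l ≈ y
  exp-surjective {y} 1≤y = s , ≤-antisym exps≤y y≤exps
    where
    open ≤-Reasoning
    0<y : 0# < y
    0<y = <-≤-trans 0<1 1≤y

    S : ℝ → Set
    S l = 0# ≤ l × exp l ≤ y

    0∈S : S 0#
    0∈S = ≤-refl , ≤-trans (≤-reflexive exp-0) 1≤y

    sup : Σ[ s ∈ ℝ ] UpperBound S s × (∀ u → UpperBound S u → s ≤ u)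
    sup = supremum S (0# , 0∈S) (y , λ { l (0≤l , expl≤y) →
      ≤-trans (≤-from 0≤1 (solve 1 (λ l → con (+ 1) := (con (+ 1) :+ l) :- l) refl l)) (≤-trans (1+x≤exp 0≤l) expl≤y) })

    s : ℝ
    s = proj₁ sup

    0≤s : 0# ≤ s
    0≤s = proj₁ (proj₂ sup) 0# 0∈S

    y≤exps : y ≤ exp s
    y≤exps exps<y = proj₁ (proj₂ sup) (s + h) (+-nonneg 0≤s (<⇒≤ 0<h) , exp[s+h]≤y) (<-from 0<h (solve 2 (λ s h → h := (s :+ h) :- s) refl s h))
      where
      -- Chosen so that y * (1 - h) = exp s; then exp (s + h) ≤ exp s / (1 - h) = y, and s + h still
      -- belongs to `S`.
      h : ℝ
      h = (y - exp s) / y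

      0<h : 0# < h
      0<h = /-pos (x<y⇒0<y-x exps<y) 0<y

      y[1-h] : y * (1# - h) ≈ exp s
      y[1-h] = trans (solve 2 (λ y h → y :* (con (+ 1) :- h) := y :- y :* h) refl y h)
        (trans (+-congˡ (-‿cong (*-/-cancel 0<y))) (solve 2 (λ y e → y :- (y :- e) := e) refl y (exp s)))

      0<1-h : 0# < 1# - h
      0<1-h = *-cancelˡ-< 0<y (<-respˡ-≈ (sym (zeroʳ y)) (<-respʳ-≈ (sym y[1-h]) (exp-pos 0≤s)))

      h<1 : h < 1#
      h<1 = <-from 0<1-h refl

      exp[s+h]≤y : exp (s + h) ≤ y
      exp[s+h]≤y = *-cancelˡ-≤ 0<1-h (begin
        (1# - h) * exp (s + h)       ≈⟨ *-congˡ (exp-+ 0≤s (<⇒≤ 0<h)) ⟩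
        (1# - h) * (exp s * exp h)   ≈⟨ solve 3 (λ a b c → a :* (b :* c) := b :* (c :* a)) refl (1# - h) (exp s) (exp h) ⟩
        exp s * (exp h * (1# - h))   ≤⟨ *-monoˡ-≤ (<⇒≤ (exp-pos 0≤s)) (exp*[1-x]≤1 (<⇒≤ 0<h) h<1) ⟩
        exp s * 1#                   ≈⟨ *-identityʳ _ ⟩
        exp s                        ≈⟨ y[1-h] ⟨
        y * (1# - h)                 ≈⟨ *-comm _ _ ⟩
        (1# - h) * y                 ∎)

    exps≤y : exp s ≤ y
    exps≤y y<exps = proj₂ (proj₂ sup) (s - h) upper (<-from 0<h (solve 2 (λ s h → h := s :- (s :- h)) refl s h))
      where
      -- Now exp s * (1 - h) = y. An l in `S` above s - h is s - t with t < h, and then exp l ≥ exp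
      -- s * (1 - t) > y, which is absurd; so s - h is an upper bound.
      h : ℝ
      h = (exp s - y) / exp s

      0<h : 0# < h
      0<h = /-pos (x<y⇒0<y-x y<exps) (exp-pos 0≤s)

      exps[1-h] : exp s * (1# - h) ≈ y
      exps[1-h] = trans (solve 2 (λ y h → y :* (con (+ 1) :- h) := y :- y :* h) refl (exp s) h)
        (trans (+-congˡ (-‿cong (*-/-cancel (exp-pos 0≤s)))) (solve 2 (λ y e → e :- (e :- y) := y) refl y (exp s)))

      0<1-h : 0# < 1# - h
      0<1-h = *-cancelˡ-< (exp-pos 0≤s) (<-respˡ-≈ (sym (zeroʳ (exp s))) (<-respʳ-≈ (sym exps[1-h]) 0<y))

      upper : UpperBound S (s - h)
      upper l (0≤l , expl≤y) s-h<l = <-irrefl refl (begin-strict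
        y                             ≈⟨ exps[1-h] ⟨
        exp s * (1# - h)              <⟨ *-monoˡ-< (exp-pos 0≤s) 1-h<1-t ⟩
        exp s * (1# - t)              ≈⟨ *-congʳ (exp-cong 0≤s (solve 2 (λ s l → s := l :+ (s :- l)) refl s l)) ⟩
        exp (l + t) * (1# - t)        ≈⟨ *-congʳ (exp-+ 0≤l 0≤t) ⟩
        exp l * exp t * (1# - t)      ≈⟨ *-assoc _ _ _ ⟩
        exp l * (exp t * (1# - t))    ≤⟨ *-monoˡ-≤ (<⇒≤ (exp-pos 0≤l)) (exp*[1-x]≤1 0≤t t<1) ⟩
        exp l * 1#                    ≈⟨ *-identityʳ _ ⟩
        exp l                         ≤⟨ expl≤y ⟩
        y                             ∎)
        where
        t : ℝ
        t = s - l

        0≤t : 0# ≤ t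
        0≤t = x≤y⇒0≤y-x (proj₁ (proj₂ sup) l (0≤l , expl≤y))

        1-h<1-t : 1# - h < 1# - t
        1-h<1-t = <-from (x<y⇒0<y-x s-h<l) (solve 3 (λ s h l → l :- (s :- h) := (con (+ 1) :- (s :- l)) :- (con (+ 1) :- h)) refl s h l)

        t<1 : t < 1#
        t<1 = <-from (<-trans 0<1-h 1-h<1-t) refl

  exp-log : 1# ≤ y → exp (log y) ≈ y
  exp-log 1≤y = choose-spec (exp-surjective 1≤y)

  -- `log` picks some solution of exp l = y, and a negative one is excluded by `exp-neg<1`. This
  -- sign is what allows `exp-cancel-≤` to compare logarithms.
  log-nonneg : 1# ≤ y → 0# ≤ log y
  log-nonneg {y} 1≤y log<0 = 1≤y (<-respˡ-≈ (exp-log 1≤y) (exp-neg<1 log<0))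

  log-mono-≤ : 1# ≤ x → x ≤ y → log x ≤ log y
  log-mono-≤ 1≤x x≤y = exp-cancel-≤ (log-nonneg 1≤y)
    (≤-trans (≤-reflexive (exp-log 1≤x)) (≤-trans x≤y (≤-reflexive (sym (exp-log 1≤y)))))
    where 1≤y = ≤-trans 1≤x x≤y

  log-* : 1# ≤ x → 1# ≤ y → log (x * y) ≈ log x + log y
  log-* {x} {y} 1≤x 1≤y = ≤-antisym (exp-cancel-≤ 0≤r (≤-reflexive eq)) (exp-cancel-≤ (log-nonneg 1≤xy) (≤-reflexive (sym eq)))
    where
    1≤xy : 1# ≤ x * y
    1≤xy = ≤-trans (≤-reflexive (sym (*-identityˡ 1#))) (*-mono-≤ 0≤1 0≤1 1≤x 1≤y)

    0≤r : 0# ≤ log x + log y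
    0≤r = +-nonneg (log-nonneg 1≤x) (log-nonneg 1≤y)

    eq : exp (log (x * y)) ≈ exp (log x + log y)
    eq = trans (exp-log 1≤xy) (sym (trans (exp-+ (log-nonneg 1≤x) (log-nonneg 1≤y)) (*-cong (exp-log 1≤x) (exp-log 1≤y))))

  x≤log : 0# ≤ x → exp x ≤ y → x ≤ log y
  x≤log {x} {y} 0≤x expx≤y = exp-cancel-≤ (log-nonneg 1≤y) (≤-trans expx≤y (≤-reflexive (sym (exp-log 1≤y))))
    where
    1≤y : 1# ≤ y
    1≤y = ≤-trans (1≤exp 0≤x) expx≤y

  1≤fromℕ : 1 ℕ.≤ n → 1# ≤ fromℕ n
  1≤fromℕ 1≤n = ≤-trans (≤-reflexive (sym fromℕ-1)) (fromℕ-mono-≤ 1≤n)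

  λ₂ : ℝ
  λ₂ = log (fromℕ 2)

  log-fromℕ-* : 1 ℕ.≤ m → 1 ℕ.≤ n → log (fromℕ (m ℕ.* n)) ≈ log (fromℕ m) + log (fromℕ n)
  log-fromℕ-* {m} {n} 1≤m 1≤n = trans (≤-antisym (log-mono-≤ 1≤mn (≤-reflexive (fromℕ-* m n))) (log-mono-≤ 1≤mn′ (≤-reflexive (sym (fromℕ-* m n)))))
    (log-* (1≤fromℕ 1≤m) (1≤fromℕ 1≤n))
    where
    1≤mn : 1# ≤ fromℕ (m ℕ.* n)
    1≤mn = 1≤fromℕ (ℕ.*-mono-≤ 1≤m 1≤n)

    1≤mn′ : 1# ≤ fromℕ m * fromℕ n
    1≤mn′ = ≤-trans 1≤mn (≤-reflexive (fromℕ-* m n))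

  1≤2^n : ∀ n → 1 ℕ.≤ 2 ℕ.^ n
  1≤2^n n = ℕ.m^n>0 2 n

  log-2^ : ∀ n → log (fromℕ (2 ℕ.^ n)) ≈ fromℕ n * λ₂
  -- log 1 = 0 follows from log 1 = log (1 * 1) = log 1 + log 1.
  log-2^ zero = trans (sym (+-identityˡ _)) (trans (+-congʳ (sym (-‿inverseˡ L)))
      (trans (+-assoc _ _ _) (trans (+-congˡ (sym (log-fromℕ-* {1} {1} (s≤s z≤n) (s≤s z≤n)))) (trans (-‿inverseˡ L) (sym (zeroˡ λ₂))))))
    where
    L : ℝ
    L = log (fromℕ 1)
  log-2^ (suc n) = trans (log-fromℕ-* {2} {2 ℕ.^ n} (s≤s z≤n) (1≤2^n n))
    (trans (+-congˡ (log-2^ n)) (solve 2 (λ l n → l :+ n :* l := (con (+ 1) :+ n) :* l) refl λ₂ (fromℕ n)))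

  -- exp (1/2) * (1 - 1/2) ≤ 1 says exp (1/2) ≤ 2. The constant 1/2 makes 2 log 2 ≥ 1, as used in
  -- `loglog-2^2^`.
  ½≤λ₂ : half 1# ≤ λ₂
  ½≤λ₂ = x≤log (<⇒≤ 0<½) (*-cancelˡ-≤ 0<½ (begin
    half 1# * exp (half 1#)            ≈⟨ *-comm _ _ ⟩
    exp (half 1#) * half 1#            ≈⟨ *-congˡ ½≈1-½ ⟩
    exp (half 1#) * (1# - half 1#)     ≤⟨ exp*[1-x]≤1 (<⇒≤ 0<½) (<-from 0<½ ½≈1-½) ⟩
    1#                                 ≈⟨ half+half 1# ⟨
    half 1# + half 1#                  ≈⟨ solve 1 (λ h → h :+ h := h :* (con (+ 1) :+ (con (+ 1) :+ con (+ 0)))) refl (half 1#) ⟩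
    half 1# * fromℕ 2                  ∎))
    where
    open ≤-Reasoning
    0<½ : 0# < half 1#
    0<½ = half-pos 0<1

    ½≈1-½ : half 1# ≈ 1# - half 1#
    ½≈1-½ = trans (solve 1 (λ h → h := (h :+ h) :- h) refl (half 1#)) (+-congʳ (half+half 1#))

  λ₂-pos : 0# < λ₂
  λ₂-pos = <-≤-trans (half-pos 0<1) ½≤λ₂

-- Countable interval covers, null sets and the Borel-Cantelli lemma.

module Covering (lem : ExcludedMiddle 0ℓ) (reals : CompleteOrderedField) where

  open Logarithm lem reals public

  private
    variable
      a b c e x y z : ℝ
      k n : ℕ
      S S′ E : ℝ → Set

  Interval : Set
  Interval = ℝ × ℝ

  length : Interval → ℝ
  length (lo , hi) = hi - lo

  -- Null S is definitionally ∀ ε → 0# < ε → Cover S ε.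
  Cover : (ℝ → Set) → ℝ → Set
  Cover S c =
    Σ[ lo ∈ (ℕ → ℝ) ] Σ[ hi ∈ (ℕ → ℝ) ]
      (∀ i → lo i ≤ hi i) ×
      (∀ x → S x → ∃[ i ] lo i < x × x < hi i) ×
      (∀ n → ∑< n (λ i → hi i - lo i) ≤ c)

  cover-⊆ : (∀ x → S x → S′ x) → Cover S′ c → Cover S c
  cover-⊆ S⊆S′ (lo , hi , lo≤hi , covers , total) = lo , hi , lo≤hi , (λ x Sx → covers x (S⊆S′ x Sx)) , total

  cover-≤ : a ≤ b → Cover S a → Cover S b
  cover-≤ a≤b (lo , hi , lo≤hi , covers , total) = lo , hi , lo≤hi , covers , λ n → ≤-trans (total n) a≤b

  ∑-zero : ∀ n → ∑< n (λ _ → 0# - 0#) ≈ 0#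
  ∑-zero zero    = refl
  ∑-zero (suc n) = trans (+-cong (-‿inverseʳ 0#) (∑-zero n)) (+-identityˡ 0#)

  cover-interval : a ≤ b → (∀ x → S x → a < x × x < b) → Cover S (b - a)
  cover-interval {a} {b} {S} a≤b S⊆ab = lo , hi , lo≤hi , (λ x Sx → 0 , S⊆ab x Sx) , total
    where
    lo hi : ℕ → ℝ
    lo zero    = a
    lo (suc _) = 0#
    hi zero    = b
    hi (suc _) = 0#

    lo≤hi : ∀ i → lo i ≤ hi i
    lo≤hi zero    = a≤b
    lo≤hi (suc _) = ≤-refl

    total : ∀ n → ∑< n (λ i → hi i - lo i) ≤ b - a
    total zero    = x≤y⇒0≤y-x a≤b
    total (suc n) = ≤-reflexive (trans (+-congˡ (∑-zero n)) (+-identityʳ _))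

  cover-∅ : (∀ x → ¬ S x) → Cover S 0#
  cover-∅ empty = cover-≤ (≤-reflexive (-‿inverseʳ 0#)) (cover-interval ≤-refl (λ x Sx → ⊥-elim (empty x Sx)))

  -- The sequence f 0, g 0, f 1, g 1, ...; the two arguments exchange roles at every step.
  interleave : {A : Set} → (ℕ → A) → (ℕ → A) → ℕ → A
  interleave f g zero    = f 0
  interleave f g (suc k) = interleave g (f ∘ suc) k

  interleave-left : {A : Set} (f g : ℕ → A) → ∀ j → interleave f g (j ℕ.+ j) ≡ f j
  interleave-left f g zero    = ≡.refl
  interleave-left f g (suc j) = ≡.trans (≡.cong (λ k → interleave g (f ∘ suc) k) (ℕ.+-suc j j)) (interleave-left (f ∘ suc) (g ∘ suc) j)

  interleave-right : {A : Set} (f g : ℕ → A) → ∀ j → interleave f g (suc (j ℕ.+ j)) ≡ g j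
  interleave-right f g j = interleave-left g (f ∘ suc) j

  interleave-cong : {A : Set} (f g f′ g′ : ℕ → A) → ∀ k →
    (∀ j → j ℕ.≤ k → f j ≡ f′ j) → (∀ j → j ℕ.< k → g j ≡ g′ j) → interleave f g k ≡ interleave f′ g′ k
  interleave-cong f g f′ g′ zero    f≡f′ g≡g′ = f≡f′ 0 z≤n
  interleave-cong f g f′ g′ (suc k) f≡f′ g≡g′ =
    interleave-cong g (f ∘ suc) g′ (f′ ∘ suc) k (λ j j≤k → g≡g′ j (s≤s j≤k)) (λ j j<k → f≡f′ (suc j) (ℕ.m≤n⇒m≤1+n j<k))

  interleave-∑ : {A : Set} (w : A → ℝ) → ∀ n (f g : ℕ → A) →
    ∃[ i ] ∃[ j ] ∑< n (w ∘ interleave f g) ≈ ∑< i (w ∘ f) + ∑< j (w ∘ g)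
  interleave-∑ w zero    f g = 0 , 0 , sym (+-identityˡ 0#)
  interleave-∑ w (suc n) f g = extend (interleave-∑ w n g (f ∘ suc))
    where
    extend : ∃[ i ] ∃[ j ] ∑< n (w ∘ interleave g (f ∘ suc)) ≈ ∑< i (w ∘ g) + ∑< j (w ∘ f ∘ suc) →
      ∃[ i ] ∃[ j ] ∑< (suc n) (w ∘ interleave f g) ≈ ∑< i (w ∘ f) + ∑< j (w ∘ g)
    extend (i , j , eq) = suc j , i , trans (+-congˡ eq)
      (solve 3 (λ a b c → a :+ (b :+ c) := (a :+ c) :+ b) refl (w (f 0)) (∑< i (w ∘ g)) (∑< j (w ∘ f ∘ suc)))

  -- The first n rows of F, interleaved. On each index this stabilises as n
  -- grows, and the stable values enumerate the whole array.
  mergeRows : {A : Set} → A → ℕ → (ℕ → ℕ → A) → ℕ → A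
  mergeRows a₀ zero    F = λ _ → a₀
  mergeRows a₀ (suc n) F = interleave (F 0) (mergeRows a₀ n (F ∘ suc))

  mergeRows-stable : {A : Set} (a₀ : A) → ∀ n (F : ℕ → ℕ → A) k → k ℕ.< n → mergeRows a₀ n F k ≡ mergeRows a₀ (suc n) F k
  mergeRows-stable a₀ (suc n) F k (s≤s k≤n) =
    interleave-cong (F 0) (mergeRows a₀ n (F ∘ suc)) (F 0) (mergeRows a₀ (suc n) (F ∘ suc)) k (λ _ _ → ≡.refl)
      (λ j j<k → mergeRows-stable a₀ n (F ∘ suc) j (ℕ.<-≤-trans j<k k≤n))

  -- Row i first appears at an index at least i, so `suc k` rows determine the entry at index k.
  enumerate : {A : Set} → A → (ℕ → ℕ → A) → ℕ → A
  enumerate a₀ F k = mergeRows a₀ (suc k) F k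

  mergeRows≡enumerate : {A : Set} (a₀ : A) (F : ℕ → ℕ → A) → ∀ k j → mergeRows a₀ (suc k ℕ.+ j) F k ≡ enumerate a₀ F k
  mergeRows≡enumerate a₀ F k zero    = ≡.cong (λ n → mergeRows a₀ n F k) (ℕ.+-identityʳ (suc k))
  mergeRows≡enumerate a₀ F k (suc j) = ≡.trans (≡.cong (λ n → mergeRows a₀ n F k) (ℕ.+-suc (suc k) j))
    (≡.trans (≡.sym (mergeRows-stable a₀ (suc k ℕ.+ j) F k (ℕ.m≤m+n (suc k) j))) (mergeRows≡enumerate a₀ F k j))

  mergeRows-surjective : {A : Set} (a₀ : A) → ∀ i j → ∃[ k ] (∀ n (F : ℕ → ℕ → A) → i ℕ.< n → mergeRows a₀ n F k ≡ F i j)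
  mergeRows-surjective a₀ zero    j = j ℕ.+ j , λ { (suc n) F _ → interleave-left (F 0) (mergeRows a₀ n (F ∘ suc)) j }
  mergeRows-surjective a₀ (suc i) j with mergeRows-surjective a₀ i j
  ... | k , hit = suc (k ℕ.+ k) , λ { (suc n) F (s≤s i<n) →
    ≡.trans (interleave-right (F 0) (mergeRows a₀ n (F ∘ suc)) k) (hit n (F ∘ suc) i<n) }

  enumerate-surjective : {A : Set} (a₀ : A) (F : ℕ → ℕ → A) → ∀ i j → ∃[ k ] enumerate a₀ F k ≡ F i j
  enumerate-surjective a₀ F i j with mergeRows-surjective a₀ i j
  ... | k , hit = k , ≡.trans (≡.sym (mergeRows≡enumerate a₀ F k i)) (hit (suc k ℕ.+ i) F (s≤s (ℕ.m≤n+m i k)))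

  mergeRows-∑ : {A : Set} (a₀ : A) (w : A → ℝ) → w a₀ ≈ 0# → ∀ n (F : ℕ → ℕ → A) (c : ℕ → ℝ) →
    (∀ i k → ∑< k (w ∘ F i) ≤ c i) → ∀ p → ∑< p (w ∘ mergeRows a₀ n F) ≤ ∑< n c
  mergeRows-∑ a₀ w w₀ zero    F c rows zero    = ≤-refl
  mergeRows-∑ a₀ w w₀ zero    F c rows (suc p) =
    ≤-trans (+-mono-≤ (≤-reflexive w₀) (mergeRows-∑ a₀ w w₀ 0 F c rows p)) (≤-reflexive (+-identityˡ 0#))
  mergeRows-∑ a₀ w w₀ (suc n) F c rows p = split (interleave-∑ w p (F 0) (mergeRows a₀ n (F ∘ suc)))
    where
    split : ∃[ i ] ∃[ j ] ∑< p (w ∘ interleave (F 0) (mergeRows a₀ n (F ∘ suc))) ≈ ∑< i (w ∘ F 0) + ∑< j (w ∘ mergeRows a₀ n (F ∘ suc)) →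
      ∑< p (w ∘ mergeRows a₀ (suc n) F) ≤ c 0 + ∑< n (c ∘ suc)
    split (i , j , eq) = ≤-trans (≤-reflexive eq) (+-mono-≤ (rows 0 i) (mergeRows-∑ a₀ w w₀ n (F ∘ suc) (c ∘ suc) (rows ∘ suc) j))

  ∑-cong-≡ : ∀ n {f g : ℕ → ℝ} → (∀ i → i ℕ.< n → f i ≡ g i) → ∑< n f ≈ ∑< n g
  ∑-cong-≡ zero    f≡g = refl
  ∑-cong-≡ (suc n) f≡g = +-cong (reflexive (f≡g 0 (s≤s z≤n))) (∑-cong-≡ n (λ i i<n → f≡g (suc i) (s≤s i<n)))

  -- All rows are listed in one sequence. Its first n intervals already occur in the merge of n
  -- rows, so their total length is bounded by the first n of the `c i`, and no infinite sum is
  -- formed.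
  cover-⋃ : {S : ℕ → ℝ → Set} {c : ℕ → ℝ} → (∀ i → Cover (S i) (c i)) → (∀ n → ∑< n c ≤ e) → Cover (λ x → ∃[ i ] S i x) e
  cover-⋃ {e} {S} {c} cov sum≤e = (λ k → proj₁ (I k)) , (λ k → proj₂ (I k)) , valid , covers , total
    where
    F : ℕ → ℕ → Interval
    F i j = proj₁ (cov i) j , proj₁ (proj₂ (cov i)) j

    empty : Interval
    empty = 0# , 0#

    I : ℕ → Interval
    I = enumerate empty F

    Proper : Interval → Set
    Proper J = proj₁ J ≤ proj₂ J

    interleave-proper : ∀ (f g : ℕ → Interval) → (∀ k → Proper (f k)) → (∀ k → Proper (g k)) → ∀ k → Proper (interleave f g k)
    interleave-proper f g pf pg zero    = pf 0
    interleave-proper f g pf pg (suc k) = interleave-proper g (f ∘ suc) pg (pf ∘ suc) k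

    merge-proper : ∀ n (F : ℕ → ℕ → Interval) → (∀ i j → Proper (F i j)) → ∀ k → Proper (mergeRows empty n F k)
    merge-proper zero    F pF k = ≤-refl
    merge-proper (suc n) F pF k = interleave-proper (F 0) (mergeRows empty n (F ∘ suc)) (pF 0) (merge-proper n (F ∘ suc) (pF ∘ suc)) k

    valid : ∀ k → proj₁ (I k) ≤ proj₂ (I k)
    valid k = merge-proper (suc k) F (λ i → proj₁ (proj₂ (proj₂ (cov i)))) k

    covers : ∀ x → ∃[ i ] S i x → ∃[ k ] proj₁ (I k) < x × x < proj₂ (I k)
    covers x (i , Six) = locate (proj₁ (proj₂ (proj₂ (proj₂ (cov i)))) x Six)
      where
      locate : ∃[ j ] proj₁ (F i j) < x × x < proj₂ (F i j) → ∃[ k ] proj₁ (I k) < x × x < proj₂ (I k)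
      locate (j , inside) = proj₁ (enumerate-surjective empty F i j) ,
        ≡.subst (λ J → proj₁ J < x × x < proj₂ J) (≡.sym (proj₂ (enumerate-surjective empty F i j))) inside

    total : ∀ n → ∑< n (length ∘ I) ≤ e
    total n = ≤-trans (≤-reflexive (∑-cong-≡ n λ k k<n → ≡.cong length (agree k k<n)))
      (≤-trans (mergeRows-∑ empty length (-‿inverseʳ 0#) n F c (λ i → proj₂ (proj₂ (proj₂ (proj₂ (cov i))))) n) (sum≤e n))
      where
      agree : ∀ k → k ℕ.< n → I k ≡ mergeRows empty n F k
      agree k k<n = ≡.trans (≡.sym (mergeRows≡enumerate empty F k (n ℕ.∸ suc k))) (≡.cong (λ n → mergeRows empty n F k) (ℕ.m+[n∸m]≡n k<n))

  cover-nonneg : Cover S c → 0# ≤ c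
  cover-nonneg (_ , _ , _ , _ , total) = total 0

  cover-∪ : Cover S a → Cover S′ b → Cover (λ x → S x ⊎ S′ x) (a + b)
  cover-∪ {S} {a} {S′} {b} cov cov′ = cover-⊆ toUnion (cover-⋃ {S = U} {c = bound} covU sums)
    where
    U : ℕ → ℝ → Set
    U 0 = S
    U 1 = S′
    U (suc (suc _)) = λ _ → ⊥

    bound : ℕ → ℝ
    bound 0 = a
    bound 1 = b
    -- Written as a difference to match the summand of `∑-zero`.
    bound (suc (suc _)) = 0# - 0#

    covU : ∀ i → Cover (U i) (bound i)
    covU 0 = cov
    covU 1 = cov′
    covU (suc (suc _)) = cover-≤ (≤-reflexive (sym (-‿inverseʳ 0#))) (cover-∅ (λ _ ()))

    sums : ∀ n → ∑< n bound ≤ a + b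
    sums 0 = +-nonneg (cover-nonneg cov) (cover-nonneg cov′)
    sums 1 = +-monoʳ-≤ a (cover-nonneg cov′)
    sums (suc (suc n)) = +-monoʳ-≤ a (≤-reflexive (trans (+-congˡ (∑-zero n)) (+-identityʳ b)))

    toUnion : ∀ x → S x ⊎ S′ x → ∃[ i ] U i x
    toUnion x (inj₁ Sx)  = 0 , Sx
    toUnion x (inj₂ S′x) = 1 , S′x

  cover-⋃< : {S : ℕ → ℝ → Set} {c : ℕ → ℝ} → ∀ n → (∀ i → Cover (S i) (c i)) → Cover (λ x → ∃[ i ] i ℕ.< n × S i x) (∑< n c)
  cover-⋃< zero cov = cover-∅ (λ { _ (_ , () , _) })
  cover-⋃< {S} (suc n) cov = cover-⊆ (λ { x (0 , _ , S0x) → inj₁ S0x ; x (suc i , s≤s i<n , Sx) → inj₂ (i , i<n , Sx) })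
    (cover-∪ (cov 0) (cover-⋃< {S = S ∘ suc} n (cov ∘ suc)))

  -- Pulling intervals back along y ↦ a y - 1 divides their lengths by a. `E` is not assumed to
  -- respect `≈`, so the image is given as a member z of `E` with the required value up to `≈`.
  cover-preimage⁺ : 0# < a → (∀ y → S y → ∃[ z ] E z × z ≈ a * y - 1#) → Cover E c → Cover S (a ⁻¹ * c)
  cover-preimage⁺ {a} {S} {E} {c} 0<a image (lo , hi , lo≤hi , covers , total) =
    (λ i → a ⁻¹ * (lo i + 1#)) , (λ i → a ⁻¹ * (hi i + 1#)) ,
    (λ i → *-monoˡ-≤ (<⇒≤ 0<a⁻¹) (≤-from (x≤y⇒0≤y-x (lo≤hi i)) (solve 2 (λ l h → h :- l := (h :+ con (+ 1)) :- (l :+ con (+ 1))) refl (lo i) (hi i)))) ,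
    (λ y Sy → pull y (image y Sy)) ,
    (λ n → ≤-trans (≤-reflexive (trans (∑-cong n (λ i → solve 3 (λ a l h → a :* (h :+ con (+ 1)) :- a :* (l :+ con (+ 1)) := a :* (h :- l)) refl (a ⁻¹) (lo i) (hi i)))
      (sym (*-distribˡ-∑ n (a ⁻¹) (λ i → hi i - lo i))))) (*-monoˡ-≤ (<⇒≤ 0<a⁻¹) (total n)))
    where
    0<a⁻¹ : 0# < a ⁻¹
    0<a⁻¹ = ⁻¹-pos 0<a

    solve-y : ∀ y z → z ≈ a * y - 1# → a ⁻¹ * (z + 1#) ≈ y
    solve-y y z eq = trans (*-congˡ (+-congʳ eq)) (trans (solve 3 (λ i a y → i :* ((a :* y :- con (+ 1)) :+ con (+ 1)) := (i :* a) :* y) refl (a ⁻¹) a y)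
      (trans (*-congʳ (inverseˡ 0<a)) (*-identityˡ y)))

    shift : ∀ {u v} → u < v → a ⁻¹ * (u + 1#) < a ⁻¹ * (v + 1#)
    shift {u} {v} u<v = *-monoˡ-< 0<a⁻¹ (<-from (x<y⇒0<y-x u<v) (solve 2 (λ u v → v :- u := (v :+ con (+ 1)) :- (u :+ con (+ 1))) refl u v))

    inside : ∀ y z → z ≈ a * y - 1# → ∃[ i ] lo i < z × z < hi i → ∃[ i ] a ⁻¹ * (lo i + 1#) < y × y < a ⁻¹ * (hi i + 1#)
    inside y z eq (i , lo<z , z<hi) = i , <-respʳ-≈ (solve-y y z eq) (shift lo<z) , <-respˡ-≈ (solve-y y z eq) (shift z<hi)

    pull : ∀ y → ∃[ z ] E z × z ≈ a * y - 1# → ∃[ i ] a ⁻¹ * (lo i + 1#) < y × y < a ⁻¹ * (hi i + 1#)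
    pull y (z , Ez , eq) = inside y z eq (covers z Ez)

  -- The decreasing counterpart, which exchanges the two ends of each interval.
  cover-preimage⁻ : 0# < a → (∀ y → S y → ∃[ z ] E z × z ≈ 1# - a * y) → Cover E c → Cover S (a ⁻¹ * c)
  cover-preimage⁻ {a} {S} {E} {c} 0<a image (lo , hi , lo≤hi , covers , total) =
    (λ i → a ⁻¹ * (1# - hi i)) , (λ i → a ⁻¹ * (1# - lo i)) ,
    (λ i → *-monoˡ-≤ (<⇒≤ 0<a⁻¹) (≤-from (x≤y⇒0≤y-x (lo≤hi i)) (solve 2 (λ l h → h :- l := (con (+ 1) :- l) :- (con (+ 1) :- h)) refl (lo i) (hi i)))) ,
    (λ y Sy → pull y (image y Sy)) ,
    (λ n → ≤-trans (≤-reflexive (trans (∑-cong n (λ i → solve 3 (λ a l h → a :* (con (+ 1) :- l) :- a :* (con (+ 1) :- h) := a :* (h :- l)) refl (a ⁻¹) (lo i) (hi i)))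
      (sym (*-distribˡ-∑ n (a ⁻¹) (λ i → hi i - lo i))))) (*-monoˡ-≤ (<⇒≤ 0<a⁻¹) (total n)))
    where
    0<a⁻¹ : 0# < a ⁻¹
    0<a⁻¹ = ⁻¹-pos 0<a

    solve-y : ∀ y z → z ≈ 1# - a * y → a ⁻¹ * (1# - z) ≈ y
    solve-y y z eq = trans (*-congˡ (+-congˡ (-‿cong eq))) (trans (solve 3 (λ i a y → i :* (con (+ 1) :- (con (+ 1) :- a :* y)) := (i :* a) :* y) refl (a ⁻¹) a y)
      (trans (*-congʳ (inverseˡ 0<a)) (*-identityˡ y)))

    flip : ∀ {u v} → u < v → a ⁻¹ * (1# - v) < a ⁻¹ * (1# - u)
    flip {u} {v} u<v = *-monoˡ-< 0<a⁻¹ (<-from (x<y⇒0<y-x u<v) (solve 2 (λ u v → v :- u := (con (+ 1) :- u) :- (con (+ 1) :- v)) refl u v))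

    inside : ∀ y z → z ≈ 1# - a * y → ∃[ i ] lo i < z × z < hi i → ∃[ i ] a ⁻¹ * (1# - hi i) < y × y < a ⁻¹ * (1# - lo i)
    inside y z eq (i , lo<z , z<hi) = i , <-respʳ-≈ (solve-y y z eq) (flip z<hi) , <-respˡ-≈ (solve-y y z eq) (flip lo<z)

    pull : ∀ y → ∃[ z ] E z × z ≈ 1# - a * y → ∃[ i ] a ⁻¹ * (1# - hi i) < y × y < a ⁻¹ * (1# - lo i)
    pull y (z , Ez , eq) = inside y z eq (covers z Ez)

  null-⊆ : (∀ x → S x → S′ x) → Null S′ → Null S
  null-⊆ S⊆S′ null ε 0<ε = cover-⊆ S⊆S′ (null ε 0<ε)

  recip-2^-pos : ∀ n → 0# < recip (2 ℕ.^ n)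
  recip-2^-pos n = recip-pos (1≤2^n n)

  recip-2^-suc : ∀ n → recip (2 ℕ.^ suc n) + recip (2 ℕ.^ suc n) ≈ recip (2 ℕ.^ n)
  recip-2^-suc n = begin
    r + r                              ≈⟨ solve 1 (λ r → r :+ r := (con (+ 1) :+ (con (+ 1) :+ con (+ 0))) :* r) refl r ⟩
    fromℕ 2 * r                        ≈⟨ *-congˡ (recip-* {2} {2 ℕ.^ n} (s≤s z≤n) (1≤2^n n)) ⟩
    fromℕ 2 * (recip 2 * recip (2 ℕ.^ n))  ≈⟨ *-assoc _ _ _ ⟨
    fromℕ 2 * recip 2 * recip (2 ℕ.^ n)    ≈⟨ *-congʳ (recip-inverseʳ {2} (s≤s z≤n)) ⟩
    1# * recip (2 ℕ.^ n)               ≈⟨ *-identityˡ _ ⟩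
    recip (2 ℕ.^ n)                    ∎
    where
    open import Relation.Binary.Reasoning.Setoid setoid
    r : ℝ
    r = recip (2 ℕ.^ suc n)

  geometric-∑ : ∀ n k → ∑< n (λ i → recip (2 ℕ.^ suc (k ℕ.+ i))) ≤ recip (2 ℕ.^ k)
  geometric-∑ n k = ≤-trans (≤-from (<⇒≤ (recip-2^-pos (k ℕ.+ n))) (solve 2 (λ s r → r := (s :+ r) :- s) refl _ _)) (≤-reflexive (exact n))
    where
    open import Relation.Binary.Reasoning.Setoid setoid
    -- The missing tail of the geometric series is carried along, which makes the induction an
    -- equation.
    exact : ∀ n → ∑< n (λ i → recip (2 ℕ.^ suc (k ℕ.+ i))) + recip (2 ℕ.^ (k ℕ.+ n)) ≈ recip (2 ℕ.^ k)
    exact zero    = trans (+-identityˡ _) (reflexive (≡.cong (λ j → recip (2 ℕ.^ j)) (ℕ.+-identityʳ k)))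
    exact (suc n) = begin
      ∑< (suc n) f + recip (2 ℕ.^ (k ℕ.+ suc n))   ≈⟨ +-cong (∑-last n f) (reflexive (≡.cong (λ j → recip (2 ℕ.^ j)) (ℕ.+-suc k n))) ⟩
      (∑< n f + f n) + f n                         ≈⟨ +-assoc _ _ _ ⟩
      ∑< n f + (f n + f n)                         ≈⟨ +-congˡ (recip-2^-suc (k ℕ.+ n)) ⟩
      ∑< n f + recip (2 ℕ.^ (k ℕ.+ n))             ≈⟨ exact n ⟩
      recip (2 ℕ.^ k)                              ∎
      where
      f : ℕ → ℝ
      f i = recip (2 ℕ.^ suc (k ℕ.+ i))

  n<2^n : ∀ n → n ℕ.< 2 ℕ.^ n
  n<2^n zero    = s≤s z≤n
  n<2^n (suc n) = ℕ.≤-trans (ℕ.+-mono-≤ (1≤2^n n) (n<2^n n)) (ℕ.≤-reflexive (≡.cong (2 ℕ.^ n ℕ.+_) (≡.sym (ℕ.+-identityʳ (2 ℕ.^ n)))))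

  recip-2^-below : 0# < e → ∃[ n ] recip (2 ℕ.^ n) < e
  recip-2^-below 0<e with recip-below 0<e
  ... | n , 1≤n , 1/n<e = n , ≤-<-trans (recip-anti-≤ 1≤n (ℕ.<⇒≤ (n<2^n n))) 1/n<e

  null-⋃ : {S : ℕ → ℝ → Set} → (∀ i → Null (S i)) → Null (λ x → ∃[ i ] S i x)
  null-⋃ null ε 0<ε = cover-≤ (≤-reflexive (trans (*-congˡ recip-1) (*-identityʳ ε)))
    (cover-⋃ (λ i → null i (ε * recip (2 ℕ.^ suc i)) (*-pos 0<ε (recip-2^-pos (suc i))))
      (λ n → ≤-trans (≤-reflexive (sym (*-distribˡ-∑ n ε (λ i → recip (2 ℕ.^ suc i))))) (*-monoˡ-≤ (<⇒≤ 0<ε) (geometric-∑ n 0))))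

  null-∪ : Null S → Null S′ → Null (λ x → S x ⊎ S′ x)
  null-∪ null null′ ε 0<ε = cover-≤ (≤-reflexive (half+half ε)) (cover-∪ (null (half ε) (half-pos 0<ε)) (null′ (half ε) (half-pos 0<ε)))

  null-from-2^ : (∀ k → Cover S (recip (2 ℕ.^ k))) → Null S
  null-from-2^ cov ε 0<ε = cover-≤ (<⇒≤ (proj₂ (recip-2^-below 0<ε))) (cov (proj₁ (recip-2^-below 0<ε)))

  -- Points lying in infinitely many `S i` lie, for every k, in the union of those with i > k, and
  -- the covers of these have total length at most 2^(-k).
  borel-cantelli : {S : ℕ → ℝ → Set} → (∀ i → Cover (S i) (recip (2 ℕ.^ i))) → Null (λ x → ∀ N → ∃[ i ] N ℕ.≤ i × S i x)
  borel-cantelli {S} cov = null-from-2^ λ k → cover-⊆ (tail k) (cover-⋃ (λ i → cov (suc (k ℕ.+ i))) (λ n → geometric-∑ n k))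
    where
    tail : ∀ k x → (∀ N → ∃[ i ] N ℕ.≤ i × S i x) → ∃[ i ] S (suc (k ℕ.+ i)) x
    tail k x often with often (suc k)
    ... | i , k<i , Six = i ℕ.∸ suc k , ≡.subst (λ j → S j x) (≡.sym (ℕ.m+[n∸m]≡n k<i)) Six

  null-point : ∀ p → Null (λ x → x ≈ p)
  null-point p ε 0<ε = cover-≤ (≤-reflexive (trans (solve 2 (λ p h → (p :+ h) :- (p :- h) := h :+ h) refl p (half ε)) (half+half ε)))
    (cover-interval (<⇒≤ (<-trans below above)) (λ x x≈p → <-respʳ-≈ (sym x≈p) below , <-respˡ-≈ (sym x≈p) above))
    where
    below : p - half ε < p
    below = <-from (half-pos 0<ε) (solve 2 (λ p h → h := p :- (p :- h)) refl p (half ε))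

    above : p < p + half ε
    above = <-from (half-pos 0<ε) (solve 2 (λ p h → h := (p :+ h) :- p) refl p (half ε))

-- Parity of digits and the affine branches of `T`.

evenOf : ℕ → ℕ
evenOf 0             = 0
evenOf 1             = 2
evenOf (suc (suc q)) = suc (suc (evenOf q))

oddOf : ℕ → ℕ
oddOf 0             = 1
oddOf 1             = 1
oddOf (suc (suc q)) = suc (suc (oddOf q))

-- The index k is kept in the exact form in which `T` and `d₁` mention it, with its truncated 2k -
-- 1, together with the resulting values of `evenOf` and `oddOf`.
data Parity (q : ℕ) : Set where
  odd  : ∀ k → 1 ℕ.≤ k → q ≡ 2 ℕ.* k ℕ.∸ 1 → suc q ≡ 2 ℕ.* k → evenOf q ≡ suc q → oddOf q ≡ q → Parity q
  even : ∀ k → 1 ℕ.≤ k → q ≡ 2 ℕ.* k → evenOf q ≡ q → oddOf q ≡ suc q → Parity q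

parity : ∀ q → 1 ℕ.≤ q → Parity q
parity 1 _ = odd 1 (s≤s z≤n) ≡.refl ≡.refl ≡.refl ≡.refl
parity 2 _ = even 1 (s≤s z≤n) ≡.refl ≡.refl ≡.refl
parity (suc (suc q@(suc _))) _ with parity q (s≤s z≤n)
... | odd k 1≤k _ 1+q≡2k e o = odd (suc k) (s≤s z≤n) (≡.cong ℕ.pred 3+q≡2k+2) 3+q≡2k+2 (≡.cong (λ n → suc (suc n)) e) (≡.cong (λ n → suc (suc n)) o)
  where
  3+q≡2k+2 : suc (suc (suc q)) ≡ 2 ℕ.* suc k
  3+q≡2k+2 = ≡.trans (≡.cong (λ n → suc (suc n)) 1+q≡2k) (≡.sym (ℕ.*-suc 2 k))
... | even k 1≤k q≡2k e o = even (suc k) (s≤s z≤n) (≡.trans (≡.cong (λ n → suc (suc n)) q≡2k) (≡.sym (ℕ.*-suc 2 k))) (≡.cong (λ n → suc (suc n)) e) (≡.cong (λ n → suc (suc n)) o)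

even≢odd : ∀ j k → 1 ℕ.≤ k → 2 ℕ.* j ≡ 2 ℕ.* k ℕ.∸ 1 → ⊥
even≢odd zero    (suc k) _ eq = ℕ.0≢1+n (≡.trans eq (ℕ.+-suc k (k ℕ.+ 0)))
even≢odd (suc j) (suc zero) _ eq = ℕ.0≢1+n (≡.sym (≡.trans (≡.sym (ℕ.+-suc j (j ℕ.+ 0))) (ℕ.suc-injective eq)))
even≢odd (suc j) (suc (suc k)) _ eq = even≢odd j (suc k) (s≤s z≤n)
  (ℕ.suc-injective (ℕ.suc-injective (≡.trans (≡.sym (ℕ.*-suc 2 j)) (≡.trans eq (≡.cong (ℕ._∸ 1) (ℕ.*-suc 2 (suc k)))))))

module Dynamics (lem : ExcludedMiddle 0ℓ) (reals : CompleteOrderedField) where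

  open Covering lem reals public

  private
    variable
      y z : ℝ
      q : ℕ

  if-yes : {P A : Set} {u v : A} → P → (if does (lem {P}) then u else v) ≡ u
  if-yes {P} p with lem {P}
  ... | yes _ = ≡.refl
  ... | no ¬p = contradiction p ¬p

  if-no : {P A : Set} {u v : A} → ¬ P → (if does (lem {P}) then u else v) ≡ v
  if-no {P} ¬p with lem {P}
  ... | yes p = contradiction p ¬p
  ... | no _  = ≡.refl

  -- An open cell, on which `d₁` is constant and `T` affine for q ≥ 1. Dropping the endpoints is
  -- harmless for generic points.
  Digit : ℕ → ℝ → Set
  Digit q y = recip (suc q) < y × y < recip q

  -- Different cells are disjoint. The second one includes its left end, as in the conditions of
  -- `d₁`.
  digit-unique : ∀ {q q′} → 1 ℕ.≤ q → 1 ℕ.≤ q′ → Digit q y → recip (suc q′) ≤ y → y < recip q′ → q ≡ q′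
  digit-unique {y} {q} {q′} 1≤q 1≤q′ (lo , hi) lo′ hi′ with ℕ.<-cmp q q′
  ... | tri≈ _ q≡q′ _ = q≡q′
  ... | tri< q<q′ _ _ = contradiction (<-≤-trans hi′ (recip-anti-≤ (s≤s z≤n) q<q′)) (<⇒≤ lo)
  ... | tri> _ _ q′<q = contradiction (<-≤-trans hi (recip-anti-≤ (s≤s z≤n) q′<q)) lo′

  <recip⇒*<1 : 1 ℕ.≤ q → y < recip q → fromℕ q * y < 1#
  <recip⇒*<1 1≤q y<1/q = <-respʳ-≈ (recip-inverseʳ 1≤q) (*-monoˡ-< (fromℕ-pos′ 1≤q) y<1/q)

  recip<⇒1<* : 1 ℕ.≤ q → recip q < y → 1# < fromℕ q * y
  recip<⇒1<* 1≤q 1/q<y = <-respˡ-≈ (recip-inverseʳ 1≤q) (*-monoˡ-< (fromℕ-pos′ 1≤q) 1/q<y)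

  *<1⇒<recip : 1 ℕ.≤ q → fromℕ q * y < 1# → y < recip q
  *<1⇒<recip 1≤q qy<1 = *-cancelˡ-< (fromℕ-pos′ 1≤q) (<-respʳ-≈ (sym (recip-inverseʳ 1≤q)) qy<1)

  digit-pos : Digit q y → 0# < y
  digit-pos {q} (lo , _) = <-trans (recip-pos {suc q} (s≤s z≤n)) lo

  q<1/y : 1 ℕ.≤ q → Digit q y → fromℕ q < 1# / y
  q<1/y {q} 1≤q D = <-/ (digit-pos {q} D) (<-respˡ-≈ (*-comm _ _) (<recip⇒*<1 1≤q (proj₂ D)))

  1/y<1+q : 1 ℕ.≤ q → Digit q y → 1# / y < fromℕ (suc q)
  1/y<1+q {q} 1≤q D = /-< (digit-pos {q} D) (<-respʳ-≈ (*-comm _ _) (recip<⇒1<* {suc q} (s≤s z≤n) (proj₁ D)))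

  ceiling : fromℕ q < z → z < fromℕ (suc q) → ⌈ z ⌉ ≡ + suc q
  ceiling {q} {z} q<z z<1+q = unique ⌈ z ⌉ (choose-spec {P = λ i → fromℤ i - 1# < z × z ≤ fromℤ i} (+ suc q , <-respˡ-≈ (solve 1 (λ q → q := (con (+ 1) :+ q) :- con (+ 1)) refl (fromℕ q)) q<z , <⇒≤ z<1+q))
    where
    unique : ∀ i → fromℤ i - 1# < z × z ≤ fromℤ i → i ≡ + suc q
    unique (+ n) (n-1<z , z≤⌈z⌉) = ≡.cong +_ (ℕ.≤-antisym (ℕ.s≤s⁻¹ n<2+q) q<n)
      where
      q<n : q ℕ.< n
      q<n = fromℕ-cancel-< (<-≤-trans q<z z≤⌈z⌉)
      n<2+q : n ℕ.< suc (suc q)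
      n<2+q = fromℕ-cancel-< (<-from (x<y⇒0<y-x (<-trans n-1<z z<1+q)) (solve 2 (λ n q → q :- (n :- con (+ 1)) := (con (+ 1) :+ q) :- n) refl (fromℕ n) (fromℕ (suc q))))
    unique -[1+ n ] (_ , z≤-n) = contradiction (≤-<-trans (fromℕ-nonneg q) q<z)
      (≤-trans z≤-n (≤-from (fromℕ-nonneg (suc n)) (solve 1 (λ n → n := con (+ 0) :- (:- n)) refl (fromℕ (suc n)))))

  floor : fromℕ q < z → z < fromℕ (suc q) → ⌊ z ⌋ ≡ + q
  floor {q} {z} q<z z<1+q = unique ⌊ z ⌋ (choose-spec {P = λ i → fromℤ i ≤ z × z < fromℤ i + 1#} (+ q , <⇒≤ q<z , <-respʳ-≈ (+-comm _ _) z<1+q))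
    where
    unique : ∀ i → fromℤ i ≤ z × z < fromℤ i + 1# → i ≡ + q
    unique (+ n) (n≤z , z<n+1) = ≡.cong +_ (ℕ.≤-antisym (ℕ.s≤s⁻¹ (fromℕ-cancel-< (≤-<-trans n≤z z<1+q)))
      (ℕ.s≤s⁻¹ (fromℕ-cancel-< (<-trans q<z (<-respʳ-≈ (+-comm _ _) z<n+1)))))
    unique -[1+ n ] (_ , z<-n+1) = contradiction (≤-<-trans (fromℕ-nonneg q) (<-trans q<z z<-n+1))
      (≤-from (fromℕ-nonneg n) (solve 1 (λ n → n := con (+ 0) :- (:- (con (+ 1) :+ n) :+ con (+ 1))) refl (fromℕ n)))

  private
    left-endpoint : ∀ k → recip (2 ℕ.* k ℕ.+ 1) ≡ recip (suc (2 ℕ.* k))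
    left-endpoint k = ≡.cong recip (ℕ.+-comm (2 ℕ.* k) 1)

    2k≡1+pred : ∀ k → 1 ℕ.≤ k → 2 ℕ.* k ≡ suc (2 ℕ.* k ℕ.∸ 1)
    2k≡1+pred (suc k) _ = ≡.refl

    1≤2k-1 : ∀ k → 1 ℕ.≤ k → 1 ℕ.≤ 2 ℕ.* k ℕ.∸ 1
    1≤2k-1 (suc k) _ = ℕ.≤-trans (s≤s z≤n) (ℕ.≤-reflexive (≡.sym (ℕ.+-suc k (k ℕ.+ 0))))

    -- Both `d₁` and `T` test the intervals with odd q first, so for even q that test has to be
    -- refuted; the half-open form serves both definitions.
    not-odd : ∀ k → 1 ℕ.≤ k → q ≡ 2 ℕ.* k → Digit q y → ¬ (∃[ j ] 1 ℕ.≤ j × recip (2 ℕ.* j) ≤ y × y < recip (2 ℕ.* j ℕ.∸ 1))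
    not-odd {y = y} k 1≤k ≡.refl D (j , 1≤j , lo , hi) = even≢odd k j 1≤j
      (digit-unique (ℕ.*-mono-≤ (s≤s (z≤n {1})) 1≤k) (1≤2k-1 j 1≤j) D (≡.subst (λ n → recip n ≤ y) (2k≡1+pred j 1≤j) lo) hi)

  d₁-digit : 1 ℕ.≤ q → Digit q y → d₁ y ≡ + evenOf q
  d₁-digit {q} {y} 1≤q D with parity q 1≤q
  ... | odd k 1≤k q≡ 1+q≡ e o = ≡.trans (if-yes (k , 1≤k , <⇒≤ (≡.subst (λ n → recip n < y) 1+q≡ (proj₁ D)) , ≡.subst (λ n → y < recip n) q≡ (proj₂ D)))
    (≡.trans (ceiling (q<1/y 1≤q D) (1/y<1+q 1≤q D)) (≡.cong +_ (≡.sym e)))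
  ... | even k 1≤k q≡ e o = ≡.trans (if-no (not-odd k 1≤k q≡ D))
    (≡.trans (if-yes (k , 1≤k , <⇒≤ (≡.subst (_< y) (≡.trans (≡.cong (recip ∘ suc) q≡) (≡.sym (left-endpoint k))) (proj₁ D)) , ≡.subst (λ n → y < recip n) q≡ (proj₂ D)))
      (≡.trans (floor (q<1/y 1≤q D) (1/y<1+q 1≤q D)) (≡.cong +_ (≡.sym e))))

  data Branch (q : ℕ) (y : ℝ) : Set where
    right : evenOf q ≡ suc q → oddOf q ≡ q → T y ≡ fromℕ (evenOf q) * y - 1# → Branch q y
    left  : evenOf q ≡ q → oddOf q ≡ suc q → T y ≡ 1# - fromℕ (evenOf q) * y → Branch q y

  branch : 1 ℕ.≤ q → Digit q y → Branch q y
  branch {q} {y} 1≤q D with parity q 1≤q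
  ... | odd k 1≤k q≡ 1+q≡ e o = right e o (≡.trans (if-yes (k , 1≤k , ≡.subst (λ n → recip n < y) 1+q≡ (proj₁ D) , ≡.subst (λ n → y < recip n) q≡ (proj₂ D)))
    (≡.cong (λ i → fromℤ i * y - 1#) (≡.trans (ceiling (q<1/y 1≤q D) (1/y<1+q 1≤q D)) (≡.cong +_ (≡.sym e)))))
  ... | even k 1≤k q≡ e o = left e o (≡.trans (if-no (λ { (j , 1≤j , lo , hi) → not-odd k 1≤k q≡ D (j , 1≤j , <⇒≤ lo , hi) }))
    (≡.trans (if-yes (k , 1≤k , ≡.subst (_< y) (≡.trans (≡.cong (recip ∘ suc) q≡) (≡.sym (left-endpoint k))) (proj₁ D) , ≡.subst (λ n → y < recip n) q≡ (proj₂ D)))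
      (≡.cong (λ i → 1# - fromℤ i * y) (≡.trans (floor (q<1/y 1≤q D) (1/y<1+q 1≤q D)) (≡.cong +_ (≡.sym e))))))

  1≤evenOf : 1 ℕ.≤ q → 1 ℕ.≤ evenOf q
  1≤evenOf {suc zero}          _ = s≤s z≤n
  1≤evenOf {suc (suc q)} _ = s≤s z≤n

  1≤oddOf : ∀ q → 1 ℕ.≤ oddOf q
  1≤oddOf 0             = s≤s z≤n
  1≤oddOf 1             = s≤s z≤n
  1≤oddOf (suc (suc q)) = s≤s z≤n

  T-pos : 1 ℕ.≤ q → Digit q y → 0# < T y
  T-pos {q} {y} 1≤q D with branch 1≤q D
  ... | right e o Ty = <-respʳ-≈ (reflexive (≡.sym Ty)) (x<y⇒0<y-x (≡.subst (λ n → 1# < fromℕ n * y) (≡.sym e) (recip<⇒1<* {suc q} (s≤s z≤n) (proj₁ D))))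
  ... | left e o Ty = <-respʳ-≈ (reflexive (≡.sym Ty)) (x<y⇒0<y-x (≡.subst (λ n → fromℕ n * y < 1#) (≡.sym e) (<recip⇒*<1 1≤q (proj₂ D))))

  -- For odd q, 1 - o T y = (q + 1)(1 - q y); for even q, 1 - o T y = q ((q + 1) y - 1). Both are
  -- positive inside the cell.
  T<recip : 1 ℕ.≤ q → Digit q y → T y < recip (oddOf q)
  T<recip {q} {y} 1≤q D with branch 1≤q D
  ... | right e o Ty rewrite Ty | e | o = *<1⇒<recip 1≤q (<-from (*-pos (fromℕ-pos q) (x<y⇒0<y-x (<recip⇒*<1 1≤q (proj₂ D))))
    (solve 2 (λ q y → (con (+ 1) :+ q) :* (con (+ 1) :- q :* y) := con (+ 1) :- q :* ((con (+ 1) :+ q) :* y :- con (+ 1))) refl (fromℕ q) y))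
  ... | left e o Ty rewrite Ty | e | o = *<1⇒<recip {suc q} (s≤s z≤n) (<-from (*-pos (fromℕ-pos′ 1≤q) (x<y⇒0<y-x (recip<⇒1<* {suc q} (s≤s z≤n) (proj₁ D))))
    (solve 2 (λ q y → q :* ((con (+ 1) :+ q) :* y :- con (+ 1)) := con (+ 1) :- (con (+ 1) :+ q) :* (con (+ 1) :- q :* y)) refl (fromℕ q) y))

  -- Irrationality of a positive number, in a form that is visibly inherited
  -- by T y = ±(n y - 1).
  Generic : ℝ → Set
  Generic y = ∀ a b c → ¬ (y * fromℕ (suc b) + fromℕ a ≈ fromℕ c)

  -- Substituting T y = ±(e y - 1) in T y (b + 1) + a = c gives a relation for y with coefficient e
  -- (b + 1). Terms change sides to keep all coefficients natural, and for the minus sign a and c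
  -- swap roles.
  T-generic : 1 ℕ.≤ q → Digit q y → Generic y → Generic (T y)
  T-generic {q} {y} 1≤q D generic a b c eq with evenOf q in e | 1≤evenOf 1≤q | branch 1≤q D
  -- `suc (b + n * suc b)` computes to `suc n * suc b`, the coefficient that arises.
  ... | suc n | _ | right _ _ Ty rewrite e = generic a (b ℕ.+ n ℕ.* suc b) (c ℕ.+ suc b) (begin
    y * fromℕ (suc n ℕ.* suc b) + fromℕ a          ≈⟨ +-congʳ (*-congˡ (fromℕ-* (suc n) (suc b))) ⟩
    y * (N * B) + fromℕ a                          ≈⟨ solve 4 (λ y n b a → y :* (n :* b) :+ a := ((n :* y :- con (+ 1)) :* b :+ a) :+ b) refl y N B (fromℕ a) ⟩
    ((N * y - 1#) * B + fromℕ a) + B               ≈⟨ +-congʳ (trans (+-congʳ (*-congʳ (reflexive (≡.sym Ty)))) eq) ⟩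
    fromℕ c + B                                    ≈⟨ fromℕ-+ c (suc b) ⟨
    fromℕ (c ℕ.+ suc b)                            ∎)
    where
    open import Relation.Binary.Reasoning.Setoid setoid
    N B : ℝ
    N = fromℕ (suc n)
    B = fromℕ (suc b)
  ... | suc n | _ | left _ _ Ty rewrite e = generic c (b ℕ.+ n ℕ.* suc b) (a ℕ.+ suc b) (begin
    y * fromℕ (suc n ℕ.* suc b) + fromℕ c          ≈⟨ +-cong (*-congˡ (fromℕ-* (suc n) (suc b))) (sym eq) ⟩
    y * (N * B) + (T y * B + fromℕ a)              ≈⟨ +-congˡ (+-congʳ (*-congʳ (reflexive Ty))) ⟩
    y * (N * B) + ((1# - N * y) * B + fromℕ a)     ≈⟨ solve 4 (λ y n b a → y :* (n :* b) :+ ((con (+ 1) :- n :* y) :* b :+ a) := a :+ b) refl y N B (fromℕ a) ⟩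
    fromℕ a + B                                    ≈⟨ fromℕ-+ a (suc b) ⟨
    fromℕ (a ℕ.+ suc b)                            ∎)
    where
    open import Relation.Binary.Reasoning.Setoid setoid
    N B : ℝ
    N = fromℕ (suc n)
    B = fromℕ (suc b)

-- Digit events, their covers, and orbits of generic points.

data Condition : Set where
  atLeast below : (t : ℕ) → 1 ℕ.≤ t → Condition

-- With an integer t, both constraints see only the integer part of q / m.
Holds : Condition → ℕ → ℕ → Set
Holds (atLeast t _) m q = t ℕ.* m ℕ.≤ q
Holds (below t _)   m q = q ℕ.< t ℕ.* m

-- The first N steps are left free. Freedom is encoded as `atLeast 1`, which every digit satisfies
-- because m ≤ q, and which has chance 1.
eventually : Condition → ℕ → ℕ → Condition
eventually c zero    _       = c
eventually c (suc N) zero    = atLeast 1 (s≤s z≤n)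
eventually c (suc N) (suc i) = eventually c N i

module Events (lem : ExcludedMiddle 0ℓ) (reals : CompleteOrderedField) where

  open Dynamics lem reals public

  private
    variable
      k m n q : ℕ

  -- Here y plays the role of a uniform point of (0, 1/m). After one step the scale is `oddOf q`,
  -- since `T` maps the cell onto (0, 1/oddOf q).
  Event : ℕ → (ℕ → Condition) → ℕ → ℝ → Set
  Event zero    c m y = 0# < y × y < recip m
  Event (suc n) c m y = ∃[ q ] m ℕ.≤ q × Holds (c 0) m q × Digit q y × Event n (c ∘ suc) (oddOf q) (T y)

  chance : Condition → ℝ
  chance (atLeast t _) = recip t
  chance (below t _)   = 1# - recip t

  probability : ℕ → (ℕ → Condition) → ℝ
  probability zero    c = 1#
  probability (suc n) c = chance (c 0) * probability n (c ∘ suc)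

  recip≤1 : 1 ℕ.≤ n → recip n ≤ 1#
  recip≤1 1≤n = ≤-trans (recip-anti-≤ (s≤s z≤n) 1≤n) (≤-reflexive recip-1)

  chance-nonneg : ∀ c → 0# ≤ chance c
  chance-nonneg (atLeast t 1≤t) = <⇒≤ (recip-pos 1≤t)
  chance-nonneg (below t 1≤t)   = x≤y⇒0≤y-x (recip≤1 1≤t)

  probability-nonneg : ∀ n c → 0# ≤ probability n c
  probability-nonneg zero    c = 0≤1
  probability-nonneg (suc n) c = *-nonneg (chance-nonneg (c 0)) (probability-nonneg n (c ∘ suc))

  recip-difference : 1 ℕ.≤ q → recip q - recip (suc q) ≈ recip q * recip (suc q)
  recip-difference {q} 1≤q = begin
    r - r′                      ≈⟨ +-cong (sym (*-identityʳ r)) (-‿cong (sym (*-identityʳ r′))) ⟩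
    r * 1# - r′ * 1#            ≈⟨ +-cong (*-congˡ (sym (recip-inverseʳ {suc q} (s≤s z≤n)))) (-‿cong (*-congˡ (sym (recip-inverseʳ 1≤q)))) ⟩
    r * (fromℕ (suc q) * r′) - r′ * (fromℕ q * r)
      ≈⟨ solve 3 (λ r r′ q → r :* ((con (+ 1) :+ q) :* r′) :- r′ :* (q :* r) := r :* r′) refl r r′ (fromℕ q) ⟩
    r * r′                      ∎
    where
    open import Relation.Binary.Reasoning.Setoid setoid
    r r′ : ℝ
    r  = recip q
    r′ = recip (suc q)

  telescope : ∀ p a n → ∑< n (λ i → p * (recip (a ℕ.+ i) - recip (suc (a ℕ.+ i)))) ≈ p * (recip a - recip (a ℕ.+ n))
  telescope p a zero    = sym (trans (*-congˡ (trans (+-congˡ (-‿cong (reflexive (≡.cong recip (ℕ.+-identityʳ a))))) (-‿inverseʳ (recip a)))) (zeroʳ p))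
  telescope p a (suc n) = begin
    ∑< (suc n) f                                                 ≈⟨ ∑-last n f ⟩
    ∑< n f + f n                                                 ≈⟨ +-congʳ (telescope p a n) ⟩
    p * (recip a - r) + p * (r - recip (suc (a ℕ.+ n)))          ≈⟨ solve 4 (λ p a r s → p :* (a :- r) :+ p :* (r :- s) := p :* (a :- s)) refl p (recip a) r (recip (suc (a ℕ.+ n))) ⟩
    p * (recip a - recip (suc (a ℕ.+ n)))                        ≈⟨ *-congˡ (+-congˡ (-‿cong (reflexive (≡.cong recip (≡.sym (ℕ.+-suc a n)))))) ⟩
    p * (recip a - recip (a ℕ.+ suc n))                          ∎
    where
    open import Relation.Binary.Reasoning.Setoid setoid
    f : ℕ → ℝ
    f i = p * (recip (a ℕ.+ i) - recip (suc (a ℕ.+ i)))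
    r : ℝ
    r = recip (a ℕ.+ n)

  -- The preimage under T is smaller by the factor evenOf q, and
  -- evenOf q * oddOf q = q (q + 1) turns the bound into a telescoping difference.
  cover-digit : ∀ {E : ℝ → Set} {p} → 1 ℕ.≤ q → Cover E (p * recip (oddOf q)) →
    Cover (λ y → Digit q y × E (T y)) (p * (recip q - recip (suc q)))
  cover-digit {q} {E} {p} 1≤q cov with parity q 1≤q
  ... | odd k 1≤k q≡ 1+q≡ e o = cover-≤ (≤-reflexive measure) (cover-preimage⁺ (fromℕ-pos′ (1≤evenOf 1≤q)) image cov)
    where
    measure : recip (evenOf q) * (p * recip (oddOf q)) ≈ p * (recip q - recip (suc q))
    measure rewrite e | o = trans (solve 3 (λ s p r → s :* (p :* r) := p :* (r :* s)) refl (recip (suc q)) p (recip q)) (*-congˡ (sym (recip-difference 1≤q)))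

    image : ∀ y → Digit q y × E (T y) → ∃[ z ] E z × z ≈ fromℕ (evenOf q) * y - 1#
    image y (D , ETy) with branch 1≤q D
    ... | right _ _ Ty = T y , ETy , reflexive Ty
    ... | left e′ _ _  = contradiction (≡.trans (≡.sym e) e′) (λ ())
  ... | even k 1≤k q≡ e o = cover-≤ (≤-reflexive measure) (cover-preimage⁻ (fromℕ-pos′ (1≤evenOf 1≤q)) image cov)
    where
    measure : recip (evenOf q) * (p * recip (oddOf q)) ≈ p * (recip q - recip (suc q))
    measure rewrite e | o = trans (solve 3 (λ s p r → r :* (p :* s) := p :* (r :* s)) refl (recip (suc q)) p (recip q)) (*-congˡ (sym (recip-difference 1≤q)))

    image : ∀ y → Digit q y × E (T y) → ∃[ z ] E z × z ≈ 1# - fromℕ (evenOf q) * y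
    image y (D , ETy) with branch 1≤q D
    ... | left _ _ Ty   = T y , ETy , reflexive Ty
    ... | right e′ _ _  = contradiction (≡.trans (≡.sym e′) e) (λ ())

  -- Induction over the first digit q: the cells contribute p (1/q - 1/(q + 1)), where p bounds the
  -- remaining conditions for every q alike. Telescoping over q ≥ t m gives p / (t m), and over m ≤
  -- q < t m it gives p (1 - 1/t) / m.
  cover-event : ∀ n c m → 1 ℕ.≤ m → Cover (Event n c m) (probability n c * recip m)
  cover-event zero c m 1≤m = cover-≤ (≤-reflexive (solve 1 (λ r → r :- con (+ 0) := con (+ 1) :* r) refl (recip m)))
    (cover-interval (<⇒≤ (recip-pos 1≤m)) (λ _ inside → inside))
  cover-event (suc n) c m 1≤m with c 0
  ... | atLeast t 1≤t = cover-⊆ split (cover-⋃ {S = S} (λ i → cover-digit (ℕ.≤-trans 1≤tm (ℕ.m≤m+n tm i)) (cover-event n (c ∘ suc) (oddOf (tm ℕ.+ i)) (1≤oddOf (tm ℕ.+ i)))) sums)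
    where
    tm : ℕ
    tm = t ℕ.* m

    1≤tm : 1 ℕ.≤ tm
    1≤tm = ℕ.*-mono-≤ 1≤t 1≤m

    p : ℝ
    p = probability n (c ∘ suc)

    S : ℕ → ℝ → Set
    S i y = Digit (tm ℕ.+ i) y × Event n (c ∘ suc) (oddOf (tm ℕ.+ i)) (T y)

    split : ∀ y → ∃[ q ] m ℕ.≤ q × tm ℕ.≤ q × Digit q y × Event n (c ∘ suc) (oddOf q) (T y) → ∃[ i ] S i y
    split y (q , _ , tm≤q , rest) = q ℕ.∸ tm , ≡.subst (λ q → Digit q y × Event n (c ∘ suc) (oddOf q) (T y)) (≡.sym (ℕ.m+[n∸m]≡n tm≤q)) rest

    sums : ∀ k → ∑< k (λ i → p * (recip (tm ℕ.+ i) - recip (suc (tm ℕ.+ i)))) ≤ recip t * p * recip m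
    sums k = begin
      ∑< k (λ i → p * (recip (tm ℕ.+ i) - recip (suc (tm ℕ.+ i))))   ≈⟨ telescope p tm k ⟩
      p * (recip tm - recip (tm ℕ.+ k))   ≤⟨ *-monoˡ-≤ (probability-nonneg n (c ∘ suc)) (≤-from (<⇒≤ (recip-pos (ℕ.≤-trans 1≤tm (ℕ.m≤m+n tm k)))) (solve 2 (λ a b → b := a :- (a :- b)) refl (recip tm) (recip (tm ℕ.+ k)))) ⟩
      p * recip tm                        ≈⟨ *-congˡ (recip-* 1≤t 1≤m) ⟩
      p * (recip t * recip m)             ≈⟨ solve 3 (λ p t m → p :* (t :* m) := t :* p :* m) refl p (recip t) (recip m) ⟩
      recip t * p * recip m               ∎
      where open ≤-Reasoning
  -- A finite union, so that the telescoped sum keeps its negative end term and yields the factor 1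
  -- - 1/t.
  ... | below t 1≤t = cover-⊆ split (cover-≤ (≤-reflexive sums) (cover-⋃< {S = S} (tm ℕ.∸ m) (λ i → cover-digit (ℕ.≤-trans 1≤m (ℕ.m≤m+n m i)) (cover-event n (c ∘ suc) (oddOf (m ℕ.+ i)) (1≤oddOf (m ℕ.+ i))))))
    where
    tm : ℕ
    tm = t ℕ.* m

    m≤tm : m ℕ.≤ tm
    m≤tm = ℕ.≤-trans (ℕ.≤-reflexive (≡.sym (ℕ.*-identityˡ m))) (ℕ.*-monoˡ-≤ m 1≤t)

    p : ℝ
    p = probability n (c ∘ suc)

    S : ℕ → ℝ → Set
    S i y = Digit (m ℕ.+ i) y × Event n (c ∘ suc) (oddOf (m ℕ.+ i)) (T y)

    split : ∀ y → ∃[ q ] m ℕ.≤ q × q ℕ.< tm × Digit q y × Event n (c ∘ suc) (oddOf q) (T y) → ∃[ i ] i ℕ.< tm ℕ.∸ m × S i y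
    split y (q , m≤q , q<tm , rest) = q ℕ.∸ m , ℕ.∸-monoˡ-< q<tm m≤q ,
      ≡.subst (λ q → Digit q y × Event n (c ∘ suc) (oddOf q) (T y)) (≡.sym (ℕ.m+[n∸m]≡n m≤q)) rest

    sums : ∑< (tm ℕ.∸ m) (λ i → p * (recip (m ℕ.+ i) - recip (suc (m ℕ.+ i)))) ≈ (1# - recip t) * p * recip m
    sums = begin
      ∑< (tm ℕ.∸ m) (λ i → p * (recip (m ℕ.+ i) - recip (suc (m ℕ.+ i))))   ≈⟨ telescope p m (tm ℕ.∸ m) ⟩
      p * (recip m - recip (m ℕ.+ (tm ℕ.∸ m)))   ≈⟨ *-congˡ (+-congˡ (-‿cong (trans (reflexive (≡.cong recip (ℕ.m+[n∸m]≡n m≤tm))) (recip-* 1≤t 1≤m)))) ⟩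
      p * (recip m - recip t * recip m)          ≈⟨ solve 3 (λ p t m → p :* (m :- t :* m) := (con (+ 1) :- t) :* p :* m) refl p (recip t) (recip m) ⟩
      (1# - recip t) * p * recip m               ∎
      where open import Relation.Binary.Reasoning.Setoid setoid

  -- The invariants that let the orbit go on: genericity keeps the point off all 1/n, `point<` tells
  -- where the search for its digit may start, and positivity makes that search end.
  record State : Set where
    field
      point   : ℝ
      scale   : ℕ
      1≤scale : 1 ℕ.≤ scale
      generic : Generic point
      0<point : 0# < point
      point<  : point < recip scale

  open State

  digit-exists : (s : State) → ∃[ q ] scale s ℕ.≤ q × Digit q (point s)
  digit-exists s = start (recip-below (0<point s))
    where
    y : ℝ
    y = point s

    -- Climbs through the cells, keeping y < 1/q; the last hypothesis says that y is passed before
    -- the fuel is used up.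
    search : ∀ fuel q → 1 ℕ.≤ q → y < recip q → recip (q ℕ.+ fuel) < y → ∃[ q′ ] q ℕ.≤ q′ × Digit q′ y
    search zero q 1≤q y<1/q 1/q<y = contradiction (<-trans y<1/q (≡.subst (λ n → recip n < y) (ℕ.+-identityʳ q) 1/q<y)) (<-irrefl refl)
    search (suc fuel) q 1≤q y<1/q lower with compare (recip (suc q)) y
    ... | tri< 1/1+q<y _ _ = q , ℕ.≤-refl , 1/1+q<y , y<1/q
    -- Equality would be the relation y (q + 1) + 0 = 1, which genericity forbids.
    ... | tri≈ _ 1/1+q≈y _ = contradiction (trans (+-identityʳ _) (trans (*-comm _ _) (trans (*-congˡ (sym 1/1+q≈y)) (trans (recip-inverseʳ {suc q} (s≤s z≤n)) (sym fromℕ-1))))) (generic s 0 q 1)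
    ... | tri> _ _ y<1/1+q with search fuel (suc q) (s≤s z≤n) y<1/1+q (≡.subst (λ n → recip n < y) (ℕ.+-suc q fuel) lower)
    ...   | q′ , q<q′ , D = q′ , ℕ.<⇒≤ q<q′ , D

    start : ∃[ n ] 1 ℕ.≤ n × recip n < y → ∃[ q ] scale s ℕ.≤ q × Digit q y
    start (n , 1≤n , 1/n<y) = search n (scale s) (1≤scale s) (point< s) (≤-<-trans (recip-anti-≤ 1≤n (ℕ.m≤n+m n (scale s))) 1/n<y)

  digit : State → ℕ
  digit s = proj₁ (digit-exists s)

  scale≤digit : ∀ s → scale s ℕ.≤ digit s
  scale≤digit s = proj₁ (proj₂ (digit-exists s))

  1≤digit : ∀ s → 1 ℕ.≤ digit s
  1≤digit s = ℕ.≤-trans (1≤scale s) (scale≤digit s)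

  isDigit : ∀ s → Digit (digit s) (point s)
  isDigit s = proj₂ (proj₂ (digit-exists s))

  next : State → State
  next s = record
    { point   = T (point s)
    ; scale   = oddOf (digit s)
    ; 1≤scale = 1≤oddOf (digit s)
    ; generic = T-generic (1≤digit s) (isDigit s) (generic s)
    ; 0<point = T-pos (1≤digit s) (isDigit s)
    ; point<  = T<recip (1≤digit s) (isDigit s)
    }

  orbit : State → ℕ → State
  orbit s zero    = s
  orbit s (suc k) = next (orbit s k)

  point-orbit : ∀ s k → point (orbit s k) ≡ fold (point s) T k
  point-orbit s zero    = ≡.refl
  point-orbit s (suc k) = ≡.cong T (point-orbit s k)

  Along : State → ℕ → Condition → Set
  Along s k c = Holds c (scale (orbit s k)) (digit (orbit s k))

  event-orbit : ∀ n (c : ℕ → Condition) s k → (∀ i → i ℕ.< n → Along s (k ℕ.+ i) (c i)) → Event n c (scale (orbit s k)) (point (orbit s k))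
  event-orbit zero    c s k holds = 0<point (orbit s k) , point< (orbit s k)
  event-orbit (suc n) c s k holds = digit s′ , scale≤digit s′ , ≡.subst (λ j → Along s j (c 0)) (ℕ.+-identityʳ k) (holds 0 (s≤s z≤n)) , isDigit s′ ,
    event-orbit n (c ∘ suc) s (suc k) (λ i i<n → ≡.subst (λ j → Along s j (c (suc i))) (ℕ.+-suc k i) (holds (suc i) (s≤s i<n)))
    where
    s′ : State
    s′ = orbit s k

  along-eventually : ∀ s j c N i → (N ℕ.≤ i → Along s j c) → Along s j (eventually c N i)
  along-eventually s j c zero    i       holds = holds z≤n
  along-eventually s j c (suc N) zero    holds = ℕ.≤-trans (ℕ.≤-reflexive (ℕ.*-identityˡ _)) (scale≤digit (orbit s j))
  along-eventually s j c (suc N) (suc i) holds = along-eventually s j c N i (λ N≤i → holds (s≤s N≤i))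

  probability-eventually : ∀ t (1≤t : 1 ℕ.≤ t) N n → probability (N ℕ.+ n) (eventually (atLeast t 1≤t) N) ≈ recip (t ℕ.^ n)
  probability-eventually t         1≤t zero    zero    = sym recip-1
  probability-eventually t@(suc _) 1≤t zero    (suc n) = trans (*-congˡ (probability-eventually t 1≤t 0 n)) (sym (recip-* 1≤t (ℕ.m^n>0 t n)))
  probability-eventually t         1≤t (suc N) n       = trans (*-congʳ recip-1) (trans (*-identityˡ _) (probability-eventually t 1≤t N n))

-- Null sets of exceptional starting points.

square : ℕ → ℕ
square l = l ℕ.* l

-- This is what makes 2^((l+1)²) events of probability 2^(-2^(l+3)) cost at most 2^(-l). The left
-- side grows by 2l + 4 at each step, the right side by 2^(l+3).
square-bound : ∀ l → square (suc l) ℕ.+ l ℕ.≤ 2 ℕ.^ (l ℕ.+ 3)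
square-bound zero    = s≤s z≤n
square-bound (suc l) = begin
  square (suc (suc l)) ℕ.+ suc l                  ≡⟨ +-*-Solver.solve 1 (λ l → (con 2 :+ l) :* (con 2 :+ l) :+ (con 1 :+ l) := ((con 1 :+ l) :* (con 1 :+ l) :+ l) :+ (con 2 :* l :+ con 4)) ≡.refl l ⟩
  (square (suc l) ℕ.+ l) ℕ.+ (2 ℕ.* l ℕ.+ 4)      ≤⟨ ℕ.+-mono-≤ (square-bound l) (linear-bound l) ⟩
  2 ℕ.^ (l ℕ.+ 3) ℕ.+ 2 ℕ.^ (l ℕ.+ 3)             ≡⟨ ≡.cong (2 ℕ.^ (l ℕ.+ 3) ℕ.+_) (ℕ.+-identityʳ _) ⟨
  2 ℕ.^ (suc l ℕ.+ 3)                             ∎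
  where
  open ℕ.≤-Reasoning
  open +-*-Solver using (con; _:+_; _:*_; _:=_)

  linear-bound : ∀ l → 2 ℕ.* l ℕ.+ 4 ℕ.≤ 2 ℕ.^ (l ℕ.+ 3)
  linear-bound zero    = ℕ.m≤m+n 4 4
  linear-bound (suc l) = begin
    2 ℕ.* suc l ℕ.+ 4                         ≡⟨ +-*-Solver.solve 1 (λ l → con 2 :* (con 1 :+ l) :+ con 4 := (con 2 :* l :+ con 4) :+ con 2) ≡.refl l ⟩
    (2 ℕ.* l ℕ.+ 4) ℕ.+ 2                     ≤⟨ ℕ.+-mono-≤ (linear-bound l) (ℕ.^-monoʳ-≤ 2 (ℕ.≤-trans (s≤s z≤n) (ℕ.m≤n+m 3 l))) ⟩
    2 ℕ.^ (l ℕ.+ 3) ℕ.+ 2 ℕ.^ (l ℕ.+ 3)       ≡⟨ ≡.cong (2 ℕ.^ (l ℕ.+ 3) ℕ.+_) (ℕ.+-identityʳ _) ⟨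
    2 ℕ.^ (suc l ℕ.+ 3)                       ∎

module BadSets (lem : ExcludedMiddle 0ℓ) (reals : CompleteOrderedField) where

  open Events lem reals public
  open State

  private
    variable
      x : ℝ
      k m n : ℕ

  -- A negative numerator is moved to the other side: x (b + 1) = -(n + 1) becomes x (b + 1) + (n +
  -- 1) = 0.
  generic⇒irrational : Generic x → Irrational x
  generic⇒irrational {x} generic (mkℚ numerator b _ , x≈) = refute numerator x≈
    where
    B : ℝ
    B = fromℕ (suc b)

    clear : ∀ i → x ≈ fromℤ i / B → x * B ≈ fromℤ i
    clear i eq = trans (*-comm x B) (trans (*-congˡ eq) (*-/-cancel (fromℕ-pos b)))

    refute : ∀ i → x ≈ fromℤ i / B → ⊥
    refute (+ n)    eq = generic 0 b n (trans (+-identityʳ _) (clear (+ n) eq))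
    refute -[1+ n ] eq = generic (suc n) b 0 (trans (+-congʳ (clear -[1+ n ] eq)) (-‿inverseˡ _))

  -- Each choice of a, b, c excludes the single point (c - a) / (b + 1), so three nested countable
  -- unions of points suffice.
  null-nongeneric : Null (λ x → ¬ Generic x)
  null-nongeneric = null-⊆ witness (null-⋃ λ a → null-⋃ λ b → null-⋃ λ c → null-point ((fromℕ c - fromℕ a) / fromℕ (suc b)))
    where
    Rational : ℝ → Set
    Rational x = ∃[ a ] ∃[ b ] ∃[ c ] x ≈ (fromℕ c - fromℕ a) / fromℕ (suc b)

    solve-x : ∀ x a b c → x * fromℕ (suc b) + fromℕ a ≈ fromℕ c → x ≈ (fromℕ c - fromℕ a) / fromℕ (suc b)
    solve-x x a b c eq = *-cancelˡ-≈ (fromℕ-pos b) (trans (solve 3 (λ x b a → b :* x := (x :* b :+ a) :- a) refl x (fromℕ (suc b)) (fromℕ a))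
      (trans (+-congʳ eq) (sym (*-/-cancel (fromℕ-pos b)))))

    witness : ∀ x → ¬ Generic x → Rational x
    witness x ¬generic with lem {Rational x}
    ... | yes found = found
    ... | no ¬found = contradiction (λ a b c eq → ¬found (a , b , c , solve-x x a b c eq)) ¬generic

  -- Turns a property of orbits into a set of reals. Propositional equality identifies x with the
  -- point of the state, and scale 1 stands for the interval (0, 1).
  Starting : (State → Set) → ℝ → Set
  Starting P x = ∃[ s ] point s ≡ x × scale s ≡ 1 × P s

  cover-starting : ∀ {P} n (c : ℕ → Condition) → (∀ s → P s → ∀ i → i ℕ.< n → Along s i (c i)) → Cover (Starting P) (probability n c)
  cover-starting n c holds = cover-≤ (≤-reflexive (trans (*-congˡ recip-1) (*-identityʳ _)))
    (cover-⊆ (λ { _ (s , ≡.refl , 1≡ , Ps) → ≡.subst (λ m → Event n c m (point s)) 1≡ (event-orbit n c s 0 (holds s Ps)) })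
      (cover-event n c 1 (s≤s z≤n)))

  AlwaysLarge : State → Set
  AlwaysLarge s = ∃[ N ] (∀ k → N ℕ.≤ k → Along s k (atLeast 2 (s≤s z≤n)))

  -- For fixed N, n further conditions of chance 1/2 have probability 2^(-n) for every n. A
  -- countable union over N follows.
  null-alwaysLarge : Null (Starting AlwaysLarge)
  null-alwaysLarge = null-⊆ (λ { x (s , eq , eq′ , N , large) → N , s , eq , eq′ , large }) (null-⋃ λ N → null-from-2^ λ n →
    cover-≤ (≤-reflexive (probability-eventually 2 (s≤s z≤n) N n))
      (cover-starting (N ℕ.+ n) (eventually (atLeast 2 (s≤s z≤n)) N)
        (λ s large i _ → along-eventually s i (atLeast 2 (s≤s z≤n)) N i (large i))))

  ∑-const : ∀ n c → ∑< n (λ _ → c) ≈ fromℕ n * c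
  ∑-const zero    c = sym (zeroˡ c)
  ∑-const (suc n) c = trans (+-congˡ (∑-const n c)) (solve 2 (λ n c → c :+ n :* c := (con (+ 1) :+ n) :* c) refl (fromℕ n) c)

  fromℕ*recip≤recip : ∀ k → 1 ℕ.≤ m → 1 ℕ.≤ n → k ℕ.* m ℕ.≤ n → fromℕ k * recip n ≤ recip m
  fromℕ*recip≤recip {m} {n} k 1≤m 1≤n km≤n = *-cancelˡ-≤ (fromℕ-pos′ 1≤m) (begin
    fromℕ m * (fromℕ k * recip n)     ≈⟨ solve 3 (λ m k r → m :* (k :* r) := k :* m :* r) refl (fromℕ m) (fromℕ k) (recip n) ⟩
    fromℕ k * fromℕ m * recip n       ≈⟨ *-congʳ (fromℕ-* k m) ⟨
    fromℕ (k ℕ.* m) * recip n         ≤⟨ *-monoʳ-≤ (<⇒≤ (recip-pos 1≤n)) (fromℕ-mono-≤ km≤n) ⟩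
    fromℕ n * recip n                 ≈⟨ recip-inverseʳ 1≤n ⟩
    1#                                ≈⟨ recip-inverseʳ 1≤m ⟨
    fromℕ m * recip m                 ∎)
    where open ≤-Reasoning

  1≤n*2^ : 1 ℕ.≤ n → ∀ i → 1 ℕ.≤ n ℕ.* 2 ℕ.^ i
  1≤n*2^ 1≤n i = ℕ.*-mono-≤ 1≤n (1≤2^n i)

  SomeHuge : ∀ n → 1 ℕ.≤ n → ℕ → State → Set
  SomeHuge n 1≤n i s = ∃[ k ] k ℕ.< n × Along s k (atLeast (n ℕ.* 2 ℕ.^ i) (1≤n*2^ 1≤n i))

  -- A union bound over n positions, each of chance 1 / (n 2^i).
  cover-someHuge : ∀ n (1≤n : 1 ℕ.≤ n) i → Cover (Starting (SomeHuge n 1≤n i)) (recip (2 ℕ.^ i))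
  cover-someHuge n 1≤n i = cover-⊆ (λ { x (s , eq , eq′ , k , k<n , huge) → k , k<n , s , eq , eq′ , huge })
    (cover-≤ (≤-trans (≤-reflexive (∑-const n (recip t))) (fromℕ*recip≤recip n (1≤2^n i) 1≤t ℕ.≤-refl))
      (cover-⋃< {S = λ k → Starting (λ s → Along s k (atLeast t 1≤t))} n λ k →
        cover-≤ (≤-reflexive (trans (probability-eventually t 1≤t k 1) (reflexive (≡.cong recip (ℕ.*-identityʳ t)))))
          (cover-starting (k ℕ.+ 1) (eventually (atLeast t 1≤t) k) (λ s huge j j<k+1 → along-eventually s j (atLeast t 1≤t) k j
            -- Only position k is constrained: among the first k + 1 steps, j ≥ k means j = k.
            (λ k≤j → ≡.subst (λ j → Along s j (atLeast t 1≤t)) (ℕ.≤-antisym k≤j (ℕ.s≤s⁻¹ (≡.subst (j ℕ.<_) (ℕ.+-comm k 1) j<k+1))) huge)))))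
    where
    t : ℕ
    t = n ℕ.* 2 ℕ.^ i

    1≤t : 1 ℕ.≤ t
    1≤t = 1≤n*2^ 1≤n i

  probability-below-+ : ∀ t (1≤t : 1 ℕ.≤ t) m n → let P = λ n → probability n (λ _ → below t 1≤t) in P (m ℕ.+ n) ≈ P m * P n
  probability-below-+ t 1≤t zero    n = sym (*-identityˡ _)
  probability-below-+ t 1≤t (suc m) n = trans (*-congˡ (probability-below-+ t 1≤t m n)) (sym (*-assoc _ _ _))

  -- The probability is (1 - 1/t)ⁿ, so this is a form of Bernoulli's inequality.
  probability-below-bernoulli : ∀ t (1≤t : 1 ℕ.≤ t) n → probability n (λ _ → below t 1≤t) * (1# + fromℕ n * recip t) ≤ 1#
  probability-below-bernoulli t 1≤t zero    = ≤-reflexive (solve 1 (λ r → con (+ 1) :* (con (+ 1) :+ con (+ 0) :* r) := con (+ 1)) refl (recip t))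
  probability-below-bernoulli t 1≤t (suc n) = ≤-trans
    (≤-from (*-nonneg (probability-nonneg n _) (*-nonneg (fromℕ-nonneg (suc n)) (*-nonneg 0≤r 0≤r)))
      (solve 3 (λ p n r → p :* ((con (+ 1) :+ n) :* (r :* r)) := p :* (con (+ 1) :+ n :* r) :- ((con (+ 1) :- r) :* p) :* (con (+ 1) :+ (con (+ 1) :+ n) :* r)) refl
        (probability n (λ _ → below t 1≤t)) (fromℕ n) (recip t)))
    (probability-below-bernoulli t 1≤t n)
    where
    0≤r : 0# ≤ recip t
    0≤r = <⇒≤ (recip-pos 1≤t)

  -- Taking t steps makes Bernoulli's factor 1 + t * (1/t) equal to 2.
  probability-below-half : ∀ t (1≤t : 1 ℕ.≤ t) → probability t (λ _ → below t 1≤t) ≤ recip 2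
  probability-below-half t 1≤t = *-cancelˡ-≤ (fromℕ-pos 1) (begin
    fromℕ 2 * P                     ≈⟨ solve 1 (λ p → (con (+ 1) :+ (con (+ 1) :+ con (+ 0))) :* p := p :* (con (+ 1) :+ con (+ 1))) refl P ⟩
    P * (1# + 1#)                   ≈⟨ *-congˡ (+-congˡ (recip-inverseʳ 1≤t)) ⟨
    P * (1# + fromℕ t * recip t)    ≤⟨ probability-below-bernoulli t 1≤t t ⟩
    1#                              ≈⟨ recip-inverseʳ {2} (s≤s z≤n) ⟨
    fromℕ 2 * recip 2               ∎)
    where
    open ≤-Reasoning
    P : ℝ
    P = probability t (λ _ → below t 1≤t)

  probability-below-2^ : ∀ t (1≤t : 1 ℕ.≤ t) s → probability (s ℕ.* t) (λ _ → below t 1≤t) ≤ recip (2 ℕ.^ s)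
  probability-below-2^ t 1≤t zero    = ≤-reflexive (sym recip-1)
  probability-below-2^ t 1≤t (suc s) = begin
    P (t ℕ.+ s ℕ.* t)           ≈⟨ probability-below-+ t 1≤t t (s ℕ.* t) ⟩
    P t * P (s ℕ.* t)           ≤⟨ *-mono-≤ (probability-nonneg t _) (probability-nonneg (s ℕ.* t) _) (probability-below-half t 1≤t) (probability-below-2^ t 1≤t s) ⟩
    recip 2 * recip (2 ℕ.^ s)   ≈⟨ recip-* {2} {2 ℕ.^ s} (s≤s z≤n) (1≤2^n s) ⟨
    recip (2 ℕ.^ suc s)         ∎
    where
    open ≤-Reasoning
    P : ℕ → ℝ
    P n = probability n (λ _ → below t 1≤t)

  -- The range of j contains every level that can arise for n with log₂ n < 2^((l+1)²), so one
  -- failure set per l covers a whole block of n.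
  AllSmall : ℕ → State → Set
  AllSmall l s = ∃[ j ] j ℕ.< 2 ℕ.^ square (suc l) × (∀ k → k ℕ.< 2 ℕ.^ (l ℕ.+ 3) ℕ.* 2 ℕ.^ j → Along s k (below (2 ℕ.^ j) (1≤2^n j)))

  -- The number of steps is proportional to the level 2^j, so all levels share the bound
  -- 2^(-2^(l+3)), and the union over j is controlled by `square-bound`.
  cover-allSmall : ∀ l → Cover (Starting (AllSmall l)) (recip (2 ℕ.^ l))
  cover-allSmall l = cover-⊆ (λ { x (s , eq , eq′ , j , j< , small) → j , j< , s , eq , eq′ , small })
    (cover-≤ (≤-trans (≤-reflexive (∑-const (2 ℕ.^ square (suc l)) _)) (fromℕ*recip≤recip (2 ℕ.^ square (suc l)) (1≤2^n l) (1≤2^n (2 ℕ.^ (l ℕ.+ 3))) count))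
      (cover-⋃< {S = λ j → Starting (λ s → ∀ k → k ℕ.< 2 ℕ.^ (l ℕ.+ 3) ℕ.* 2 ℕ.^ j → Along s k (below (2 ℕ.^ j) (1≤2^n j)))} (2 ℕ.^ square (suc l)) λ j →
        cover-≤ (probability-below-2^ (2 ℕ.^ j) (1≤2^n j) (2 ℕ.^ (l ℕ.+ 3))) (cover-starting (2 ℕ.^ (l ℕ.+ 3) ℕ.* 2 ℕ.^ j) (λ _ → below (2 ℕ.^ j) (1≤2^n j)) (λ _ small → small))))
    where
    count : 2 ℕ.^ square (suc l) ℕ.* 2 ℕ.^ l ℕ.≤ 2 ℕ.^ (2 ℕ.^ (l ℕ.+ 3))
    count = ℕ.≤-trans (ℕ.≤-reflexive (≡.sym (ℕ.^-distribˡ-+-* 2 (square (suc l)) l))) (ℕ.^-monoʳ-≤ 2 (square-bound l))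

-- Comparison of `R` and `M` with the digit ratios.

q≤evenOf : ∀ q → q ℕ.≤ evenOf q
q≤evenOf 0             = z≤n
q≤evenOf 1             = s≤s z≤n
q≤evenOf (suc (suc q)) = s≤s (s≤s (q≤evenOf q))

evenOf≤1+q : ∀ q → evenOf q ℕ.≤ suc q
evenOf≤1+q 0             = z≤n
evenOf≤1+q 1             = ℕ.≤-refl
evenOf≤1+q (suc (suc q)) = s≤s (s≤s (evenOf≤1+q q))

evenOf≤2*oddOf : ∀ q → evenOf q ℕ.≤ 2 ℕ.* oddOf q
evenOf≤2*oddOf 0             = z≤n
evenOf≤2*oddOf 1             = ℕ.≤-refl
evenOf≤2*oddOf (suc (suc q)) = ℕ.≤-trans (s≤s (s≤s (ℕ.≤-trans (evenOf≤2*oddOf q) (ℕ.m≤n+m _ 2)))) (ℕ.≤-reflexive (≡.sym (≡.trans (ℕ.*-distribˡ-+ 2 2 (oddOf q)) ≡.refl)))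

2*oddOf≤4*evenOf : ∀ q → 1 ℕ.≤ q → 2 ℕ.* oddOf q ℕ.≤ 4 ℕ.* evenOf q
2*oddOf≤4*evenOf 1 _ = ℕ.m≤m+n 2 6
2*oddOf≤4*evenOf 2 _ = ℕ.m≤m+n 6 2
2*oddOf≤4*evenOf (suc (suc q@(suc _))) _ = begin
  2 ℕ.* (2 ℕ.+ oddOf q)      ≡⟨ ℕ.*-distribˡ-+ 2 2 (oddOf q) ⟩
  4 ℕ.+ 2 ℕ.* oddOf q        ≤⟨ ℕ.+-mono-≤ (ℕ.m≤m+n 4 4) (2*oddOf≤4*evenOf q (s≤s z≤n)) ⟩
  8 ℕ.+ 4 ℕ.* evenOf q       ≡⟨ ℕ.*-distribˡ-+ 4 2 (evenOf q) ⟨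
  4 ℕ.* (2 ℕ.+ evenOf q)     ∎
  where open ℕ.≤-Reasoning

-- This makes the denominators nondecreasing along an orbit: the next digit is at least the next
-- scale `oddOf q`, and an even number that is at least `oddOf q` is at least `evenOf q`.
evenOf-mono : ∀ q q′ → oddOf q ℕ.≤ q′ → evenOf q ℕ.≤ evenOf q′
evenOf-mono 0 q′ _ = z≤n
evenOf-mono 1 1 _ = ℕ.≤-refl
evenOf-mono 1 (suc (suc q′)) _ = s≤s (s≤s z≤n)
evenOf-mono (suc (suc q)) (suc (suc q′)) (s≤s (s≤s o≤q′)) = s≤s (s≤s (evenOf-mono q q′ o≤q′))

module Ratios (lem : ExcludedMiddle 0ℓ) (reals : CompleteOrderedField) where

  open BadSets lem reals public
  open State

  private
    variable
      x y c : ℝ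
      k n : ℕ

  x≤max : ∀ x y → x ≤ max x y
  x≤max x y with x <? y
  ... | yes x<y = <⇒≤ x<y
  ... | no _    = ≤-refl

  y≤max : ∀ x y → y ≤ max x y
  y≤max x y with x <? y
  ... | yes _   = ≤-refl
  ... | no x≮y  = x≮y

  max≤ : x ≤ c → y ≤ c → max x y ≤ c
  max≤ {x} {c} {y} x≤c y≤c with x <? y
  ... | yes _ = y≤c
  ... | no _  = x≤c

  R≤M : ∀ x n k → k ℕ.≤ n → R (suc k) x ≤ M (suc n) x
  R≤M x zero    zero    _   = ≤-refl
  R≤M x (suc n) k       k≤1+n with k ℕ.≟ suc n
  ... | yes ≡.refl = y≤max (M (suc n) x) (R (suc (suc n)) x)
  ... | no k≢1+n   = ≤-trans (R≤M x n k (ℕ.s≤s⁻¹ (ℕ.≤∧≢⇒< k≤1+n k≢1+n))) (x≤max (M (suc n) x) (R (suc (suc n)) x))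

  M≤ : ∀ x n → (∀ k → k ℕ.≤ n → R (suc k) x ≤ c) → M (suc n) x ≤ c
  M≤ x zero    R≤c = R≤c 0 z≤n
  M≤ x (suc n) R≤c = max≤ (M≤ x n (λ k k≤n → R≤c k (ℕ.m≤n⇒m≤1+n k≤n))) (R≤c (suc n) ℕ.≤-refl)

  -- The denominators d_k, with the convention d_0 = 1 that makes
  -- R_1 = d_1 an instance of R_k = d_k / d_{k-1}.
  denominator : State → ℕ → ℕ
  denominator s zero    = 1
  denominator s (suc k) = evenOf (digit (orbit s k))

  1≤denominator : ∀ s k → 1 ℕ.≤ denominator s k
  1≤denominator s zero    = s≤s z≤n
  1≤denominator s (suc k) = 1≤evenOf (1≤digit (orbit s k))

  d≡denominator : ∀ s k → d (suc k) (point s) ≡ + denominator s (suc k)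
  d≡denominator s k = ≡.trans (≡.cong d₁ (≡.sym (point-orbit s k))) (d₁-digit (1≤digit (orbit s k)) (isDigit (orbit s k)))

  R≈ratio : ∀ s k → R (suc k) (point s) ≈ fromℕ (denominator s (suc k)) / fromℕ (denominator s k)
  R≈ratio s zero    = trans (reflexive (≡.cong fromℤ (d≡denominator s 0))) (trans (sym (*-identityʳ _)) (*-congˡ (sym recip-1)))
  R≈ratio s (suc k) = reflexive (≡.cong₂ (λ i j → fromℤ i / fromℤ j) (d≡denominator s (suc k)) (d≡denominator s k))

  ratio≤ : ∀ s k c → denominator s (suc k) ℕ.≤ c ℕ.* denominator s k → R (suc k) (point s) ≤ fromℕ c
  ratio≤ s k c a≤cb = ≤-trans (≤-reflexive (R≈ratio s k)) (/-≤ (fromℕ-pos′ (1≤denominator s k))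
    (≤-trans (fromℕ-mono-≤ a≤cb) (≤-reflexive (trans (fromℕ-* c (denominator s k)) (*-comm _ _)))))

  ≤ratio : ∀ s k c → c ℕ.* denominator s k ℕ.≤ denominator s (suc k) → fromℕ c ≤ R (suc k) (point s)
  ≤ratio s k c cb≤a = ≤-trans (≤-/ (fromℕ-pos′ (1≤denominator s k))
    (≤-trans (≤-reflexive (trans (*-comm _ _) (sym (fromℕ-* c (denominator s k))))) (fromℕ-mono-≤ cb≤a))) (≤-reflexive (sym (R≈ratio s k)))

  module _ (s : State) (scale≡1 : scale s ≡ 1) where

    denominator-mono : ∀ k → denominator s k ℕ.≤ denominator s (suc k)
    denominator-mono zero    = 1≤denominator s 1
    denominator-mono (suc k) = evenOf-mono (digit (orbit s k)) (digit (orbit s (suc k))) (scale≤digit (orbit s (suc k)))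

    denominator≤2*scale : ∀ k → denominator s k ℕ.≤ 2 ℕ.* scale (orbit s k)
    denominator≤2*scale zero    = ≡.subst (λ m → 1 ℕ.≤ 2 ℕ.* m) (≡.sym scale≡1) (s≤s z≤n)
    denominator≤2*scale (suc k) = evenOf≤2*oddOf (digit (orbit s k))

    scale≤2*denominator : ∀ k → scale (orbit s k) ℕ.≤ 2 ℕ.* denominator s k
    scale≤2*denominator zero    = ≡.subst (ℕ._≤ 2) (≡.sym scale≡1) (s≤s z≤n)
    scale≤2*denominator (suc k) = ℕ.*-cancelˡ-≤ 2 (ℕ.≤-trans (2*oddOf≤4*evenOf (digit (orbit s k)) (1≤digit (orbit s k))) (ℕ.≤-reflexive (ℕ.*-assoc 2 2 (evenOf (digit (orbit s k))))))

    1≤R : ∀ k → 1# ≤ R (suc k) (point s)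
    1≤R k = ≤-trans (≤-reflexive (sym fromℕ-1)) (≤ratio s k 1 (ℕ.≤-trans (ℕ.≤-reflexive (ℕ.*-identityˡ _)) (denominator-mono k)))

    1≤M : ∀ n → 1# ≤ M (suc n) (point s)
    1≤M n = ≤-trans (1≤R 0) (R≤M (point s) n 0 z≤n)

    -- Strictness of q < t m absorbs e ≤ q + 1. The factor 2 is the price of replacing the scale m
    -- by the previous denominator.
    R-upper : ∀ k t (1≤t : 1 ℕ.≤ t) → Along s k (below t 1≤t) → R (suc k) (point s) ≤ fromℕ (2 ℕ.* t)
    R-upper k t 1≤t q<tm = ratio≤ s k (2 ℕ.* t) (begin
      evenOf q                          ≤⟨ evenOf≤1+q q ⟩
      suc q                             ≤⟨ q<tm ⟩
      t ℕ.* scale (orbit s k)           ≤⟨ ℕ.*-monoʳ-≤ t (scale≤2*denominator k) ⟩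
      t ℕ.* (2 ℕ.* denominator s k)     ≡⟨ ℕ.*-assoc t 2 _ ⟨
      t ℕ.* 2 ℕ.* denominator s k       ≡⟨ ≡.cong (ℕ._* denominator s k) (ℕ.*-comm t 2) ⟩
      2 ℕ.* t ℕ.* denominator s k       ∎)
      where
      open ℕ.≤-Reasoning
      q : ℕ
      q = digit (orbit s k)

    -- The previous denominator may be as large as 2m, hence the threshold 2t for a ratio of t.
    R-lower : ∀ k t (1≤2t : 1 ℕ.≤ 2 ℕ.* t) → Along s k (atLeast (2 ℕ.* t) 1≤2t) → fromℕ t ≤ R (suc k) (point s)
    R-lower k t 1≤2t 2tm≤q = ≤ratio s k t (begin
      t ℕ.* denominator s k             ≤⟨ ℕ.*-monoʳ-≤ t (denominator≤2*scale k) ⟩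
      t ℕ.* (2 ℕ.* scale (orbit s k))   ≡⟨ ℕ.*-assoc t 2 _ ⟨
      t ℕ.* 2 ℕ.* scale (orbit s k)     ≡⟨ ≡.cong (ℕ._* scale (orbit s k)) (ℕ.*-comm t 2) ⟩
      2 ℕ.* t ℕ.* scale (orbit s k)     ≤⟨ 2tm≤q ⟩
      q                                 ≤⟨ q≤evenOf q ⟩
      evenOf q                          ∎)
      where
      open ℕ.≤-Reasoning
      q : ℕ
      q = digit (orbit s k)

-- A discrete inverse of `f`; since i < f i, the search upward from a must stop by the time it
-- reaches n.
bracket : (f : ℕ → ℕ) → (∀ i → i ℕ.< f i) → ∀ a n → f a ℕ.≤ n → ∃[ i ] a ℕ.≤ i × f i ℕ.≤ n × n ℕ.< f (suc i)
bracket f i<fi a n fa≤n = search n a fa≤n (ℕ.≤-trans (ℕ.≤-reflexive (ℕ.+-comm 1 n)) (ℕ.≤-trans (ℕ.m≤n+m (n ℕ.+ 1) a) (ℕ.≤-reflexive (≡.trans (≡.cong (a ℕ.+_) (ℕ.+-comm n 1)) (ℕ.+-suc a n)))))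
  where
  search : ∀ fuel a → f a ℕ.≤ n → n ℕ.< suc (a ℕ.+ fuel) → ∃[ i ] a ℕ.≤ i × f i ℕ.≤ n × n ℕ.< f (suc i)
  search zero a fa≤n n<1+a = contradiction (ℕ.<-≤-trans (i<fi a) (ℕ.≤-trans fa≤n (ℕ.≤-trans (ℕ.s≤s⁻¹ n<1+a) (ℕ.≤-reflexive (ℕ.+-identityʳ a))))) (ℕ.<-irrefl ≡.refl)
  search (suc fuel) a fa≤n n< with n ℕ.<? f (suc a)
  ... | yes n<f = a , ℕ.≤-refl , fa≤n , n<f
  ... | no n≮f with search fuel (suc a) (ℕ.≮⇒≥ n≮f) (≡.subst (λ j → n ℕ.< suc j) (ℕ.+-suc a fuel) n<)
  ...   | i , a<i , fi≤n , n<f = i , ℕ.<⇒≤ a<i , fi≤n , n<f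

n≤square : ∀ n → n ℕ.≤ square n
n≤square zero    = z≤n
n≤square (suc n) = ℕ.m≤m*n (suc n) (suc n)

-- Criteria for the limit inferior in the extended reals.

module Liminf (lem : ExcludedMiddle 0ℓ) (reals : CompleteOrderedField) where

  open Ratios lem reals public
  open AddExtrema _≤_ using (⊥±≤_; [≤]-injective)

  private
    variable
      a : ℕ → ℝ

  [_]≤ : ∀ {x y : ℝ} → x ≤ y → [ x ] ≤± [ y ]
  [ x≤y ]≤ = AddExtrema.[ x≤y ]

  liminf-⊥ : (∀ r N → ∃[ n ] N ℕ.≤ n × a n < r) → IsLiminf a ⊥±
  liminf-⊥ {a} low = (λ _ → ⊥±) , (λ n → (λ _ → ⊥±≤ _) , greatest n) , ((λ _ → ⊥±≤ _) , λ u upper → upper 0)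
    where
    greatest : ∀ n u → (∀ j → u ≤± [ a (n ℕ.+ j) ]) → u ≤± ⊥±
    greatest n ⊥± lower = ⊥±≤ _
    greatest n [ r ] lower with low r n
    ... | m , n≤m , am<r = contradiction am<r
      (≡.subst (λ m → r ≤ a m) (ℕ.m+[n∸m]≡n n≤m) ([≤]-injective (lower (m ℕ.∸ n))))
    greatest n ⊤± lower with lower 0
    ... | ()

  -- Completeness gives it as the supremum of the real lower bounds; if there are none, it is `⊥±`.
  infimum : (f : ℕ → ℝ) → ∃[ l ] IsInf (λ j → [ f j ]) l
  infimum f with lem {∃[ b ] (∀ j → b ≤ f j)}
  ... | yes (b , b≤f) = [ s ] , (λ j → [ proj₂ (proj₂ sup) (f j) (λ r r≤f → r≤f j) ]≤) , greatest
    where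
    Lower : ℝ → Set
    Lower r = ∀ j → r ≤ f j

    sup : Σ[ s ∈ ℝ ] UpperBound Lower s × (∀ u → UpperBound Lower u → s ≤ u)
    sup = supremum Lower (b , b≤f) (f 0 , λ r r≤f → r≤f 0)

    s : ℝ
    s = proj₁ sup

    greatest : ∀ u → (∀ j → u ≤± [ f j ]) → u ≤± [ s ]
    greatest ⊥±    lower = ⊥±≤ _
    greatest [ r ] lower = [ proj₁ (proj₂ sup) r (λ j → [≤]-injective (lower j)) ]≤
    greatest ⊤±    lower with lower 0
    ... | ()
  ... | no unbounded = ⊥± , (λ _ → ⊥±≤ _) , greatest
    where
    greatest : ∀ u → (∀ j → u ≤± [ f j ]) → u ≤± ⊥±
    greatest ⊥±    lower = ⊥±≤ _
    greatest [ r ] lower = contradiction (r , λ j → [≤]-injective (lower j)) unbounded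
    greatest ⊤±    lower with lower 0
    ... | ()

  -- The first hypothesis puts some tail infimum above -ε, the second keeps every tail infimum at
  -- most 0. Each is contradicted at half the distance of a nonzero real candidate.
  liminf-0 : (∀ ε → 0# < ε → ∃[ N ] (∀ n → N ℕ.≤ n → - ε ≤ a n)) →
             (∀ ε → 0# < ε → ∀ N → ∃[ n ] N ℕ.≤ n × a n ≤ ε) → IsLiminf a [ 0# ]
  liminf-0 {a} lower upper = g , isInf , g≤0 , least
    where
    tailInf : ∀ n → ∃[ l ] IsInf (λ j → [ a (n ℕ.+ j) ]) l
    tailInf n = infimum (λ j → a (n ℕ.+ j))

    g : ℕ → ℝ ±
    g n = proj₁ (tailInf n)

    isInf : ∀ n → IsInf (λ j → [ a (n ℕ.+ j) ]) (g n)
    isInf n = proj₂ (tailInf n)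

    below-0 : ∀ n l → (∀ j → l ≤± [ a (n ℕ.+ j) ]) → l ≤± [ 0# ]
    below-0 n ⊥±    low = ⊥±≤ _
    below-0 n ⊤±    low with low 0
    ... | ()
    below-0 n [ r ] low = [ r≤0 ]≤
      where
      r≤0 : r ≤ 0#
      r≤0 0<r with upper (half r) (half-pos 0<r) n
      ... | m , n≤m , am≤½r = contradiction
        (<-from (half-pos 0<r) (trans (solve 1 (λ h → h := (h :+ h) :- h) refl (half r)) (+-congʳ (half+half r))))
        (≤-trans (≡.subst (λ m → r ≤ a m) (ℕ.m+[n∸m]≡n n≤m) ([≤]-injective (low (m ℕ.∸ n)))) am≤½r)

    g≤0 : ∀ n → g n ≤± [ 0# ]
    g≤0 n = below-0 n (g n) (proj₁ (isInf n))

    squeeze : ∀ {r u} l → [ r ] ≤± l → l ≤± [ u ] → r ≤ u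
    squeeze [ s ] r≤s s≤u = ≤-trans ([≤]-injective r≤s) ([≤]-injective s≤u)
    squeeze ⊥± AddSupremum.[ () ] _
    squeeze ⊤± _ ()

    not-⊥ : ∀ {r} l → [ r ] ≤± l → l ≤± ⊥± → ⊥
    not-⊥ ⊥±    AddSupremum.[ () ] _
    not-⊥ [ _ ] _ AddSupremum.[ () ]
    not-⊥ ⊤±    _ ()

    low-bound : ∀ ε → 0# < ε → ∃[ N ] [ - ε ] ≤± g N
    low-bound ε 0<ε with lower ε 0<ε
    ... | N , -ε≤a = N , proj₂ (isInf N) [ - ε ] (λ j → [ -ε≤a (N ℕ.+ j) (ℕ.m≤m+n N j) ]≤)

    least : ∀ u → (∀ n → g n ≤± u) → [ 0# ] ≤± u
    least ⊤±    bound = AddExtrema._≤⊤± _≤_ [ 0# ]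
    least [ r ] bound = [ 0≤r ]≤
      where
      0≤r : 0# ≤ r
      0≤r r<0 = conclude (low-bound (half (- r)) (half-pos 0<-r))
        where
        0<-r : 0# < - r
        0<-r = <-from (x<y⇒0<y-x r<0) (solve 1 (λ r → con (+ 0) :- r := :- r :- con (+ 0)) refl r)

        conclude : ∃[ N ] [ - half (- r) ] ≤± g N → ⊥
        conclude (N , low) = squeeze (g N) low (bound N) (<-from (half-pos 0<-r)
          (trans (solve 1 (λ h → h := :- h :+ (h :+ h)) refl (half (- r))) (+-congˡ (half+half (- r)))))
    least ⊥±    bound with low-bound 1# 0<1
    ... | N , low = ⊥-elim (not-⊥ (g N) low (bound N))

-- The two limits outside the exceptional set.

module Theorem (lem : ExcludedMiddle 0ℓ) (reals : CompleteOrderedField) where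

  open Liminf lem reals public
  open State

  loglog : ℕ → ℝ
  loglog n = log (log (fromℕ n))

  loglog-unbounded : ∀ u → 0# ≤ u → ∃[ N ] (∀ n → N ℕ.≤ n → 1# ≤ log (fromℕ n) × u ≤ loglog n)
  loglog-unbounded u 0≤u = from (archimedean (exp (exp u)))
    where
    from : ∃[ N ] exp (exp u) < fromℕ N → ∃[ N ] (∀ n → N ℕ.≤ n → 1# ≤ log (fromℕ n) × u ≤ loglog n)
    from (N , expexp<N) = N , λ n N≤n → ≤-trans (1≤exp 0≤u) (expu≤log n N≤n) , x≤log 0≤u (expu≤log n N≤n)
      where
      expu≤log : ∀ n → N ℕ.≤ n → exp u ≤ log (fromℕ n)
      expu≤log n N≤n = x≤log (<⇒≤ (exp-pos 0≤u)) (≤-trans (<⇒≤ expexp<N) (fromℕ-mono-≤ N≤n))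

  -- log n ≥ 2^(p+1) log 2 ≥ 2^p, because 2 log 2 ≥ 1. One binary exponent is spent on removing the
  -- inner factor log 2.
  loglog-2^2^ : ∀ p n → 2 ℕ.^ (2 ℕ.^ suc p) ℕ.≤ n → fromℕ p * λ₂ ≤ loglog n
  loglog-2^2^ p n big = ≤-trans (≤-reflexive (sym (log-2^ p))) (log-mono-≤ (1≤fromℕ (1≤2^n p)) (begin
    fromℕ (2 ℕ.^ p)                      ≈⟨ solve 1 (λ a → a := a :* con (+ 1)) refl (fromℕ (2 ℕ.^ p)) ⟩
    fromℕ (2 ℕ.^ p) * 1#                 ≈⟨ *-congˡ (half+half 1#) ⟨
    fromℕ (2 ℕ.^ p) * (half 1# + half 1#)  ≤⟨ *-monoˡ-≤ (fromℕ-nonneg (2 ℕ.^ p)) (+-mono-≤ ½≤λ₂ ½≤λ₂) ⟩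
    fromℕ (2 ℕ.^ p) * (λ₂ + λ₂)          ≈⟨ solve 2 (λ a l → a :* (l :+ l) := ((con (+ 1) :+ (con (+ 1) :+ con (+ 0))) :* a) :* l) refl (fromℕ (2 ℕ.^ p)) λ₂ ⟩
    fromℕ 2 * fromℕ (2 ℕ.^ p) * λ₂       ≈⟨ *-congʳ (fromℕ-* 2 (2 ℕ.^ p)) ⟨
    fromℕ (2 ℕ.^ suc p) * λ₂             ≈⟨ log-2^ (2 ℕ.^ suc p) ⟨
    log (fromℕ (2 ℕ.^ (2 ℕ.^ suc p)))    ≤⟨ log-mono-≤ (1≤fromℕ (1≤2^n (2 ℕ.^ suc p))) (fromℕ-mono-≤ big) ⟩
    log (fromℕ n)                        ∎))
    where open ≤-Reasoning

  by-contradiction : {A : Set} → ¬ ¬ A → A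
  by-contradiction {A} ¬¬a with lem {A}
  ... | yes a = a
  ... | no ¬a = contradiction ¬a ¬¬a

  eventually-not : {P : ℕ → Set} → ¬ (∀ N → ∃[ i ] N ℕ.≤ i × P i) → ∃[ N ] (∀ i → N ℕ.≤ i → ¬ P i)
  eventually-not rare = by-contradiction λ ¬found → rare λ N → by-contradiction λ ¬found′ →
    ¬found (N , λ i N≤i Pi → ¬found′ (i , N≤i , Pi))

  small-often : ∀ s → ¬ AlwaysLarge s → ∀ N → ∃[ k ] N ℕ.≤ k × Along s k (below 2 (s≤s z≤n))
  small-often s ¬large N = by-contradiction λ ¬found → ¬large (N , λ k N≤k → ℕ.≮⇒≥ (λ small → ¬found (k , N≤k , small)))

  large-exists : ∀ s l → ¬ AllSmall l s → ∀ j → j ℕ.< 2 ℕ.^ square (suc l) →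
    ∃[ k ] k ℕ.< 2 ℕ.^ (l ℕ.+ 3) ℕ.* 2 ℕ.^ j × Along s k (atLeast (2 ℕ.^ j) (1≤2^n j))
  large-exists s l ¬small j j< = by-contradiction λ ¬found → ¬small (j , j< , λ k k< → ℕ.≰⇒> (λ large → ¬found (k , k< , large)))

  -- To be read with u = log log n, l = log n and c = log R_n: since l ≥ 1 + u + u²/2 and c ≤ u, the
  -- difference c - l is at most -1 - u²/2, which is below -u k.
  quadratic-gap : ∀ {c l u k} → 0# < u → c ≤ u → two * k ≤ u → two * (1# + u) + u * u ≤ two * l → c - l < u * (- k)
  quadratic-gap {c} {l} {u} {k} 0<u c≤u 2k≤u quadratic = *-cancelˡ-< 0<two (<-from
    (+-pos-nonneg (+-pos-nonneg (+-pos-nonneg 0<two (*-nonneg (<⇒≤ 0<two) (x≤y⇒0≤y-x c≤u))) (*-nonneg (<⇒≤ 0<u) (x≤y⇒0≤y-x 2k≤u))) (x≤y⇒0≤y-x quadratic))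
    (solve 4 (λ c l u k → ((con (+ 1) :+ con (+ 1)) :+ (con (+ 1) :+ con (+ 1)) :* (u :- c) :+ u :* (u :- (con (+ 1) :+ con (+ 1)) :* k))
        :+ ((con (+ 1) :+ con (+ 1)) :* l :- ((con (+ 1) :+ con (+ 1)) :* (con (+ 1) :+ u) :+ u :* u))
      := (con (+ 1) :+ con (+ 1)) :* (u :* (:- k)) :- (con (+ 1) :+ con (+ 1)) :* (c :- l)) refl c l u k))

  fraction-≤ : ∀ {ε} k a b → recip k ≤ ε → 1 ℕ.≤ k → k ℕ.* a ℕ.≤ b → fromℕ a ≤ ε * fromℕ b
  fraction-≤ {ε} k a b 1/k≤ε 1≤k ka≤b = begin
    fromℕ a                          ≈⟨ *-identityˡ _ ⟨
    1# * fromℕ a                     ≈⟨ *-congʳ (recip-inverseʳ 1≤k) ⟨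
    fromℕ k * recip k * fromℕ a      ≈⟨ solve 3 (λ k r a → k :* r :* a := r :* (k :* a)) refl (fromℕ k) (recip k) (fromℕ a) ⟩
    recip k * (fromℕ k * fromℕ a)    ≈⟨ *-congˡ (fromℕ-* k a) ⟨
    recip k * fromℕ (k ℕ.* a)        ≤⟨ *-mono-≤ (<⇒≤ (recip-pos 1≤k)) (fromℕ-nonneg (k ℕ.* a)) 1/k≤ε (fromℕ-mono-≤ ka≤b) ⟩
    ε * fromℕ b                      ∎
    where open ≤-Reasoning

  -- n_i, so large that log log n_i outgrows the log 2^i by which M_{n_i} may exceed n_i.
  sparse : ℕ → ℕ
  sparse i = 2 ℕ.^ (2 ℕ.^ suc (square i))

  1≤sparse : ∀ i → 1 ℕ.≤ sparse i
  1≤sparse i = 1≤2^n (2 ℕ.^ suc (square i))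

  i≤sparse : ∀ i → i ℕ.≤ sparse i
  i≤sparse i = begin
    i                          ≤⟨ n≤square i ⟩
    square i                   ≤⟨ ℕ.n≤1+n _ ⟩
    suc (square i)             ≤⟨ ℕ.<⇒≤ (n<2^n (suc (square i))) ⟩
    2 ℕ.^ suc (square i)       ≤⟨ ℕ.<⇒≤ (n<2^n (2 ℕ.^ suc (square i))) ⟩
    sparse i                   ∎
    where open ℕ.≤-Reasoning

  module _ (s : State) (scale≡1 : scale s ≡ 1) where

    private
      x : ℝ
      x = point s

    M-upper : ∀ {c} n → 1 ℕ.≤ n → (∀ k → k ℕ.< n → R (suc k) x ≤ c) → M n x ≤ c
    M-upper (suc n) _ R≤c = M≤ x n (λ k k≤n → R≤c k (s≤s k≤n))

    M-lower : ∀ n k → k ℕ.< n → R (suc k) x ≤ M n x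
    M-lower (suc n) k (s≤s k≤n) = R≤M x n k k≤n

    1≤M′ : ∀ n → 1 ℕ.≤ n → 1# ≤ M n x
    1≤M′ (suc n) _ = 1≤M s scale≡1 n

    -- The threshold 2K + log 4 + 1 for log log n is a sum so that it yields positivity, log R_n ≤
    -- log log n and 2K ≤ log log n at once.
    ratio-R<-K : ∀ {K} n → 0# ≤ K → 1# ≤ R n x → R n x ≤ fromℕ 4 → 1# ≤ log (fromℕ n) →
      (two * K + log (fromℕ 4)) + 1# ≤ loglog n → (log (R n x) - log (fromℕ n)) / log (log (fromℕ n)) < - K
    ratio-R<-K {K} n 0≤K 1≤R R≤4 1≤L U≤u = /-< 0<u (quadratic-gap 0<u logR≤u 2K≤u
        (≤-trans (half-square≤exp (<⇒≤ 0<u)) (≤-reflexive (*-congˡ (exp-log 1≤L)))))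
      where
      C : ℝ
      C = log (fromℕ 4)

      0≤C : 0# ≤ C
      0≤C = log-nonneg (1≤fromℕ {4} (s≤s z≤n))

      0≤2K : 0# ≤ two * K
      0≤2K = *-nonneg (<⇒≤ 0<two) 0≤K

      0<u : 0# < loglog n
      0<u = <-≤-trans (<-≤-trans 0<1 (≤-from (+-nonneg 0≤2K 0≤C) (solve 2 (λ k c → k :+ c := ((k :+ c) :+ con (+ 1)) :- con (+ 1)) refl (two * K) C))) U≤u

      logR≤u : log (R n x) ≤ loglog n
      logR≤u = ≤-trans (log-mono-≤ 1≤R R≤4) (≤-trans (≤-from (+-nonneg 0≤2K 0≤1) (solve 2 (λ k c → k :+ con (+ 1) := ((k :+ c) :+ con (+ 1)) :- c) refl (two * K) C)) U≤u)

      2K≤u : two * K ≤ loglog n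
      2K≤u = ≤-trans (≤-from (+-nonneg 0≤C 0≤1) (solve 2 (λ k c → c :+ con (+ 1) := ((k :+ c) :+ con (+ 1)) :- k) refl (two * K) C)) U≤u

    liminf-R : ¬ AlwaysLarge s → IsLiminf (λ n → (log (R n x) - log (fromℕ n)) / log (log (fromℕ n))) ⊥±
    liminf-R ¬large = liminf-⊥ λ r N → conclude r N (±≤-bound r)
      where
      Low : ℝ → ℕ → Set
      Low r N = ∃[ n ] N ℕ.≤ n × (log (R n x) - log (fromℕ n)) / log (log (fromℕ n)) < r

      conclude : ∀ r N → ∃[ K ] (0# ≤ K × r ±≤ K) → Low r N
      conclude r N (K , 0≤K , -K≤r , _) = pick (loglog-unbounded U 0≤U)
        where
        U : ℝ
        U = (two * K + log (fromℕ 4)) + 1#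

        0≤U : 0# ≤ U
        0≤U = +-nonneg (+-nonneg (*-nonneg (<⇒≤ 0<two) 0≤K) (log-nonneg (1≤fromℕ {4} (s≤s z≤n)))) 0≤1

        pick : ∃[ N′ ] (∀ n → N′ ℕ.≤ n → 1# ≤ log (fromℕ n) × U ≤ loglog n) → Low r N
        pick (N′ , large) = at (small-often s ¬large (N ℕ.+ N′))
          where
          at : ∃[ k ] N ℕ.+ N′ ℕ.≤ k × Along s k (below 2 (s≤s z≤n)) → Low r N
          -- Orbit positions start at 0 and `R` at 1, so position k concerns `R (suc k)`.
          at (k , N+N′≤k , small) = suc k , ℕ.≤-trans (ℕ.m≤m+n N N′) (ℕ.m≤n⇒m≤1+n N+N′≤k) , <-≤-trans
            (ratio-R<-K (suc k) 0≤K (1≤R s scale≡1 k) (R-upper s scale≡1 k 2 (s≤s z≤n) small) (proj₁ bounds) (proj₂ bounds)) -K≤r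
            where
            bounds : 1# ≤ log (fromℕ (suc k)) × U ≤ loglog (suc k)
            bounds = large (suc k) (ℕ.≤-trans (ℕ.m≤n+m N′ N) (ℕ.m≤n⇒m≤1+n N+N′≤k))

    -- At n = `sparse i` the excess of log M_n over log n is at most (i + 1) log 2, while log log n
    -- ≥ i² log 2.
    upper-M : ∃[ I ] (∀ i → I ℕ.≤ i → ¬ SomeHuge (sparse i) (1≤sparse i) i s) →
      ∀ ε → 0# < ε → ∀ N → ∃[ n ] N ℕ.≤ n × (log (M n x) - log (fromℕ n)) / log (log (fromℕ n)) ≤ ε
    upper-M (I , ¬huge) ε 0<ε N = pick (recip-below 0<ε)
      where
      pick : ∃[ k ] (1 ℕ.≤ k × recip k < ε) → ∃[ n ] N ℕ.≤ n × (log (M n x) - log (fromℕ n)) / log (log (fromℕ n)) ≤ ε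
      pick (k , 1≤k , 1/k<ε) = n , ℕ.≤-trans (ℕ.m≤n+m N _) (i≤sparse i) , /-≤ 0<u (begin
          log (M n x) - log (fromℕ n)                   ≤⟨ ≤-from (x≤y⇒0≤y-x logM≤) (solve 4 (λ a l n i → (l :+ (n :+ i :* l)) :- a := (con (+ 1) :+ i) :* l :- (a :- n)) refl (log (M n x)) λ₂ (log (fromℕ n)) (fromℕ i)) ⟩
          fromℕ (suc i) * λ₂                            ≤⟨ *-monoʳ-≤ (<⇒≤ λ₂-pos) (fraction-≤ k (suc i) (square i) (<⇒≤ 1/k<ε) 1≤k k[1+i]≤i²) ⟩
          ε * fromℕ (square i) * λ₂                     ≈⟨ *-assoc _ _ _ ⟩
          ε * (fromℕ (square i) * λ₂)                   ≤⟨ *-monoˡ-≤ (<⇒≤ 0<ε) (loglog-2^2^ (square i) n ℕ.≤-refl) ⟩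
          ε * loglog n                                  ≈⟨ *-comm _ _ ⟩
          loglog n * ε                                  ∎)
        where
        open ≤-Reasoning
        i n : ℕ
        -- i ≥ 2k gives k (1 + i) ≤ 2k i ≤ i²; i ≥ I excludes the huge ratios, and i ≥ N makes n ≥
        -- N.
        i = ((k ℕ.+ k) ℕ.+ I) ℕ.+ N
        n = sparse i

        k+k≤i : k ℕ.+ k ℕ.≤ i
        k+k≤i = ℕ.≤-trans (ℕ.m≤m+n (k ℕ.+ k) I) (ℕ.m≤m+n _ N)

        1≤i : 1 ℕ.≤ i
        1≤i = ℕ.≤-trans 1≤k (ℕ.≤-trans (ℕ.m≤m+n k k) k+k≤i)

        k[1+i]≤i² : k ℕ.* suc i ℕ.≤ square i
        k[1+i]≤i² = ℕ.≤-trans (ℕ.*-monoʳ-≤ k (ℕ.+-monoˡ-≤ i 1≤i)) (ℕ.≤-trans (ℕ.≤-reflexive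
          (≡.trans (ℕ.*-distribˡ-+ k i i) (≡.sym (ℕ.*-distribʳ-+ i k k)))) (ℕ.*-monoˡ-≤ i k+k≤i))

        0<u : 0# < loglog n
        0<u = <-≤-trans (*-pos (fromℕ-pos′ (ℕ.*-mono-≤ 1≤i 1≤i)) λ₂-pos) (loglog-2^2^ (square i) n ℕ.≤-refl)

        M≤2n2^i : M n x ≤ fromℕ (2 ℕ.* (n ℕ.* 2 ℕ.^ i))
        M≤2n2^i = M-upper n (1≤sparse i) (λ k k<n → R-upper s scale≡1 k (n ℕ.* 2 ℕ.^ i) (1≤n*2^ (1≤sparse i) i)
          (ℕ.≰⇒> (λ huge → ¬huge i (ℕ.≤-trans (ℕ.m≤n+m I _) (ℕ.m≤m+n _ N)) (k , k<n , huge))))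

        logM≤ : log (M n x) ≤ λ₂ + (log (fromℕ n) + fromℕ i * λ₂)
        logM≤ = ≤-trans (log-mono-≤ (1≤M′ n (1≤sparse i)) M≤2n2^i) (≤-reflexive
          (trans (log-fromℕ-* {2} {n ℕ.* 2 ℕ.^ i} (s≤s z≤n) (1≤n*2^ (1≤sparse i) i))
            (+-congˡ (trans (log-fromℕ-* (1≤sparse i) (1≤2^n i)) (+-congˡ (log-2^ i))))))

    -- Here log n exceeds log M_n by at most (l + 5) log 2, which is small against log log n, of
    -- order at least l².
    lower-M : ∃[ I ] (∀ i → I ℕ.≤ i → ¬ AllSmall i s) →
      ∀ ε → 0# < ε → ∃[ N ] (∀ n → N ℕ.≤ n → - ε ≤ (log (M n x) - log (fromℕ n)) / log (log (fromℕ n)))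
    lower-M (I , ¬small) ε 0<ε = from (recip-below 0<ε)
      where
      Bound : ℕ → Set
      Bound n = - ε ≤ (log (M n x) - log (fromℕ n)) / log (log (fromℕ n))

      from : ∃[ k ] (1 ℕ.≤ k × recip k < ε) → ∃[ N ] (∀ n → N ℕ.≤ n → Bound n)
      from (k₀ , 1≤k₀ , 1/k₀<ε) = 2 ℕ.^ (2 ℕ.^ square l₀) , λ n N≤n → locate n (bracket (2 ℕ.^_) n<2^n (2 ℕ.^ square l₀) n N≤n)
        where
        l₀ : ℕ
        -- For l ≥ k₀ + 6 one gets 1 + k₀ (l + 5) ≤ l + k₀ l + 5 l = (k₀ + 6) l ≤ l², so (l + 5) /
        -- (l² - 1) is at most 1/k₀ < ε.
        l₀ = (k₀ ℕ.+ 6) ℕ.+ I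

        locate : ∀ n → ∃[ J ] 2 ℕ.^ square l₀ ℕ.≤ J × 2 ℕ.^ J ℕ.≤ n × n ℕ.< 2 ℕ.^ suc J → Bound n
        -- J is the integer part of log₂ n, and the second search brackets log₂ J between
        -- consecutive squares l² and (l + 1)².
        locate n (J , l₀≤J , 2^J≤n , n<2^J+1) = split (bracket (λ l → 2 ℕ.^ square l) (λ l → ℕ.≤-<-trans (n≤square l) (n<2^n (square l))) l₀ J l₀≤J)
          where
          split : ∃[ l ] l₀ ℕ.≤ l × 2 ℕ.^ square l ℕ.≤ J × J ℕ.< 2 ℕ.^ square (suc l) → Bound n
          split (l , l₀≤l , l²≤J , J<) = refine (large-exists s l (¬small l (ℕ.≤-trans (ℕ.m≤n+m I (k₀ ℕ.+ 6)) l₀≤l)) j j<)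
            where
            open ≤-Reasoning
            k₀+6≤l : k₀ ℕ.+ 6 ℕ.≤ l
            k₀+6≤l = ℕ.≤-trans (ℕ.m≤m+n _ I) l₀≤l

            k₀[l+5]<l² : suc (k₀ ℕ.* (l ℕ.+ 5)) ℕ.≤ square l
            k₀[l+5]<l² = ℕ.≤-trans (ℕ.≤-trans (ℕ.+-mono-≤ (ℕ.≤-trans 1≤k₀ (ℕ.≤-trans (ℕ.m≤m+n k₀ 6) k₀+6≤l))
                (ℕ.≤-trans (ℕ.≤-reflexive (ℕ.*-distribˡ-+ k₀ l 5)) (ℕ.+-monoʳ-≤ (k₀ ℕ.* l) (ℕ.*-monoˡ-≤ 5 (ℕ.≤-trans (ℕ.m≤m+n k₀ 6) k₀+6≤l)))))
              (ℕ.≤-reflexive (+-*-Solver.solve 2 (λ k l → l :+ℕ (k :*ℕ l :+ℕ l :*ℕ conℕ 5) :=ℕ (k :+ℕ conℕ 6) :*ℕ l) ≡.refl k₀ l)))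
              (ℕ.*-monoˡ-≤ l k₀+6≤l)
              where open +-*-Solver using () renaming (_:+_ to _:+ℕ_; _:*_ to _:*ℕ_; con to conℕ; _:=_ to _:=ℕ_)

            -- j = J - (l + 3), so the 2^(l+3) 2^j = 2^J steps fit among the first n. `R-lower`
            -- halves the level, hence j′ = j - 1. The predecessor p of l² absorbs the exponent lost
            -- in `loglog-2^2^`.
            p j′ j : ℕ
            p = ℕ.pred (square l)
            j′ = J ℕ.∸ (l ℕ.+ 4)
            j = suc j′

            l²≡1+p : square l ≡ suc p
            l²≡1+p with square l | k₀[l+5]<l²
            ... | suc _ | _ = ≡.refl

            k₀[l+5]≤p : k₀ ℕ.* (l ℕ.+ 5) ℕ.≤ p
            k₀[l+5]≤p = ℕ.s≤s⁻¹ (≡.subst (suc (k₀ ℕ.* (l ℕ.+ 5)) ℕ.≤_) l²≡1+p k₀[l+5]<l²)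

            l+5≤p : l ℕ.+ 5 ℕ.≤ p
            l+5≤p = ℕ.≤-trans (ℕ.≤-trans (ℕ.≤-reflexive (≡.sym (ℕ.*-identityˡ _))) (ℕ.*-monoˡ-≤ (l ℕ.+ 5) 1≤k₀)) k₀[l+5]≤p

            l+4≤J : l ℕ.+ 4 ℕ.≤ J
            l+4≤J = ℕ.≤-trans (ℕ.≤-trans (ℕ.+-monoʳ-≤ l (ℕ.n≤1+n 4)) (ℕ.≤-trans l+5≤p (ℕ.pred[n]≤n {square l})))
              (ℕ.≤-trans (ℕ.<⇒≤ (n<2^n (square l))) l²≤J)

            J≡ : (l ℕ.+ 3) ℕ.+ j ≡ J
            J≡ = ≡.trans (ℕ.+-suc (l ℕ.+ 3) j′) (≡.trans (≡.cong (ℕ._+ j′) (≡.sym (ℕ.+-suc l 3))) (ℕ.m+[n∸m]≡n l+4≤J))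

            j< : j ℕ.< 2 ℕ.^ square (suc l)
            j< = ℕ.≤-<-trans (≡.subst (j ℕ.≤_) J≡ (ℕ.m≤n+m j (l ℕ.+ 3))) J<

            pλ≤u : fromℕ p * λ₂ ≤ loglog n
            pλ≤u = loglog-2^2^ p n (ℕ.≤-trans (ℕ.^-monoʳ-≤ 2 (≡.subst (λ e → 2 ℕ.^ e ℕ.≤ J) l²≡1+p l²≤J)) 2^J≤n)

            0<u : 0# < loglog n
            0<u = <-≤-trans (*-pos (fromℕ-pos′ (ℕ.≤-trans (ℕ.≤-trans (s≤s z≤n) (ℕ.m≤n+m 5 l)) l+5≤p)) λ₂-pos) pλ≤u

            refine : ∃[ k ] k ℕ.< 2 ℕ.^ (l ℕ.+ 3) ℕ.* 2 ℕ.^ j × Along s k (atLeast (2 ℕ.^ j) (1≤2^n j)) → Bound n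
            refine (k , k< , large) = ≤-/ 0<u (begin
              loglog n * (- ε)               ≈⟨ solve 2 (λ u e → u :* (:- e) := :- (e :* u)) refl (loglog n) ε ⟩
              - (ε * loglog n)               ≤⟨ ≤-from (x≤y⇒0≤y-x deficit) (solve 2 (λ a b → b :- a := :- a :- (:- b)) refl (fromℕ (l ℕ.+ 5) * λ₂) (ε * loglog n)) ⟩
              - (fromℕ (l ℕ.+ 5) * λ₂)       ≈⟨ solve 3 (λ j l λ₂ → :- (l :* λ₂) := j :* λ₂ :- (j :+ l) :* λ₂) refl (fromℕ j′) (fromℕ (l ℕ.+ 5)) λ₂ ⟩
              fromℕ j′ * λ₂ - (fromℕ j′ + fromℕ (l ℕ.+ 5)) * λ₂   ≤⟨ +-mono-≤ logM≥ (≤-from (x≤y⇒0≤y-x logn≤) (solve 2 (λ a b → b :- a := :- a :- (:- b)) refl (log (fromℕ n)) _)) ⟩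
              log (M n x) - log (fromℕ n)    ∎)
              where
              k<n : k ℕ.< n
              k<n = ℕ.<-≤-trans k< (ℕ.≤-trans (ℕ.≤-reflexive (≡.trans (≡.sym (ℕ.^-distribˡ-+-* 2 (l ℕ.+ 3) j)) (≡.cong (2 ℕ.^_) J≡))) 2^J≤n)

              logM≥ : fromℕ j′ * λ₂ ≤ log (M n x)
              logM≥ = ≤-trans (≤-reflexive (sym (log-2^ j′))) (log-mono-≤ (1≤fromℕ (1≤2^n j′)) (≤-trans (R-lower s scale≡1 k (2 ℕ.^ j′) (1≤2^n j) large) (M-lower n k k<n)))

              1+J≡ : suc J ≡ j′ ℕ.+ (l ℕ.+ 5)
              1+J≡ = ≡.trans (≡.cong suc (≡.sym (ℕ.m+[n∸m]≡n l+4≤J))) (≡.trans (≡.cong (ℕ._+ j′) (≡.sym (ℕ.+-suc l 4))) (ℕ.+-comm (l ℕ.+ 5) j′))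

              logn≤ : log (fromℕ n) ≤ (fromℕ j′ + fromℕ (l ℕ.+ 5)) * λ₂
              logn≤ = ≤-trans (log-mono-≤ (1≤fromℕ (ℕ.≤-trans (s≤s z≤n) k<n)) (fromℕ-mono-≤ (ℕ.<⇒≤ n<2^J+1)))
                (≤-reflexive (trans (log-2^ (suc J)) (*-congʳ (trans (reflexive (≡.cong fromℕ 1+J≡)) (fromℕ-+ j′ (l ℕ.+ 5))))))

              deficit : fromℕ (l ℕ.+ 5) * λ₂ ≤ ε * loglog n
              deficit = ≤-trans (*-monoʳ-≤ (<⇒≤ λ₂-pos) (fraction-≤ k₀ (l ℕ.+ 5) p (<⇒≤ 1/k₀<ε) 1≤k₀ k₀[l+5]≤p))
                (≤-trans (≤-reflexive (*-assoc _ _ _)) (*-monoˡ-≤ (<⇒≤ 0<ε) pλ≤u))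

  initial : ∀ {x} → Generic x → 0# < x → x < 1# → State
  initial {x} generic-x 0<x x<1 = record
    { point   = x
    ; scale   = 1
    ; 1≤scale = s≤s z≤n
    ; generic = generic-x
    ; 0<point = 0<x
    ; point<  = <-respʳ-≈ (sym recip-1) x<1
    }

  Conclusion : ℝ → Set
  Conclusion x = Irrational x ×
      IsLiminf (λ n → (log (R n x) - log (fromℕ n)) / log (log (fromℕ n))) ⊥± ×
      IsLiminf (λ n → (log (M n x) - log (fromℕ n)) / log (log (fromℕ n))) [ 0# ]

  Exceptional : ℝ → Set
  Exceptional x = ¬ Generic x ⊎ Starting AlwaysLarge x ⊎
    (∀ N → ∃[ i ] N ℕ.≤ i × Starting (SomeHuge (sparse i) (1≤sparse i) i) x) ⊎
    (∀ N → ∃[ i ] N ℕ.≤ i × Starting (AllSmall i) x)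

  null-exceptional : Null Exceptional
  null-exceptional = null-∪ null-nongeneric (null-∪ null-alwaysLarge
    (null-∪ (borel-cantelli (λ i → cover-someHuge (sparse i) (1≤sparse i) i)) (borel-cantelli cover-allSmall)))

  unexceptional : ∀ x s → point s ≡ x → scale s ≡ 1 → ¬ Exceptional x → Conclusion x
  unexceptional x s ≡.refl scale≡1 ¬exceptional =
    generic⇒irrational (generic s) ,
    liminf-R s scale≡1 (λ large → ¬exceptional (inj₂ (inj₁ (s , ≡.refl , scale≡1 , large)))) ,
    liminf-0
      (lower-M s scale≡1 (eventually-not λ often → ¬exceptional (inj₂ (inj₂ (inj₂ λ N → start (often N))))))
      (upper-M s scale≡1 (eventually-not λ often → ¬exceptional (inj₂ (inj₂ (inj₁ λ N → start (often N))))))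
    where
    start : ∀ {P : ℕ → State → Set} {N} → ∃[ i ] N ℕ.≤ i × P i s → ∃[ i ] N ℕ.≤ i × Starting (P i) (point s)
    start (i , N≤i , Ps) = i , N≤i , s , ≡.refl , scale≡1 , Ps

  almostAll : AlmostAll Conclusion
  almostAll = null-⊆ exceptional null-exceptional
    where
    exceptional : ∀ x → 0# < x × x < 1# × ¬ Conclusion x → Exceptional x
    -- Outside the exceptional set the alternative `¬ Generic x` would nevertheless hold, because
    -- genericity would give the conclusion; this contradiction puts x in the set.
    exceptional x (0<x , x<1 , ¬conclusion) = by-contradiction {Exceptional x} λ ¬exceptional → ¬exceptional (inj₁ λ generic →
      ¬conclusion (unexceptional x (initial {x} generic 0<x x<1) ≡.refl ≡.refl ¬exceptional))

theorem1p8 : (lem : ExcludedMiddle 0ℓ) (reals : CompleteOrderedField) →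
    let open SignedEngel lem reals in
    AlmostAll (λ x → Irrational x ×
    IsLiminf (λ n → (log (R n x) - log (fromℕ n)) / log (log (fromℕ n))) ⊥± ×
    IsLiminf (λ n → (log (M n x) - log (fromℕ n)) / log (log (fromℕ n))) [ 0# ])
theorem1p8 lem reals = Theorem.almostAll lem reals
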